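{- Let $\mathbb{F}_q$ be a finite field, let $a\in\mathbb{F}_q$ be a non-square in $\mathbb{F}_q$, let $b\in\mathbb{F}_{q^2}\setminus\mathbb{F}_q$ satisfy $b^2=a$, and let $n$ be a positive integer such that $\operatorname{rad}(n)$ divides $q-1$. Then for every irreducible factor $f(x)$ of $D_n(x,a)$ in $\mathbb{F}_q[x]$ there exist $\alpha\in\mathbb{F}_{q^2}^*$ and a positive divisor $t$ of $\frac{4n}{\gcd(4n,q^2-1)}$ satisfying (i) $\alpha^{2n/t}=-1$, (ii) $\operatorname{rad}(t)$ divides $\operatorname{ord}_{q^2}(\alpha)$, (iii) $\gcd\left(t,\frac{q^2-1}{\operatorname{ord}_{q^2}(\alpha)}\right)=1$, such that $f(x)$ is of the following form: (a) $f(x)=D_t(x,a)-b^t(\alpha+\alpha^{ -1})$ in the case that either $t$ is even and ($\alpha\in\mathbb{F}_q^*$ or $\alpha^{q+1}=1$), or $t$ is odd and ($\alpha^{q-1}=-1$ or $\alpha^{q+1}=-1$); (b) $f(x)=\left(D_t(x,a)-b^t(\alpha+\alpha^{ -1})\right)\left(D_t(x,a)-b^{qt}(\alpha^q+\alpha^{ -q})\right)$ otherwise.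
   Context: For $n\ge 1$ and $a\in\mathbb{F}_q$, the $n$-th Dickson polynomial of the first kind with parameter $a$ is $D_n(x,a)=\sum_{i=0}^{\lfloor n/2\rfloor}\frac{n}{n-i}\binom{n-i}{i}(-a)^i x^{n-2i}\in\mathbb{F}_q[x]$ (the numbers $\frac{n}{n-i}\binom{n-i}{i}$ are integers, viewed in $\mathbb{F}_q$). $\operatorname{rad}(n)$ is the product of the distinct primes dividing $n$, with $\operatorname{rad}(1)=1$. $\operatorname{ord}_{q^2}(\alpha)$ is the multiplicative order of $\alpha$ in the cyclic group $\mathbb{F}_{q^2}^*$. Irreducible factors are normalized to be monic. (The existence of a non-square forces $q$ to be odd.) -}

module Defs where

open import Algebra.Bundles using (CommutativeRing; RawRing)
open import Algebra.Definitions using (Invertible)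
open import Algebra.Morphism.Structures using (module RingMorphisms)
import Algebra.Definitions.RawMonoid as RawMonoidDefs
import Algebra.Definitions.RawSemiring as RawSemiringDefs
open import Data.Fin.Base using (Fin; toℕ)
open import Data.Fin.Properties using (toℕ≤pred[n])
open import Data.List.Base as List using (List; []; _∷_; upTo; filter; replicate; _++_)
open import Data.Nat.Base as ℕ using (ℕ; zero; suc; NonZero; ⌊_/2⌋; ≢-nonZero; ≢-nonZero⁻¹)
import Data.Nat.Properties as ℕₚ
open import Data.Nat.Combinatorics using (_C_)
open import Data.Nat.Divisibility using (_∣_; _∣?_)
open import Data.Nat.DivMod using (_/_)
open import Data.Nat.GCD using (gcd; gcd[m,n]≢0)
open import Data.Nat.ListAction using (product)
open import Data.Nat.Primality using (prime?)
open import Data.Product.Base using (_×_; ∃-syntax; proj₁)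
open import Data.Sum.Base using (inj₁)
open import Function.Bundles using (Inverse)
open import Level using (Level; _⊔_) renaming (suc to lsuc)
open import Relation.Binary.PropositionalEquality using (_≡_; _≢_; setoid)
open import Relation.Nullary.Decidable using (_×-dec_)
open import Relation.Nullary.Negation.Core using (¬_)

private
  variable
    c ℓ c′ ℓ′ : Level

rad : ℕ → ℕ
rad n = product (filter (λ p → prime? p ×-dec p ∣? n) (upTo (suc n)))

gcd[4n,m]≢0 : ∀ n m .{{_ : NonZero n}} → NonZero (gcd (4 ℕ.* n) m)
gcd[4n,m]≢0 n m =
  ≢-nonZero (gcd[m,n]≢0 (4 ℕ.* n) m (inj₁ (≢-nonZero⁻¹ (4 ℕ.* n) {{ℕₚ.m*n≢0 4 n}})))

record FiniteField (c ℓ : Level) : Set (lsuc (c ⊔ ℓ)) where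
  field
    commutativeRing : CommutativeRing c ℓ

  open CommutativeRing commutativeRing public renaming (setoid to ≈-setoid)
  open RawSemiringDefs (RawRing.rawSemiring rawRing) public using (_^_)

  field
    1≉0         : 1# ≉ 0#
    invertible  : ∀ x → x ≉ 0# → Invertible _≈_ 1# _*_ x
    size        : ℕ
    enumeration : Inverse ≈-setoid (setoid (Fin size))

  inv : ∀ x → x ≉ 0# → Carrier
  inv x x≉0 = proj₁ (invertible x x≉0)

  IsSquare : Carrier → Set (c ⊔ ℓ)
  IsSquare x = ∃[ y ] y ^ 2 ≈ x

  record IsOrder (x : Carrier) (m : ℕ) : Set ℓ where
    field
      nonZero : NonZero m
      x^m≈1   : x ^ m ≈ 1#
      minimal : ∀ k → .{{_ : NonZero k}} → x ^ k ≈ 1# → m ℕ.≤ k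

-- A field with q² elements containing a given field F with q elements; the
-- inclusion is an explicit embedding ι.
record QuadraticExtension (F : FiniteField c ℓ) (c′ ℓ′ : Level)
       : Set (c ⊔ ℓ ⊔ lsuc (c′ ⊔ ℓ′)) where
  private module F = FiniteField F

  field
    extension : FiniteField c′ ℓ′

  open FiniteField extension public

  open RingMorphisms F.rawRing rawRing using (IsRingMonomorphism)

  field
    ι                  : F.Carrier → Carrier
    isRingMonomorphism : IsRingMonomorphism ι
    size≡              : size ≡ F.size ℕ.^ 2

  InBase : Carrier → Set (c ⊔ ℓ′)
  InBase x = ∃[ y ] ι y ≈ x

-- Univariate polynomials as coefficient lists, constant term first. Trailing
-- zeros are permitted, so the equality compares all coefficients.
module Polynomial (R : RawRing c ℓ) where
  open RawRing R
  open RawSemiringDefs rawSemiring using (_^_) renaming (_×_ to _·_)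

  Poly : Set c
  Poly = List Carrier

  coeff : Poly → ℕ → Carrier
  coeff []      _       = 0#
  coeff (x ∷ p) zero    = x
  coeff (x ∷ p) (suc k) = coeff p k

  infix  4 _≈ᴾ_
  infixl 6 _+ᴾ_ _-ᴾ_
  infixl 7 _*ᴾ_

  _≈ᴾ_ : Poly → Poly → Set ℓ
  p ≈ᴾ q = ∀ k → coeff p k ≈ coeff q k

  _+ᴾ_ : Poly → Poly → Poly
  []      +ᴾ q       = q
  (x ∷ p) +ᴾ []      = x ∷ p
  (x ∷ p) +ᴾ (y ∷ q) = (x + y) ∷ (p +ᴾ q)

  -ᴾ_ : Poly → Poly
  -ᴾ_ = List.map -_

  _-ᴾ_ : Poly → Poly → Poly
  p -ᴾ q = p +ᴾ (-ᴾ q)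

  _*ᴾ_ : Poly → Poly → Poly
  []      *ᴾ q = []
  (x ∷ p) *ᴾ q = List.map (x *_) q +ᴾ (0# ∷ (p *ᴾ q))

  monomial : Carrier → ℕ → Poly
  monomial x k = replicate k 0# ++ (x ∷ [])

  constant : Carrier → Poly
  constant x = monomial x 0

  polyRawRing : RawRing c ℓ
  polyRawRing = record
    { Carrier = Poly
    ; _≈_     = _≈ᴾ_
    ; _+_     = _+ᴾ_
    ; _*_     = _*ᴾ_
    ; -_      = -ᴾ_
    ; 0#      = []
    ; 1#      = constant 1#
    }

  open RawSemiringDefs (RawRing.rawSemiring polyRawRing) public
    using (Irreducible) renaming (_∣_ to _∣ᴾ_)
  open RawMonoidDefs (RawRing.+-rawMonoid polyRawRing) using ()
    renaming (sum to sumᴾ)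

  Monic : Poly → Set ℓ
  Monic p = ∃[ d ] coeff p d ≈ 1# × (∀ k → d ℕ.< k → coeff p k ≈ 0#)

  private
    n∸i≢0 : ∀ n .{{_ : NonZero n}} (i : Fin (suc ⌊ n /2⌋)) → NonZero (n ℕ.∸ toℕ i)
    n∸i≢0 (suc n) i = ≢-nonZero (ℕₚ.m>n⇒m∸n≢0
      (ℕₚ.≤-<-trans (toℕ≤pred[n] i) (ℕₚ.⌊n/2⌋<n n)))

  -- The integer n/(n-i) · binom(n-i, i); the division of naturals is exact.
  dicksonNumber : ∀ n .{{_ : NonZero n}} → Fin (suc ⌊ n /2⌋) → ℕ
  dicksonNumber n i =
    _/_ (n ℕ.* ((n ℕ.∸ toℕ i) C toℕ i)) (n ℕ.∸ toℕ i) {{n∸i≢0 n i}}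

  dickson : ∀ n .{{_ : NonZero n}} → Carrier → Poly
  dickson n a = sumᴾ {suc ⌊ n /2⌋} λ i →
    monomial (dicksonNumber n i · ((- a) ^ toℕ i)) (n ℕ.∸ 2 ℕ.* toℕ i)

{-# OPTIONS --safe #-}

-- Over an extension of 𝔽_{q²} write a root of f as x = b(z + 1/z). Since
-- D_k(b(z + 1/z), a) = b^k (z^k + z^{-k}), the divisibility f ∣ D_n says z^{2n} = −1.
-- Let t be the least positive exponent with z^t ∈ 𝔽_{q²} and α = z^t. Because z^m lies
-- in 𝔽_{q²} exactly when z^{m(q²−1)} = 1, a prime p ∣ t dividing (q²−1)/ord α would put
-- z^{t/p} into 𝔽_{q²}; this gives (ii), (iii) and the bound on t.
-- The polynomial D_t − b^t(α + 1/α) has the root x; in case (a) it has coefficients in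
-- 𝔽_q, and otherwise its product with its conjugate has. So it remains to bound deg f
-- from below. Two of x, x^q, …, x^{q^d} (d = deg f) coincide, hence x^{q^s} = x with
-- 0 < s ≤ d. For even s = 2h this forces z^{q^s} = z (or α² = 1 and t = 1), so t divides
-- 1 + q² + … + q^{2(h−1)}, and by lifting the exponent t ∣ h, whence 2t ≤ d.
-- For odd s it forces z^{q^s} = −z^{±1}; then t ∣ s is odd and α^q = −α^{±1}, which is
-- case (a), and t ≤ d.
-- The extension is 𝔽_{q²}[Z]/(h) for a least-degree monic nonconstant divisor h of
-- Z^d b^{-d} f(b(Z + 1/Z)), found by exhaustive search.
module Submission where

open import Defs
open import Algebra.Bundles using (CommutativeRing; RawRing)
import Algebra.Definitions.RawMagma as RawMagmaDefs
import Algebra.Definitions.RawMonoid as RawMonoidDefs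
import Algebra.Definitions.RawSemiring as RawSemiringDefs
import Algebra.Morphism.Construct.Composition as Composition
open import Algebra.Morphism.Structures using (module RingMorphisms)
import Algebra.Properties.CommutativeMonoid.Sum as CommutativeMonoidSum
import Algebra.Properties.CommutativeSemiring.Exp
import Algebra.Properties.Ring
import Algebra.Properties.Semiring.Exp
import Algebra.Properties.Semiring.Mult
import Algebra.Properties.Semiring.Sum
import Algebra.Solver.CommutativeMonoid as CommutativeMonoidSolver
import Algebra.Solver.Ring as RingSolver
open import Algebra.Solver.Ring.AlmostCommutativeRing
  using (_-Raw-AlmostCommutative⟶_; fromCommutativeRing)
open import Data.Empty using (⊥; ⊥-elim)
open import Data.Fin.Base as Fin using (Fin; toℕ; punchIn)
open import Data.Fin.Permutation as Perm using (Permutation; permutation; _⟨$⟩ʳ_)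
import Data.Fin.Properties as Finₚ
open import Data.List.Base as List using ([]; _∷_; map; length; _++_)
import Data.List.Membership.Propositional.Properties as Membershipₚ
import Data.List.Properties as Listₚ
open import Data.List.Relation.Unary.All as All using (All; []; _∷_)
import Data.List.Relation.Unary.All.Properties as Allₚ
open import Data.List.Relation.Unary.AllPairs using ([]; _∷_)
open import Data.List.Relation.Unary.Unique.Propositional using (Unique)
import Data.List.Relation.Unary.Unique.Propositional.Properties as Uniqueₚ
open import Data.Maybe.Base using (Maybe; just; nothing)
open import Data.Nat.Base as ℕ using (ℕ; zero; suc; NonZero; ⌊_/2⌋; z≤n; s≤s)
open import Data.Nat.Combinatorics using (_C_)
import Data.Nat.Combinatorics as Comb
open import Data.Nat.Coprimality using (coprime-divisor; gcd≡1⇒coprime)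
open import Data.Nat.Divisibility as Div using (_∣_; divides)
open import Data.Nat.DivMod as DivMod using (_/_; _%_)
open import Data.Nat.GCD using (gcd)
import Data.Nat.GCD as GCD
open import Data.Nat.ListAction using (product)
open import Data.Nat.ListAction.Properties using (∈⇒∣product)
open import Data.Nat.Primality as Prime using (Prime; prime?)
open import Data.Nat.Primality.Factorisation using (factorise)
import Data.Nat.Properties as ℕₚ
open import Data.Nat.Tactic.RingSolver using (solve-∀)
open import Data.Product.Base using (Σ-syntax; ∃; ∃-syntax; _×_; _,_; proj₁; proj₂)
open import Data.Sum.Base using (_⊎_; inj₁; inj₂; [_,_]′)
open import Data.Vec.Base as Vec using (Vec; []; _∷_; toList; _∷ʳ_)
import Data.Vec.Properties as Vecₚ
open import Data.Vec.Relation.Binary.Pointwise.Inductive as Pointwise using (Pointwise; []; _∷_)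
open import Function.Base using (_∘_; id; _$_; case_of_)
open import Function.Bundles using (Inverse)
open import Level using (Level; _⊔_)
open import Relation.Binary.Definitions using (Decidable; tri<; tri≈; tri>)
open import Relation.Binary.PropositionalEquality as ≡ using (_≡_; _≢_)
import Relation.Binary.Reasoning.Setoid as SetoidReasoning
open import Relation.Nullary.Decidable using (Dec; yes; no; map′; _×-dec_)
open import Relation.Nullary.Negation using (¬_; contradiction)

-- The argument needs no field above 𝔽_{q²}: a domain with decidable equality containing it, and an
-- invertible z with f(b(z + 1/z)) = 0, are enough. A lower bound on deg f suffices because f is
-- irreducible: the polynomials over 𝔽_q vanishing at x form a proper ideal containing f, so a monic
-- member of degree at most deg f is f itself. This and the integrality of the quotient come from
-- one dichotomy for ideals, which replaces Bézout coefficients. The condition on rad(n) enters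
-- through t ∣ 2n: a prime divisor of t is 2 or divides q - 1, so in either case it divides q² - 1.
-- The prime 2 is the delicate one, both in lifting the exponent and when α² = 1; there 4 ∣ q² - 1
-- helps, which holds because q is odd. The characteristic is never named: additivity of u ↦ u^q
-- comes from counting roots.

private
  variable
    c ℓ c′ ℓ′ c″ ℓ″ : Level

-- Ring homomorphisms and a solver for commutative rings.

IsHom : (R : CommutativeRing c ℓ) (S : CommutativeRing c′ ℓ′) →
        (CommutativeRing.Carrier R → CommutativeRing.Carrier S) → Set (c ⊔ ℓ ⊔ ℓ′)
IsHom R S = RingMorphisms.IsRingHomomorphism (CommutativeRing.rawRing R) (CommutativeRing.rawRing S)

AreInverse : (R : CommutativeRing c ℓ) (x y : CommutativeRing.Carrier R) → Set ℓ
AreInverse R x y = x * y ≈ 1#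
  where open CommutativeRing R

module UnitPowers (R : CommutativeRing c ℓ) where
  open CommutativeRing R
  open Algebra.Properties.Semiring.Exp semiring

  1^k≈1 : ∀ k → 1# ^ k ≈ 1#
  1^k≈1 zero    = refl
  1^k≈1 (suc k) = trans (*-identityˡ _) (1^k≈1 k)

-- Coefficients are formal differences m − n of naturals, so that the solver can
-- decide which of them vanish in every ring.
module CommutativeRingSolver (R : CommutativeRing c ℓ) where
  open CommutativeRing R
  open Algebra.Properties.Ring ring
  open Algebra.Properties.Semiring.Mult semiring
    using (×-homo-+; ×1-homo-*; ×-congˡ) renaming (_×_ to _·_)
  open SetoidReasoning setoid

  private
    differences : RawRing _ _
    differences = record
      { Carrier = ℕ × ℕ
      ; _≈_     = λ (m , n) (m′ , n′) → m ℕ.+ n′ ≡ m′ ℕ.+ n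
      ; _+_     = λ (m , n) (m′ , n′) → m ℕ.+ m′ , n ℕ.+ n′
      ; _*_     = λ (m , n) (m′ , n′) → m ℕ.* m′ ℕ.+ n ℕ.* n′ , m ℕ.* n′ ℕ.+ n ℕ.* m′
      ; -_      = λ (m , n) → n , m
      ; 0#      = 0 , 0
      ; 1#      = 1 , 0
      }

    module D = RawRing differences

    ⟦_⟧ : D.Carrier → Carrier
    ⟦ m , n ⟧ = m · 1# - n · 1#

    open CommutativeMonoidSolver +-commutativeMonoid using (solve; _⊕_; _⊜_)

    [x+y]-[z+w] : ∀ x y z w → (x + y) - (z + w) ≈ (x - z) + (y - w)
    [x+y]-[z+w] x y z w = begin
      (x + y) - (z + w)        ≈⟨ +-congˡ (-‿+-comm z w) ⟨
      (x + y) + (- z + - w)    ≈⟨ solve 4 (λ x y z w → (x ⊕ y) ⊕ (z ⊕ w) ⊜ (x ⊕ z) ⊕ (y ⊕ w))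
                                    refl x y (- z) (- w) ⟩
      (x - z) + (y - w)        ∎

    +-homo : ∀ x y → ⟦ x D.+ y ⟧ ≈ ⟦ x ⟧ + ⟦ y ⟧
    +-homo (m , n) (m′ , n′) = begin
      (m ℕ.+ m′) · 1# - (n ℕ.+ n′) · 1#
        ≈⟨ +-cong (×-homo-+ 1# m m′) (-‿cong (×-homo-+ 1# n n′)) ⟩
      (m · 1# + m′ · 1#) - (n · 1# + n′ · 1#)
        ≈⟨ [x+y]-[z+w] _ _ _ _ ⟩
      ⟦ m , n ⟧ + ⟦ m′ , n′ ⟧ ∎

    ·1-homo : ∀ m m′ n n′ → (m ℕ.* m′ ℕ.+ n ℕ.* n′) · 1# ≈
              (m · 1#) * (m′ · 1#) + (n · 1#) * (n′ · 1#)
    ·1-homo m m′ n n′ = trans (×-homo-+ 1# (m ℕ.* m′) (n ℕ.* n′)) (+-cong (×1-homo-* m m′) (×1-homo-* n n′))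

    *-homo : ∀ x y → ⟦ x D.* y ⟧ ≈ ⟦ x ⟧ * ⟦ y ⟧
    *-homo (m , n) (m′ , n′) = begin
      (m ℕ.* m′ ℕ.+ n ℕ.* n′) · 1# - (m ℕ.* n′ ℕ.+ n ℕ.* m′) · 1#
        ≈⟨ +-cong (·1-homo m m′ n n′) (-‿cong (·1-homo m n′ n m′)) ⟩
      (a * a′ + b * b′) - (a * b′ + b * a′)
        ≈⟨ +-congˡ (-‿cong (+-comm _ _)) ⟩
      (a * a′ + b * b′) - (b * a′ + a * b′)
        ≈⟨ [x+y]-[z+w] _ _ _ _ ⟩
      (a * a′ - b * a′) + (b * b′ - a * b′)
        ≈⟨ +-congˡ (⁻¹-anti-homo‿- _ _) ⟨
      (a * a′ - b * a′) - (a * b′ - b * b′)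
        ≈⟨ +-cong ([y-z]x≈yx-zx _ _ _) (-‿cong ([y-z]x≈yx-zx _ _ _)) ⟨
      (a - b) * a′ - (a - b) * b′
        ≈⟨ x[y-z]≈xy-xz _ _ _ ⟨
      (a - b) * (a′ - b′) ∎
      where
      a = m · 1# ; a′ = m′ · 1# ; b = n · 1# ; b′ = n′ · 1#

    target = fromCommutativeRing R

    -- Agrees with ⟦_⟧, but sends the numerals 0 and 1 to 0# and 1# definitionally.
    ⟦_⟧₀₁ : D.Carrier → Carrier
    ⟦ 0 , 0 ⟧₀₁ = 0#
    ⟦ 1 , 0 ⟧₀₁ = 1#
    ⟦ x ⟧₀₁     = ⟦ x ⟧

    ⟦⟧₀₁≈⟦⟧ : ∀ x → ⟦ x ⟧₀₁ ≈ ⟦ x ⟧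
    ⟦⟧₀₁≈⟦⟧ (0 , 0)           = sym (-‿inverseʳ 0#)
    ⟦⟧₀₁≈⟦⟧ (1 , 0)           = sym (trans (+-cong (+-identityʳ 1#) -0#≈0#) (+-identityʳ 1#))
    ⟦⟧₀₁≈⟦⟧ (0 , suc n)       = refl
    ⟦⟧₀₁≈⟦⟧ (1 , suc n)       = refl
    ⟦⟧₀₁≈⟦⟧ (suc (suc m) , n) = refl

    morphism : differences -Raw-AlmostCommutative⟶ target
    morphism = record
      { ⟦_⟧    = ⟦_⟧₀₁
      ; +-homo = λ x y → trans (⟦⟧₀₁≈⟦⟧ (x D.+ y))
          (trans (+-homo x y) (sym (+-cong (⟦⟧₀₁≈⟦⟧ x) (⟦⟧₀₁≈⟦⟧ y))))
      ; *-homo = λ x y → trans (⟦⟧₀₁≈⟦⟧ (x D.* y))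
          (trans (*-homo x y) (sym (*-cong (⟦⟧₀₁≈⟦⟧ x) (⟦⟧₀₁≈⟦⟧ y))))
      ; -‿homo = λ x → trans (⟦⟧₀₁≈⟦⟧ (D.- x))
          (trans (sym (⁻¹-anti-homo‿- _ _)) (-‿cong (sym (⟦⟧₀₁≈⟦⟧ x))))
      ; 0-homo = refl
      ; 1-homo = refl
      }

    ⟦⟧-cong : ∀ x y → x D.≈ y → ⟦ x ⟧ ≈ ⟦ y ⟧
    ⟦⟧-cong (m , n) (m′ , n′) eq = begin
      a - b                   ≈⟨ +-identityʳ _ ⟨
      (a - b) + 0#            ≈⟨ +-congˡ (-‿inverseʳ b′) ⟨
      (a - b) + (b′ - b′)     ≈⟨ [x+y]-[z+w] _ _ _ _ ⟨
      (a + b′) - (b + b′)     ≈⟨ +-cong (trans (sym (×-homo-+ 1# m n′)) (trans (×-congˡ eq)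
        (×-homo-+ 1# m′ n))) (-‿cong (+-comm _ _)) ⟩
      (a′ + b) - (b′ + b)     ≈⟨ [x+y]-[z+w] _ _ _ _ ⟩
      (a′ - b′) + (b - b)     ≈⟨ +-congˡ (-‿inverseʳ b) ⟩
      (a′ - b′) + 0#          ≈⟨ +-identityʳ _ ⟩
      a′ - b′                 ∎
      where
      a = m · 1# ; a′ = m′ · 1# ; b = n · 1# ; b′ = n′ · 1#

    weaklyDecidable : ∀ x y → Maybe (⟦ x ⟧₀₁ ≈ ⟦ y ⟧₀₁)
    weaklyDecidable x@(m , n) y@(m′ , n′) with (m ℕ.+ n′) ℕₚ.≟ (m′ ℕ.+ n)
    ... | yes eq = just (trans (⟦⟧₀₁≈⟦⟧ x) (trans (⟦⟧-cong x y eq) (sym (⟦⟧₀₁≈⟦⟧ y))))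
    ... | no _   = nothing

  open RingSolver differences target morphism weaklyDecidable public
    using (solve; _:=_; _:+_; _:*_; _:-_; :-_; _:^_; con)

-- The polynomial ring over a commutative ring.

module PolynomialRing (R : CommutativeRing c ℓ) where
  open CommutativeRing R
  open Polynomial rawRing public
  open Algebra.Properties.Ring ring using (-0#≈0#)
  open CommutativeRingSolver R

  -- Unlike _≈ᴾ_, which unfolds to a function type, this record lets Agda infer
  -- the polynomials from an equality proof.
  infix 4 _≋_
  record _≋_ (p q : Poly) : Set ℓ where
    constructor mk≋
    field at : p ≈ᴾ q
  open _≋_ public

  scale : Carrier → Poly → Poly
  scale x = map (x *_)

  coeff-+ : ∀ p q k → coeff (p +ᴾ q) k ≈ coeff p k + coeff q k
  coeff-+ []      q       k       = sym (+-identityˡ _)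
  coeff-+ (x ∷ p) []      k       = sym (+-identityʳ _)
  coeff-+ (x ∷ p) (y ∷ q) zero    = refl
  coeff-+ (x ∷ p) (y ∷ q) (suc k) = coeff-+ p q k

  coeff-neg : ∀ p k → coeff (-ᴾ p) k ≈ - coeff p k
  coeff-neg []      k       = sym -0#≈0#
  coeff-neg (x ∷ p) zero    = refl
  coeff-neg (x ∷ p) (suc k) = coeff-neg p k

  coeff-- : ∀ p q k → coeff (p -ᴾ q) k ≈ coeff p k - coeff q k
  coeff-- p q k = trans (coeff-+ p (-ᴾ q) k) (+-congˡ (coeff-neg q k))

  coeff-scale : ∀ x p k → coeff (scale x p) k ≈ x * coeff p k
  coeff-scale x []      k       = sym (zeroʳ x)
  coeff-scale x (y ∷ p) zero    = refl
  coeff-scale x (y ∷ p) (suc k) = coeff-scale x p k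

  coeff-*-zero : ∀ x p q → coeff ((x ∷ p) *ᴾ q) 0 ≈ x * coeff q 0
  coeff-*-zero x p q = trans (coeff-+ (scale x q) (0# ∷ p *ᴾ q) 0)
    (trans (+-identityʳ _) (coeff-scale x q 0))

  coeff-*-suc : ∀ x p q k → coeff ((x ∷ p) *ᴾ q) (suc k) ≈ x * coeff q (suc k) + coeff (p *ᴾ q) k
  coeff-*-suc x p q k = trans (coeff-+ (scale x q) (0# ∷ p *ᴾ q) (suc k))
    (+-congʳ (coeff-scale x q (suc k)))

  infixr 5 _∷-cong_
  _∷-cong_ : ∀ {x y p q} → x ≈ y → p ≋ q → (x ∷ p) ≋ (y ∷ q)
  (x≈y ∷-cong p≈q) .at zero    = x≈y
  (x≈y ∷-cong p≈q) .at (suc k) = p≈q .at k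

  tail-cong : ∀ {p q} → p ≋ q → List.drop 1 p ≋ List.drop 1 q
  tail-cong {[]}    {[]}    p≈q = p≈q
  tail-cong {[]}    {y ∷ q} p≈q .at k = p≈q .at (suc k)
  tail-cong {x ∷ p} {[]}    p≈q .at k = p≈q .at (suc k)
  tail-cong {x ∷ p} {y ∷ q} p≈q .at k = p≈q .at (suc k)

  0∷[]≈[] : (0# ∷ []) ≋ []
  0∷[]≈[] .at zero    = refl
  0∷[]≈[] .at (suc k) = refl

  scale-0 : ∀ p → scale 0# p ≋ []
  scale-0 p .at k = trans (coeff-scale 0# p k) (zeroˡ _)

  private
    ≋-refl : ∀ {p} → p ≋ p
    ≋-refl .at k = refl

    ≋-sym : ∀ {p q} → p ≋ q → q ≋ p
    ≋-sym p≈q .at k = sym (p≈q .at k)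

    ≋-trans : ∀ {p q r} → p ≋ q → q ≋ r → p ≋ r
    ≋-trans p≈q q≈r .at k = trans (p≈q .at k) (q≈r .at k)

    +ᴾ-cong : ∀ {p p′ q q′} → p ≋ p′ → q ≋ q′ → (p +ᴾ q) ≋ (p′ +ᴾ q′)
    +ᴾ-cong {p} {p′} {q} {q′} p≈p′ q≈q′ .at k =
      trans (coeff-+ p q k) (trans (+-cong (p≈p′ .at k) (q≈q′ .at k)) (sym (coeff-+ p′ q′ k)))

    +ᴾ-assoc : ∀ p q r → ((p +ᴾ q) +ᴾ r) ≋ (p +ᴾ (q +ᴾ r))
    +ᴾ-assoc p q r .at k = trans (coeff-+ (p +ᴾ q) r k) (trans (+-congʳ (coeff-+ p q k)) (trans
      (+-assoc _ _ _)
      (sym (trans (coeff-+ p (q +ᴾ r) k) (+-congˡ (coeff-+ q r k))))))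

    +ᴾ-comm : ∀ p q → (p +ᴾ q) ≋ (q +ᴾ p)
    +ᴾ-comm p q .at k = trans (coeff-+ p q k) (trans (+-comm _ _) (sym (coeff-+ q p k)))

    +ᴾ-identityʳ : ∀ p → (p +ᴾ []) ≋ p
    +ᴾ-identityʳ p .at k = trans (coeff-+ p [] k) (+-identityʳ _)

    -ᴾ-cong : ∀ {p q} → p ≋ q → (-ᴾ p) ≋ (-ᴾ q)
    -ᴾ-cong {p} {q} p≈q .at k = trans (coeff-neg p k) (trans (-‿cong (p≈q .at k)) (sym (coeff-neg q k)))

    -ᴾ-inverseʳ : ∀ p → (p +ᴾ (-ᴾ p)) ≋ []
    -ᴾ-inverseʳ p .at k = trans (coeff-- p p k) (-‿inverseʳ _)

    -ᴾ-inverseˡ : ∀ p → ((-ᴾ p) +ᴾ p) ≋ []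
    -ᴾ-inverseˡ p = ≋-trans (+ᴾ-comm (-ᴾ p) p) (-ᴾ-inverseʳ p)

    +ᴾ-medial : ∀ p q r s → ((p +ᴾ q) +ᴾ (r +ᴾ s)) ≋ ((p +ᴾ r) +ᴾ (q +ᴾ s))
    +ᴾ-medial p q r s .at k = trans (expand p q r s)
      (trans (solve 4 (λ a b c d → (a :+ b) :+ (c :+ d) := (a :+ c) :+ (b :+ d)) refl _ _ _ _)
        (sym (expand p r q s)))
      where
      expand : ∀ p q r s → coeff ((p +ᴾ q) +ᴾ (r +ᴾ s)) k ≈ (coeff p k + coeff q k) + (coeff r k + coeff s k)
      expand p q r s = trans (coeff-+ (p +ᴾ q) (r +ᴾ s) k) (+-cong (coeff-+ p q k) (coeff-+ r s k))

  scale-cong : ∀ {x y p q} → x ≈ y → p ≋ q → scale x p ≋ scale y q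
  scale-cong {x} {y} {p} {q} x≈y p≈q .at k =
    trans (coeff-scale x p k) (trans (*-cong x≈y (p≈q .at k)) (sym (coeff-scale y q k)))

  private
    scale-distrib : ∀ x p q → scale x (p +ᴾ q) ≋ (scale x p +ᴾ scale x q)
    scale-distrib x p q .at k = trans (coeff-scale x (p +ᴾ q) k) (trans (*-congˡ (coeff-+ p q k)) (trans
      (distribˡ _ _ _)
      (sym (trans (coeff-+ (scale x p) (scale x q) k) (+-cong (coeff-scale x p k) (coeff-scale x q k))))))

    scale-+ : ∀ x y p → scale (x + y) p ≋ (scale x p +ᴾ scale y p)
    scale-+ x y p .at k = trans (coeff-scale (x + y) p k) (trans (distribʳ _ _ _)
      (sym (trans (coeff-+ (scale x p) (scale y p) k) (+-cong (coeff-scale x p k) (coeff-scale y p k)))))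

    scale-scale : ∀ x y p → scale (x * y) p ≋ scale x (scale y p)
    scale-scale x y p .at k = trans (coeff-scale (x * y) p k) (trans (*-assoc x y _)
      (sym (trans (coeff-scale x (scale y p) k) (*-congˡ (coeff-scale y p k)))))

    -- The zero polynomial is also represented by nonempty lists of zeros, so congruence in the left
    -- factor, by recursion on lists, needs this case separately.
    []*-cong : ∀ p q → [] ≋ p → [] ≋ (p *ᴾ q)
    []*-cong []      q []≈p = ≋-refl
    []*-cong (x ∷ p) q []≈p =
      ≋-trans (≋-sym 0∷[]≈[]) (+ᴾ-cong
        (≋-trans (≋-sym (scale-0 q)) (scale-cong ([]≈p .at 0) ≋-refl))
        (refl ∷-cong []*-cong p q (tail-cong {[]} []≈p)))

    *ᴾ-congʳ : ∀ {p p′} q → p ≋ p′ → (p *ᴾ q) ≋ (p′ *ᴾ q)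
    *ᴾ-congʳ {[]}    {p′}     q p≈p′ = []*-cong p′ q p≈p′
    *ᴾ-congʳ {x ∷ p} {[]}         q p≈p′ = ≋-sym ([]*-cong (x ∷ p) q (≋-sym p≈p′))
    *ᴾ-congʳ {x ∷ p} {y ∷ p′} q p≈p′ = +ᴾ-cong
      (scale-cong (p≈p′ .at 0) ≋-refl) (refl ∷-cong *ᴾ-congʳ {p} {p′} q (tail-cong p≈p′))

    *ᴾ-congˡ : ∀ p {q q′} → q ≋ q′ → (p *ᴾ q) ≋ (p *ᴾ q′)
    *ᴾ-congˡ []      q≈q′ = ≋-refl
    *ᴾ-congˡ (x ∷ p) {q} {q′} q≈q′ = +ᴾ-cong
      (scale-cong refl q≈q′) (refl ∷-cong *ᴾ-congˡ p q≈q′)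

    *ᴾ-cong : ∀ {p p′ q q′} → p ≋ p′ → q ≋ q′ → (p *ᴾ q) ≋ (p′ *ᴾ q′)
    *ᴾ-cong {p} {p′} {q} p≈p′ q≈q′ = ≋-trans (*ᴾ-congʳ q p≈p′) (*ᴾ-congˡ p′ q≈q′)

    shift-+ : ∀ p q → (0# ∷ (p +ᴾ q)) ≋ ((0# ∷ p) +ᴾ (0# ∷ q))
    shift-+ p q = sym (+-identityʳ 0#) ∷-cong ≋-refl

    distribʳᴾ : ∀ r p q → ((p +ᴾ q) *ᴾ r) ≋ (p *ᴾ r +ᴾ q *ᴾ r)
    distribʳᴾ r []      q       = ≋-refl
    distribʳᴾ r (x ∷ p) []      = ≋-sym (+ᴾ-identityʳ ((x ∷ p) *ᴾ r))
    distribʳᴾ r (x ∷ p) (y ∷ q) = ≋-trans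
      (+ᴾ-cong (scale-+ x y r)
        (≋-trans (refl ∷-cong distribʳᴾ r p q) (shift-+ (p *ᴾ r) (q *ᴾ r))))
      (+ᴾ-medial (scale x r) (scale y r) (0# ∷ p *ᴾ r) (0# ∷ q *ᴾ r))

    scale-*ᴾ : ∀ x q r → (scale x q *ᴾ r) ≋ scale x (q *ᴾ r)
    scale-*ᴾ x []      r = ≋-refl
    scale-*ᴾ x (y ∷ q) r = ≋-trans
      (+ᴾ-cong
        (scale-scale x y r) (sym (zeroʳ x) ∷-cong scale-*ᴾ x q r))
      (≋-sym (scale-distrib x (scale y r) (0# ∷ q *ᴾ r)))

  shift-*ᴾ : ∀ p q → ((0# ∷ p) *ᴾ q) ≋ (0# ∷ p *ᴾ q)
  shift-*ᴾ p q = +ᴾ-cong (scale-0 q) ≋-refl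

  private
    *ᴾ-assoc : ∀ p q r → ((p *ᴾ q) *ᴾ r) ≋ (p *ᴾ (q *ᴾ r))
    *ᴾ-assoc []      q r = ≋-refl
    *ᴾ-assoc (x ∷ p) q r = ≋-trans (distribʳᴾ r (scale x q) (0# ∷ p *ᴾ q))
      (+ᴾ-cong (scale-*ᴾ x q r)
        (≋-trans (shift-*ᴾ (p *ᴾ q) r) (refl ∷-cong *ᴾ-assoc p q r)))

    *ᴾ-zeroʳ : ∀ p → (p *ᴾ []) ≋ []
    *ᴾ-zeroʳ []      = ≋-refl
    *ᴾ-zeroʳ (x ∷ p) = ≋-trans (refl ∷-cong *ᴾ-zeroʳ p) 0∷[]≈[]

    -- Multiplication recurses on its left factor; this mirrored recursion on the right factor is
    -- the inductive step of commutativity.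
    *ᴾ-∷ʳ : ∀ p y q → (p *ᴾ (y ∷ q)) ≋ (scale y p +ᴾ (0# ∷ p *ᴾ q))
    *ᴾ-∷ʳ []      y q = ≋-sym 0∷[]≈[]
    *ᴾ-∷ʳ (x ∷ p) y q = +-congʳ (*-comm x y) ∷-cong ≋-trans
      (+ᴾ-cong ≋-refl (*ᴾ-∷ʳ p y q)) (swap (scale x q) (scale y p) (0# ∷ p *ᴾ q))
      where
      swap : ∀ p q r → (p +ᴾ (q +ᴾ r)) ≋ (q +ᴾ (p +ᴾ r))
      swap p q r = ≋-trans (≋-sym (+ᴾ-assoc p q r)) (≋-trans
        (+ᴾ-cong (+ᴾ-comm p q) ≋-refl) (+ᴾ-assoc q p r))

    *ᴾ-comm : ∀ p q → (p *ᴾ q) ≋ (q *ᴾ p)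
    *ᴾ-comm []      q = ≋-sym (*ᴾ-zeroʳ q)
    *ᴾ-comm (x ∷ p) q = ≋-trans
      (+ᴾ-cong ≋-refl (refl ∷-cong *ᴾ-comm p q)) (≋-sym (*ᴾ-∷ʳ q x p))

    *ᴾ-identityˡ : ∀ p → (constant 1# *ᴾ p) ≋ p
    *ᴾ-identityˡ p .at k = trans (coeff-+ (scale 1# p) (0# ∷ []) k)
      (trans (+-cong (trans (coeff-scale 1# p k) (*-identityˡ _)) (0∷[]≈[] .at k)) (+-identityʳ _))

    *ᴾ-identityʳ : ∀ p → (p *ᴾ constant 1#) ≋ p
    *ᴾ-identityʳ p = ≋-trans (*ᴾ-comm p (constant 1#)) (*ᴾ-identityˡ p)

    distribˡᴾ : ∀ p q r → (p *ᴾ (q +ᴾ r)) ≋ (p *ᴾ q +ᴾ p *ᴾ r)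
    distribˡᴾ p q r = ≋-trans (*ᴾ-comm p (q +ᴾ r)) (≋-trans (distribʳᴾ p q r)
      (+ᴾ-cong (*ᴾ-comm q p) (*ᴾ-comm r p)))

  polynomialRing : CommutativeRing c ℓ
  polynomialRing = record
    { Carrier = Poly ; _≈_ = _≋_ ; _+_ = _+ᴾ_ ; _*_ = _*ᴾ_ ; -_ = -ᴾ_ ; 0# = [] ; 1# = constant 1#
    ; isCommutativeRing = record
      { isRing = record
        { +-isAbelianGroup = record
          { isGroup = record
            { isMonoid = record
              { isSemigroup = record
                { isMagma = record
                  { isEquivalence = record
                    { refl = ≋-refl ; sym = ≋-sym ; trans = ≋-trans }
                  ; ∙-cong = +ᴾ-cong }
                ; assoc = +ᴾ-assoc }
              ; identity = (λ p → ≋-refl) , +ᴾ-identityʳ }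
            ; inverse = -ᴾ-inverseˡ , -ᴾ-inverseʳ
            ; ⁻¹-cong = -ᴾ-cong }
          ; comm = +ᴾ-comm }
        ; *-cong = *ᴾ-cong
        ; *-assoc = *ᴾ-assoc
        ; *-identity = *ᴾ-identityˡ , *ᴾ-identityʳ
        ; distrib = distribˡᴾ , distribʳᴾ }
      ; *-comm = *ᴾ-comm }
    }

-- Evaluation of polynomials.

module Evaluation (R : CommutativeRing c ℓ) where
  open CommutativeRing R
  open PolynomialRing R
  open Algebra.Properties.Semiring.Exp semiring
  open Algebra.Properties.Ring ring using (-0#≈0#)
  open CommutativeRingSolver R
  open SetoidReasoning setoid

  eval : Poly → Carrier → Carrier
  eval []      u = 0#
  eval (x ∷ p) u = x + u * eval p u

  IsRoot : Poly → Carrier → Set ℓ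
  IsRoot p u = eval p u ≈ 0#

  eval-zero : ∀ p u → p ≋ [] → eval p u ≈ 0#
  eval-zero []      u p≋[] = refl
  eval-zero (x ∷ p) u p≋[] = trans
    (+-cong (p≋[] .at 0) (*-congˡ (eval-zero p u (tail-cong p≋[]))))
    (trans (+-identityˡ _) (zeroʳ u))

  eval-congˡ : ∀ {p q} u → p ≋ q → eval p u ≈ eval q u
  eval-congˡ {[]}    {q}     u p≋q = sym (eval-zero q u (P.sym p≋q))
    where module P = CommutativeRing polynomialRing
  eval-congˡ {x ∷ p} {[]}    u p≋q = eval-zero (x ∷ p) u p≋q
  eval-congˡ {x ∷ p} {y ∷ q} u p≋q = +-cong (p≋q .at 0) (*-congˡ (eval-congˡ {p} {q} u (tail-cong p≋q)))

  eval-congʳ : ∀ p {u v} → u ≈ v → eval p u ≈ eval p v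
  eval-congʳ []      u≈v = refl
  eval-congʳ (x ∷ p) u≈v = +-congˡ (*-cong u≈v (eval-congʳ p u≈v))

  eval-+ : ∀ p q u → eval (p +ᴾ q) u ≈ eval p u + eval q u
  eval-+ []      q       u = sym (+-identityˡ _)
  eval-+ (x ∷ p) []      u = sym (+-identityʳ _)
  eval-+ (x ∷ p) (y ∷ q) u = trans (+-congˡ (*-congˡ (eval-+ p q u)))
    (solve 5 (λ x y u a b → (x :+ y) :+ u :* (a :+ b) := (x :+ u :* a) :+ (y :+ u :* b))
      refl x y u (eval p u) (eval q u))

  eval-neg : ∀ p u → eval (-ᴾ p) u ≈ - eval p u
  eval-neg []      u = sym -0#≈0#
  eval-neg (x ∷ p) u = trans (+-congˡ (*-congˡ (eval-neg p u)))
    (solve 3 (λ x u a → :- x :+ u :* (:- a) := :- (x :+ u :* a)) refl x u (eval p u))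

  eval-- : ∀ p q u → eval (p -ᴾ q) u ≈ eval p u - eval q u
  eval-- p q u = trans (eval-+ p (-ᴾ q) u) (+-congˡ (eval-neg q u))

  eval-scale : ∀ x p u → eval (scale x p) u ≈ x * eval p u
  eval-scale x []      u = sym (zeroʳ x)
  eval-scale x (y ∷ p) u = trans (+-congˡ (*-congˡ (eval-scale x p u)))
    (solve 4 (λ x y u a → x :* y :+ u :* (x :* a) := x :* (y :+ u :* a)) refl x y u (eval p u))

  eval-* : ∀ p q u → eval (p *ᴾ q) u ≈ eval p u * eval q u
  eval-* []      q u = sym (zeroˡ _)
  eval-* (x ∷ p) q u = begin
    eval (scale x q +ᴾ (0# ∷ p *ᴾ q)) u           ≈⟨ eval-+ (scale x q) (0# ∷ p *ᴾ q) u ⟩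
    eval (scale x q) u + (0# + u * eval (p *ᴾ q) u)
      ≈⟨ +-cong (eval-scale x q u) (trans (+-identityˡ _) (*-congˡ (eval-* p q u))) ⟩
    x * eval q u + u * (eval p u * eval q u)
      ≈⟨ solve 4 (λ x u a b → x :* b :+ u :* (a :* b) := (x :+ u :* a) :* b) refl x u (eval p u) (eval q u) ⟩
    (x + u * eval p u) * eval q u                 ∎

  eval-monomial : ∀ x k u → eval (monomial x k) u ≈ x * u ^ k
  eval-monomial x zero    u = trans (+-congˡ (zeroʳ u)) (trans (+-identityʳ x) (sym (*-identityʳ x)))
  eval-monomial x (suc k) u = trans (+-identityˡ _) (trans (*-congˡ (eval-monomial x k u))
    (solve 3 (λ x u a → u :* (x :* a) := x :* (u :* a)) refl x u (u ^ k)))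

  eval-constant : ∀ x u → eval (constant x) u ≈ x
  eval-constant x u = trans (+-congˡ (zeroʳ u)) (+-identityʳ x)

-- Degree bounds and division by monic polynomials.

module Degrees (R : CommutativeRing c ℓ) where
  open CommutativeRing R
  open PolynomialRing R
  open Algebra.Properties.Ring ring using (-0#≈0#)
  open CommutativeRingSolver R
  private module P = CommutativeRing polynomialRing

  -- A bound replaces a degree function: lists may end in zeros, and over a general ring it is not
  -- decidable which coefficients vanish.
  Below : ℕ → Poly → Set ℓ
  Below k p = ∀ j → k ℕ.≤ j → coeff p j ≈ 0#

  MonicAt : ℕ → Poly → Set ℓ
  MonicAt k p = coeff p k ≈ 1# × Below (suc k) p

  Below-resp : ∀ {k p q} → p ≋ q → Below k p → Below k q
  Below-resp p≋q below j k≤j = trans (sym (p≋q .at j)) (below j k≤j)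

  Below-≤ : ∀ {k m p} → k ℕ.≤ m → Below k p → Below m p
  Below-≤ k≤m below j m≤j = below j (ℕₚ.≤-trans k≤m m≤j)

  Below-- : ∀ {k p q} → Below k p → Below k q → Below k (p -ᴾ q)
  Below-- {p = p} {q} bp bq j k≤j = trans (coeff-- p q j)
    (trans (+-cong (bp j k≤j) (-‿cong (bq j k≤j))) (-‿inverseʳ 0#))

  Below-+ : ∀ {k p q} → Below k p → Below k q → Below k (p +ᴾ q)
  Below-+ {p = p} {q} bp bq j k≤j = trans (coeff-+ p q j)
    (trans (+-cong (bp j k≤j) (bq j k≤j)) (+-identityˡ 0#))

  Below-∷ : ∀ {k x p} → Below k p → Below (suc k) (x ∷ p)
  Below-∷ bp (suc j) (s≤s k≤j) = bp j k≤j

  Below-scale : ∀ {k p} x → Below k p → Below k (scale x p)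
  Below-scale {p = p} x bp j k≤j = trans (coeff-scale x p j) (trans (*-congˡ (bp j k≤j)) (zeroʳ x))

  Below-constant : ∀ x → Below 1 (constant x)
  Below-constant x (suc j) _ = refl

  monomial-lead : ∀ x k → coeff (monomial x k) k ≈ x
  monomial-lead x zero    = refl
  monomial-lead x (suc k) = monomial-lead x k

  coeff-monomial-≢ : ∀ x {k j} → k ≢ j → coeff (monomial x k) j ≈ 0#
  coeff-monomial-≢ x {zero}  {zero}  k≢j = contradiction ≡.refl k≢j
  coeff-monomial-≢ x {zero}  {suc j} k≢j = refl
  coeff-monomial-≢ x {suc k} {zero}  k≢j = refl
  coeff-monomial-≢ x {suc k} {suc j} k≢j = coeff-monomial-≢ x (k≢j ∘ ≡.cong suc)

  monomial-Below : ∀ x k → Below (suc k) (monomial x k)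
  monomial-Below x k j k<j = coeff-monomial-≢ x (ℕₚ.<⇒≢ k<j)

  Below-tail : ∀ {k x p} → Below (suc k) (x ∷ p) → Below k p
  Below-tail below j k≤j = below (suc j) (s≤s k≤j)

  Below-zero : ∀ {p} → Below 0 p → p ≋ []
  Below-zero below .at j = below j z≤n

  MonicAt-resp : ∀ {k p q} → p ≋ q → MonicAt k p → MonicAt k q
  MonicAt-resp p≋q (lead , below) = trans (sym (p≋q .at _)) lead , Below-resp p≋q below

  MonicAt-+ : ∀ {k p q} → MonicAt k p → Below k q → MonicAt k (p +ᴾ q)
  MonicAt-+ {k} {p} {q} (lead , below) bq =
    trans (coeff-+ p q k) (trans (+-cong lead (bq k ℕₚ.≤-refl)) (+-identityʳ 1#)) ,
    Below-+ {p = p} {q} below (Below-≤ {p = q} (ℕₚ.n≤1+n k) bq)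

  MonicAt-- : ∀ {k p q} → MonicAt k p → Below k q → MonicAt k (p -ᴾ q)
  MonicAt-- {k} {p} {q} (lead , below) bq =
    trans (coeff-- p q k) (trans (+-cong lead (-‿cong (bq k ℕₚ.≤-refl))) (trans (+-congˡ -0#≈0#) (+-identityʳ 1#)))
    , Below-- {p = p} {q} below (Below-≤ {p = q} (ℕₚ.n≤1+n k) bq)

  coeff-*-constant : ∀ x p q j → p ≋ [] → coeff ((x ∷ p) *ᴾ q) j ≈ x * coeff q j
  coeff-*-constant x p q zero    p≋[] = coeff-*-zero x p q
  coeff-*-constant x p q (suc j) p≋[] = trans (coeff-*-suc x p q j)
    (trans (+-congˡ (P.*-congʳ {q} p≋[] .at j)) (+-identityʳ _))

  leading-* : ∀ k m p q → Below (suc k) p → Below (suc m) q →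
              coeff (p *ᴾ q) (k ℕ.+ m) ≈ coeff p k * coeff q m × Below (suc (k ℕ.+ m)) (p *ᴾ q)
  leading-* k       m []      q bp bq = sym (zeroˡ _) , λ _ _ → refl
  leading-* zero    m (x ∷ p) q bp bq =
    coeff-*-constant x p q m p≋[] ,
    λ j m<j → trans (coeff-*-constant x p q j p≋[]) (trans (*-congˡ (bq j m<j)) (zeroʳ x))
    where p≋[] = Below-zero (Below-tail {x = x} bp)
  leading-* (suc k) m (x ∷ p) q bp bq =
    trans (above (k ℕ.+ m) (ℕₚ.m≤n+m m k)) (proj₁ ih) , below
    where
    ih = leading-* k m p q (Below-tail {x = x} bp) bq
    above : ∀ j → m ℕ.≤ j → coeff ((x ∷ p) *ᴾ q) (suc j) ≈ coeff (p *ᴾ q) j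
    above j m≤j = trans (coeff-*-suc x p q j)
      (trans (+-congʳ (trans (*-congˡ (bq (suc j) (s≤s m≤j))) (zeroʳ x))) (+-identityˡ _))
    below : Below (suc (suc k ℕ.+ m)) ((x ∷ p) *ᴾ q)
    below (suc j) (s≤s le) = trans (above j (ℕₚ.≤-trans (ℕₚ.m≤n+m m (suc k)) le)) (proj₂ ih j le)

  MonicAt-* : ∀ {k m p q} → MonicAt k p → MonicAt m q → MonicAt (k ℕ.+ m) (p *ᴾ q)
  MonicAt-* {k} {m} {p} {q} (lp , bp) (lq , bq) with leading-* k m p q bp bq
  ... | l , b = trans l (trans (*-cong lp lq) (*-identityˡ 1#)) , b

  -- The leading term of `w` survives multiplication by a monic `m`. Since `m` vanishes above degree
  -- k, the head `x` of `w` affects no coefficient of the product above k, so the tail of `w` is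
  -- zero by induction; then `x` is the coefficient at k. This is what makes remainders unique.
  multiple-of-monic-Below : ∀ k m → MonicAt k m → ∀ w → Below k (w *ᴾ m) → w ≋ []
  multiple-of-monic-Below k m mm [] below = P.refl
  multiple-of-monic-Below k m mm@(lead , above) (x ∷ w) below =
    P.trans (x≈0 ∷-cong w≋[]) 0∷[]≈[]
    where
    w≋[] : w ≋ []
    w≋[] = multiple-of-monic-Below k m mm w λ j k≤j → trans
      (trans (sym (+-identityˡ _)) (+-congʳ (sym (trans (*-congˡ (above (suc j) (s≤s k≤j))) (zeroʳ x)))))
      (trans (sym (coeff-*-suc x w m j)) (below (suc j) (ℕₚ.m≤n⇒m≤1+n k≤j)))
    x≈0 : x ≈ 0#
    x≈0 = trans (sym (*-identityʳ x)) (trans (*-congˡ (sym lead))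
      (trans (sym (coeff-*-constant x w m k w≋[])) (below k ℕₚ.≤-refl)))

  -- Over a finite field, indexing by the vector of lower coefficients turns a search through all
  -- monic polynomials of degree k into a search through vectors.
  monic : ∀ {k} → Vec Carrier k → Poly
  monic v = toList v ++ (1# ∷ [])

  monic-MonicAt : ∀ {k} (v : Vec Carrier k) → MonicAt k (monic v)
  monic-MonicAt []      = refl , λ { (suc j) _ → refl }
  monic-MonicAt (x ∷ v) with monic-MonicAt v
  ... | lead , below = lead , λ { (suc j) (s≤s le) → below j le }

  toList-Below : ∀ {k} (v : Vec Carrier k) → Below k (toList v)
  toList-Below []      j       _        = refl
  toList-Below (x ∷ v) (suc j) (s≤s le) = toList-Below v j le

  truncate : ∀ k → Poly → Vec Carrier k
  truncate zero    p = []
  truncate (suc k) p = coeff p 0 ∷ truncate k (List.drop 1 p)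

  coeff-drop : ∀ p j → coeff (List.drop 1 p) j ≡ coeff p (suc j)
  coeff-drop []      j = ≡.refl
  coeff-drop (x ∷ p) j = ≡.refl

  private
    drop-Below : ∀ {k} p → Below (suc k) p → Below k (List.drop 1 p)
    drop-Below p below j le = trans (reflexive (coeff-drop p j)) (below (suc j) (s≤s le))

  toList-truncate : ∀ k p → Below k p → toList (truncate k p) ≋ p
  toList-truncate zero    p below = P.sym (Below-zero below)
  toList-truncate (suc k) p below .at zero    = refl
  toList-truncate (suc k) p below .at (suc j) = trans
    (toList-truncate k (List.drop 1 p) (drop-Below p below) .at j) (reflexive (coeff-drop p j))

  monic-truncate : ∀ k p → MonicAt k p → monic (truncate k p) ≋ p
  monic-truncate zero    p (lead , below) .at zero    = sym lead
  monic-truncate zero    p (lead , below) .at (suc j) = sym (below (suc j) (s≤s z≤n))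
  monic-truncate (suc k) p (lead , below) .at zero    = refl
  monic-truncate (suc k) p (lead , below) .at (suc j) = trans
    (monic-truncate k (List.drop 1 p) (trans (reflexive (coeff-drop p k)) lead , drop-Below p below) .at j)
    (reflexive (coeff-drop p j))

  private
    reduce-top : ∀ {k} (i v : Vec Carrier k) e →
                 toList (i ∷ʳ e) ≋ (scale e (monic v) +ᴾ toList (Vec.zipWith (λ x y → x - e * y) i v))
    reduce-top []      []      e = trans (sym (*-identityʳ e)) refl ∷-cong P.refl
    reduce-top (x ∷ i) (y ∷ v) e =
      solve 3 (λ x y e → x := e :* y :+ (x :- e :* y)) refl x y e ∷-cong reduce-top i v e

  divMod : ∀ {k} (v : Vec Carrier k) p → Σ[ s ∈ Poly ] Σ[ r ∈ Vec Carrier k ] p ≋ (s *ᴾ monic v +ᴾ toList r)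
  divMod {k} v [] = [] , Vec.replicate k 0# , P.sym (zeros k)
    where
    zeros : ∀ k → toList (Vec.replicate k 0#) ≋ []
    zeros zero    = P.refl
    zeros (suc k) = P.trans (refl ∷-cong zeros k) 0∷[]≈[]
  divMod v (x ∷ p) with divMod v p
  -- `x ∷ r` stands for x + Z r and has one coefficient too many; its last entry `e` is the next
  -- quotient coefficient, and `reduce-top` cancels it by subtracting `e` times the divisor.
  ... | s , r , p≋ with Vec.initLast (x ∷ r)
  ... | i , e , eq = e ∷ s , Vec.zipWith (λ x y → x - e * y) i v , (begin
    x ∷ p
      ≈⟨ sym (+-identityˡ x) ∷-cong p≋ ⟩
    (0# ∷ s *ᴾ monic v) +ᴾ toList (x ∷ r)
      ≈⟨ P.+-congˡ (P.reflexive (≡.cong toList eq)) ⟩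
    (0# ∷ s *ᴾ monic v) +ᴾ toList (i ∷ʳ e)
      ≈⟨ P.+-congˡ (reduce-top i v e) ⟩
    (0# ∷ s *ᴾ monic v) +ᴾ (scale e (monic v) +ᴾ r′)
      ≈⟨ P.+-assoc (0# ∷ s *ᴾ monic v) (scale e (monic v)) r′ ⟨
    ((0# ∷ s *ᴾ monic v) +ᴾ scale e (monic v)) +ᴾ r′
      ≈⟨ P.+-congʳ (P.+-comm (0# ∷ s *ᴾ monic v) (scale e (monic v))) ⟩
    ((e ∷ s) *ᴾ monic v) +ᴾ r′ ∎)
    where
    open SetoidReasoning P.setoid
    r′ = toList (Vec.zipWith (λ x y → x - e * y) i v)

-- Polynomials under a change of coefficient ring.

module PolynomialMap (R : CommutativeRing c ℓ) (S : CommutativeRing c′ ℓ′)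
    (φ : CommutativeRing.Carrier R → CommutativeRing.Carrier S) (isHom : IsHom R S φ) where
  open RingMorphisms.IsRingHomomorphism isHom
  open CommutativeRing S
  private
    module R = CommutativeRing R
    module R[X] = PolynomialRing R
    module S[X] = PolynomialRing S
    module P = CommutativeRing S[X].polynomialRing
    module RE = Algebra.Properties.Semiring.Exp R.semiring
    module RM = Algebra.Properties.Semiring.Mult R.semiring
  open Algebra.Properties.Semiring.Exp semiring
  open Algebra.Properties.Semiring.Mult semiring using () renaming (_×_ to _·_)
  open S[X] using (_≋_; at; coeff; _+ᴾ_; _*ᴾ_; -ᴾ_; _-ᴾ_; scale; monomial; _∷-cong_)
  open Degrees using (MonicAt)

  ^-homo : ∀ x k → φ (x RE.^ k) ≈ φ x ^ k
  ^-homo x zero    = 1#-homo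
  ^-homo x (suc k) = trans (*-homo x (x RE.^ k)) (*-congˡ (^-homo x k))

  ·-homo : ∀ k x → φ (k RM.× x) ≈ k · φ x
  ·-homo zero    x = 0#-homo
  ·-homo (suc k) x = trans (+-homo x (k RM.× x)) (+-congˡ (·-homo k x))

  -homo : ∀ x y → φ (x R.- y) ≈ φ x - φ y
  -homo x y = trans (+-homo x (R.- y)) (+-congˡ (-‿homo y))

  coeff-map : ∀ p k → coeff (map φ p) k ≈ φ (R[X].coeff p k)
  coeff-map []      k       = sym 0#-homo
  coeff-map (x ∷ p) zero    = refl
  coeff-map (x ∷ p) (suc k) = coeff-map p k

  map-cong : ∀ {p q} → p R[X].≋ q → map φ p ≋ map φ q
  map-cong {p} {q} p≋q .at k =
    trans (coeff-map p k) (trans (⟦⟧-cong (p≋q .R[X].at k)) (sym (coeff-map q k)))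

  map-+ : ∀ p q → map φ (p R[X].+ᴾ q) ≋ (map φ p +ᴾ map φ q)
  map-+ []      q       = P.refl
  map-+ (x ∷ p) []      = P.refl
  map-+ (x ∷ p) (y ∷ q) = +-homo x y ∷-cong map-+ p q

  map-scale : ∀ x p → map φ (R[X].scale x p) ≋ scale (φ x) (map φ p)
  map-scale x []      = P.refl
  map-scale x (y ∷ p) = *-homo x y ∷-cong map-scale x p

  map-neg : ∀ p → map φ (R[X].-ᴾ p) ≋ (-ᴾ map φ p)
  map-neg []      = P.refl
  map-neg (x ∷ p) = -‿homo x ∷-cong map-neg p

  map-- : ∀ p q → map φ (p R[X].-ᴾ q) ≋ (map φ p -ᴾ map φ q)
  map-- p q = P.trans (map-+ p (R[X].-ᴾ q)) (P.+-congˡ (map-neg q))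

  map-* : ∀ p q → map φ (p R[X].*ᴾ q) ≋ (map φ p *ᴾ map φ q)
  map-* []      q = P.refl
  map-* (x ∷ p) q = P.trans (map-+ (R[X].scale x q) _)
    (P.+-cong (map-scale x q) (0#-homo ∷-cong map-* p q))

  map-monomial : ∀ x k → map φ (R[X].monomial x k) ≋ monomial (φ x) k
  map-monomial x zero    = P.refl
  map-monomial x (suc k) = 0#-homo ∷-cong map-monomial x k

  map-MonicAt : ∀ {k p} → MonicAt R k p → MonicAt S k (map φ p)
  map-MonicAt {k} {p} (lead , below) =
    trans (coeff-map p k) (trans (⟦⟧-cong lead) 1#-homo) ,
    λ j k<j → trans (coeff-map p j) (trans (⟦⟧-cong (below j k<j)) 0#-homo)

  module _ (injective : ∀ {x y} → φ x ≈ φ y → x R.≈ y) where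
    MonicAt-map⁻¹ : ∀ {k p} → MonicAt S k (map φ p) → MonicAt R k p
    MonicAt-map⁻¹ {k} {p} (lead , below) =
      injective (trans (sym (coeff-map p k)) (trans lead (sym 1#-homo))) ,
      λ j k<j → injective (trans (sym (coeff-map p j)) (trans (below j k<j) (sym 0#-homo)))

-- Domains with decidable equality and the number of roots of a polynomial.

record IsDiscreteDomain (R : CommutativeRing c ℓ) : Set (c ⊔ ℓ) where
  open CommutativeRing R
  field
    _≟_      : Decidable _≈_
    1≉0      : 1# ≉ 0#
    integral : ∀ {x y} → x * y ≈ 0# → x ≈ 0# ⊎ y ≈ 0#

module DiscreteDomain (R : CommutativeRing c ℓ) (isDomain : IsDiscreteDomain R) where
  open CommutativeRing R
  open IsDiscreteDomain isDomain
  open PolynomialRing R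
  open Evaluation R
  open Degrees R
  open CommutativeRingSolver R
  open Algebra.Properties.Ring ring using (x∙y⁻¹≈ε⇒x≈y; x≈y⇒x∙y⁻¹≈ε)
  open Algebra.Properties.Semiring.Exp semiring
  private module P = CommutativeRing polynomialRing

  *-cancelˡ : ∀ {x y z} → x ≉ 0# → x * y ≈ x * z → y ≈ z
  *-cancelˡ {x} {y} {z} x≉0 xy≈xz with integral {x} {y - z} (trans
    (solve 3 (λ x y z → x :* (y :- z) := x :* y :- x :* z) refl x y z) (x≈y⇒x∙y⁻¹≈ε xy≈xz))
  ... | inj₁ x≈0   = contradiction x≈0 x≉0
  ... | inj₂ y-z≈0 = x∙y⁻¹≈ε⇒x≈y _ _ y-z≈0

  *-≉0 : ∀ {x y} → x ≉ 0# → y ≉ 0# → x * y ≉ 0#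
  *-≉0 x≉0 y≉0 xy≈0 with integral xy≈0
  ... | inj₁ x≈0 = x≉0 x≈0
  ... | inj₂ y≈0 = y≉0 y≈0

  ^-≉0 : ∀ {x} k → x ≉ 0# → x ^ k ≉ 0#
  ^-≉0 zero    x≉0 = 1≉0
  ^-≉0 (suc k) x≉0 = *-≉0 x≉0 (^-≉0 k x≉0)

  x^k≈0⇒x≈0 : ∀ {x} k → x ^ k ≈ 0# → x ≈ 0#
  x^k≈0⇒x≈0 {x} k x^k≈0 with x ≟ 0#
  ... | yes x≈0 = x≈0
  ... | no x≉0  = contradiction x^k≈0 (^-≉0 k x≉0)

  x²≈y² : ∀ {x y} → x * x ≈ y * y → x ≈ y ⊎ x ≈ - y
  x²≈y² {x} {y} eq with integral {x - y} {x + y} (trans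
    (solve 2 (λ x y → (x :- y) :* (x :+ y) := x :* x :- y :* y) refl x y) (x≈y⇒x∙y⁻¹≈ε eq))
  ... | inj₁ x-y≈0 = inj₁ (x∙y⁻¹≈ε⇒x≈y _ _ x-y≈0)
  ... | inj₂ x+y≈0 = inj₂ (x∙y⁻¹≈ε⇒x≈y _ _ (trans
    (solve 2 (λ x y → x :- :- y := x :+ y) refl x y) x+y≈0))

  private
    -- Synthetic division: the entries are the partial values of Horner's scheme. Whatever `x` is,
    -- this is the quotient of `x ∷ p` by Z - r, which does not depend on the constant term.
    quotientTail : Carrier → Poly → Poly
    quotientTail r []      = []
    quotientTail r (x ∷ p) = eval (x ∷ p) r ∷ quotientTail r p

    length-quotientTail : ∀ r p → length (quotientTail r p) ≡ length p
    length-quotientTail r []      = ≡.refl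
    length-quotientTail r (x ∷ p) = ≡.cong suc (length-quotientTail r p)

    eval-quotientTail : ∀ r p u → u * eval p u ≈ r * eval p r + (u - r) * eval (quotientTail r p) u
    eval-quotientTail r []      u = solve 2 (λ u r → u :* o := r :* o :+ (u :- r) :* o) refl u r
      where o = con (0 , 0)
    eval-quotientTail r (x ∷ p) u = trans (*-congˡ (+-congˡ (eval-quotientTail r p u)))
      (solve 5 (λ x u r a b → u :* (x :+ (r :* a :+ (u :- r) :* b)) :=
          r :* (x :+ r :* a) :+ (u :- r) :* ((x :+ r :* a) :+ u :* b))
        refl x u r (eval p r) (eval (quotientTail r p) u))

    quotientTail-zero : ∀ r p → quotientTail r p ≋ [] → p ≋ []
    quotientTail-zero r []      q≋[] = P.refl
    quotientTail-zero r (x ∷ p) q≋[] = P.trans (x≈0 ∷-cong p≋[]) 0∷[]≈[]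
      where
      p≋[] = quotientTail-zero r p (tail-cong q≋[])
      x≈0 = trans (sym (trans (+-congˡ (trans (*-congˡ (eval-zero p r p≋[])) (zeroʳ r))) (+-identityʳ x)))
        (q≋[] .at 0)

  -- Dividing by Z - r₀ shortens the list by one, and in a domain the remaining points are roots of
  -- the quotient because they differ from r₀. The bound is on the length of the list, which keeps
  -- the induction structural; `Below-roots⇒zero` trades it for a degree bound.
  roots⇒zero : ∀ m p → length p ℕ.≤ m → (r : Fin m → Carrier) →
               (∀ {i j} → r i ≈ r j → i ≡ j) → (∀ i → eval p (r i) ≈ 0#) → p ≋ []
  roots⇒zero m       []      _        r inj root = P.refl
  roots⇒zero (suc m) (x ∷ p) (s≤s le) r inj root = P.trans (x≈0 ∷-cong p≋[]) 0∷[]≈[]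
    where
    r₀ = r Fin.zero
    q = quotientTail r₀ p
    rootOfQuotient : ∀ i → eval q (r (Fin.suc i)) ≈ 0#
    rootOfQuotient i with integral {r (Fin.suc i) - r₀} (trans
      (solve 3 (λ x a b → b := (x :+ (a :+ b)) :- (x :+ a)) refl x (r₀ * eval p r₀) _)
      (x≈y⇒x∙y⁻¹≈ε (trans (+-congˡ (sym (eval-quotientTail r₀ p _)))
        (trans (root (Fin.suc i)) (sym (root Fin.zero))))))
    ... | inj₁ rᵢ≈r₀ = case inj (x∙y⁻¹≈ε⇒x≈y _ _ rᵢ≈r₀) of λ ()
    ... | inj₂ root′ = root′
    p≋[] : p ≋ []
    p≋[] = quotientTail-zero r₀ p (roots⇒zero m q (≡.subst (ℕ._≤ m) (≡.sym (length-quotientTail r₀ p)) le)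
      (r ∘ Fin.suc) (Finₚ.suc-injective ∘ inj) rootOfQuotient)
    x≈0 : x ≈ 0#
    x≈0 = trans (sym (trans (+-congˡ (trans (*-congˡ (eval-zero p r₀ p≋[])) (zeroʳ r₀))) (+-identityʳ x)))
      (root Fin.zero)

  Below-roots⇒zero : ∀ {m p} → Below m p → (r : Fin m → Carrier) →
                     (∀ {i j} → r i ≈ r j → i ≡ j) → (∀ i → eval p (r i) ≈ 0#) → p ≋ []
  Below-roots⇒zero {m} {p} below r inj root = P.trans (P.sym eq)
    (roots⇒zero m (toList (truncate m p)) (ℕₚ.≤-reflexive (Vecₚ.length-toList (truncate m p))) r inj
      (λ i → trans (eval-congˡ (r i) eq) (root i)))
    where eq = toList-truncate m p below

  monic-has-few-roots : ∀ {d p} → MonicAt d p → (r : Fin (suc d) → Carrier) →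
                        (∀ {i j} → r i ≈ r j → i ≡ j) → ¬ (∀ i → eval p (r i) ≈ 0#)
  monic-has-few-roots {d} {p} (lead , below) r inj root =
    1≉0 (trans (sym lead) (Below-roots⇒zero {p = p} below r inj root .at d))

-- Least exponents.

least : ∀ {p} {P : ℕ → Set p} → (∀ k → Dec (P k)) → ∀ n → P n →
        Σ[ m ∈ ℕ ] P m × m ℕ.≤ n × (∀ k → k ℕ.< m → ¬ P k)
least P? zero    Pn = 0 , Pn , z≤n , λ _ ()
least P? (suc n) Pn with P? 0
... | yes P0 = 0 , P0 , z≤n , λ _ ()
... | no ¬P0 with least (P? ∘ suc) n Pn
... | m , Pm , m≤n , smaller = suc m , Pm , s≤s m≤n ,
  λ { zero _ → ¬P0 ; (suc k) (s≤s k<m) → smaller k k<m }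

-- Division with remainder: the residue of `m` again satisfies `P`, so it cannot be positive. It
-- serves both for the order of α and for the exponents m with z^m in 𝔽_{q²}.
least-exponent∣ : ∀ {p} {P : ℕ → Set p} t → (∀ r k → P (r ℕ.+ k ℕ.* suc t) → P r) →
                  (∀ k → k ℕ.< t → ¬ P (suc k)) → ∀ {m} → P m → suc t ∣ m
least-exponent∣ {P = P} t reduce smaller {m} Pm with m % suc t in eq
... | zero  = Div.m%n≡0⇒n∣m m (suc t) eq
... | suc r = contradiction
  (reduce (suc r) (m / suc t) (≡.subst P (≡.trans (DivMod.m≡m%n+[m/n]*n m (suc t)) (≡.cong
    (ℕ._+ m / suc t ℕ.* suc t) eq)) Pm))
  (smaller r (ℕ.s≤s⁻¹ (≡.subst (ℕ._< suc t) eq (DivMod.m%n<n m (suc t)))))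

-- Finite fields: exhaustive search and Fermat's theorem.

module FiniteFieldProperties (K : FiniteField c ℓ) where
  open FiniteField K
  open Inverse enumeration using (to; from; to-cong; from-cong; strictlyInverseˡ; strictlyInverseʳ)
  open SetoidReasoning ≈-setoid
  private module Π = CommutativeMonoidSum *-commutativeMonoid

  to-injective : ∀ {x y} → to x ≡ to y → x ≈ y
  to-injective {x} {y} eq = trans (sym (strictlyInverseʳ x)) (trans (from-cong eq) (strictlyInverseʳ y))

  from-injective : ∀ {i j} → from i ≈ from j → i ≡ j
  from-injective {i} {j} eq = ≡.trans (≡.sym (strictlyInverseˡ i)) (≡.trans (to-cong eq) (strictlyInverseˡ j))

  _≟_ : Decidable _≈_
  x ≟ y = map′ to-injective to-cong (to x Finₚ.≟ to y)

  x*x⁻¹≈1 : ∀ {x} (x≉0 : x ≉ 0#) → x * inv x x≉0 ≈ 1#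
  x*x⁻¹≈1 x≉0 = proj₂ (proj₂ (invertible _ x≉0))

  x⁻¹*x≈1 : ∀ {x} (x≉0 : x ≉ 0#) → inv x x≉0 * x ≈ 1#
  x⁻¹*x≈1 x≉0 = proj₁ (proj₂ (invertible _ x≉0))

  x⁻¹*[x*y]≈y : ∀ {x} (x≉0 : x ≉ 0#) y → inv x x≉0 * (x * y) ≈ y
  x⁻¹*[x*y]≈y x≉0 y = trans (sym (*-assoc _ _ _)) (trans (*-congʳ (x⁻¹*x≈1 x≉0)) (*-identityˡ y))

  integral : ∀ {x y} → x * y ≈ 0# → x ≈ 0# ⊎ y ≈ 0#
  integral {x} {y} xy≈0 with x ≟ 0#
  ... | yes x≈0 = inj₁ x≈0
  ... | no x≉0  = inj₂ (trans (sym (x⁻¹*[x*y]≈y x≉0 y)) (trans (*-congˡ xy≈0) (zeroʳ _)))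

  isDomain : IsDiscreteDomain commutativeRing
  isDomain = record { _≟_ = _≟_ ; 1≉0 = 1≉0 ; integral = integral }

  open DiscreteDomain commutativeRing isDomain using (*-cancelˡ; *-≉0)

  any? : ∀ {p} {P : Carrier → Set p} → (∀ {x y} → x ≈ y → P x → P y) → (∀ x → Dec (P x)) → Dec (∃ P)
  any? resp P? = map′ (λ (i , Pi) → from i , Pi) (λ (x , Px) → to x , resp (sym (strictlyInverseʳ x)) Px)
    (Finₚ.any? (P? ∘ from))

  -- Through `monic`, this decides whether a divisor of a given degree exists. Invariance under
  -- pointwise equality is required because the search visits one representative of each field
  -- element.
  anyVec? : ∀ {p} k {P : Vec Carrier k → Set p} → (∀ {v w} → Pointwise _≈_ v w → P v → P w) →
            (∀ v → Dec (P v)) → Dec (∃ P)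
  anyVec? zero    resp P? = map′ ([] ,_) (λ { ([] , P[]) → P[] }) (P? [])
  anyVec? (suc k) resp P? = map′ (λ (x , v , Pv) → x ∷ v , Pv) (λ { (x ∷ v , Pv) → x , v , Pv })
    (any? (λ x≈y (v , Pv) → v , resp (x≈y ∷ Pointwise.refl refl) Pv)
      (λ x → anyVec? k (λ v≈w → resp (refl ∷ v≈w)) (λ v → P? (x ∷ v))))

  1<size : 1 ℕ.< size
  1<size = distinct (to 1#) (to 0#) (1≉0 ∘ to-injective)
    where
    distinct : ∀ {n} (i j : Fin n) → i ≢ j → 1 ℕ.< n
    distinct {suc (suc n)} i j i≢j = s≤s (s≤s z≤n)
    distinct {suc zero} Fin.zero Fin.zero i≢j = contradiction ≡.refl i≢j

  private
    ∏-≉0 : ∀ {n} (f : Fin n → Carrier) → (∀ i → f i ≉ 0#) → Π.sum f ≉ 0#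
    ∏-≉0 {zero}  f f≉0 = 1≉0
    ∏-≉0 {suc n} f f≉0 = *-≉0 (f≉0 Fin.zero) (∏-≉0 (f ∘ Fin.suc) (f≉0 ∘ Fin.suc))

    -- Multiplication by u permutes the nonzero elements, hence fixes their product.
    unit^[size∸1] : ∀ n → Inverse ≈-setoid (≡.setoid (Fin (suc n))) → ∀ u → u ≉ 0# → u ^ n ≈ 1#
    unit^[size∸1] n enum u u≉0 = sym (*-cancelˡ (∏-≉0 elements nonzero) (begin
      Π.sum elements * 1#
        ≈⟨ *-identityʳ _ ⟩
      Π.sum elements
        ≈⟨ Π.sum-permute elements (Perm.remove i₀ π) ⟩
      Π.sum (λ j → elements (Perm.remove i₀ π ⟨$⟩ʳ j))
        ≈⟨ Π.sum-cong-≋ permuted ⟩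
      Π.sum (λ j → u * elements j)
        ≈⟨ Π.∑-distrib-+ (λ _ → u) elements ⟩
      Π.sum (λ (_ : Fin n) → u) * Π.sum elements
        ≈⟨ *-congʳ (Π.sum-replicate n) ⟩
      u ^ n * Π.sum elements
        ≈⟨ *-comm _ _ ⟩
      Π.sum elements * u ^ n ∎))
      where
      module I = Inverse enum
      i₀ = I.to 0#
      elements : Fin n → Carrier
      elements j = I.from (punchIn i₀ j)
      nonzero : ∀ j → elements j ≉ 0#
      nonzero j eq = Finₚ.punchInᵢ≢i i₀ j (≡.trans (≡.sym (I.strictlyInverseˡ _)) (I.to-cong eq))
      multiply : Carrier → Fin (suc n) → Fin (suc n)
      multiply x i = I.to (x * I.from i)
      u⁻¹ = inv u u≉0
      multiply-inverse : ∀ x y → x * y ≈ 1# → ∀ i → multiply x (multiply y i) ≡ i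
      multiply-inverse x y xy≈1 i = ≡.trans (I.to-cong (begin
        x * I.from (I.to (y * I.from i))  ≈⟨ *-congˡ (I.strictlyInverseʳ _) ⟩
        x * (y * I.from i)                ≈⟨ *-assoc _ _ _ ⟨
        (x * y) * I.from i                ≈⟨ *-congʳ xy≈1 ⟩
        1# * I.from i                     ≈⟨ *-identityˡ _ ⟩
        I.from i                          ∎)) (I.strictlyInverseˡ i)
      π : Permutation (suc n) (suc n)
      π = permutation (multiply u) (multiply u⁻¹)
        (multiply-inverse u u⁻¹ (x*x⁻¹≈1 u≉0)) (multiply-inverse u⁻¹ u (x⁻¹*x≈1 u≉0))
      πi₀≡i₀ : π ⟨$⟩ʳ i₀ ≡ i₀
      πi₀≡i₀ = I.to-cong (trans (*-congˡ (I.strictlyInverseʳ 0#)) (zeroʳ u))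
      permuted : ∀ j → elements (Perm.remove i₀ π ⟨$⟩ʳ j) ≈ u * elements j
      permuted j = begin
        I.from (punchIn i₀ (Perm.remove i₀ π ⟨$⟩ʳ j))
          ≡⟨ ≡.cong (λ i → I.from (punchIn i (Perm.remove i₀ π ⟨$⟩ʳ j))) πi₀≡i₀ ⟨
        I.from (punchIn (π ⟨$⟩ʳ i₀) (Perm.remove i₀ π ⟨$⟩ʳ j))
          ≡⟨ ≡.cong I.from (Perm.punchIn-permute π i₀ j) ⟨
        I.from (π ⟨$⟩ʳ punchIn i₀ j)
          ≈⟨ I.strictlyInverseʳ _ ⟩
        u * elements j ∎

    -- The number of elements is generalised to a variable so that it can be split off as a
    -- successor.
    fermat′ : ∀ n → Inverse ≈-setoid (≡.setoid (Fin n)) → ∀ u → u ^ n ≈ u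
    fermat′ zero    enum u = case Inverse.to enum 0# of λ ()
    fermat′ (suc n) enum u with u ≟ 0#
    ... | yes u≈0 = trans (*-congʳ u≈0) (trans (zeroˡ _) (sym u≈0))
    ... | no u≉0  = trans (*-congˡ (unit^[size∸1] n enum u u≉0)) (*-identityʳ u)

  x^size≈x : ∀ u → u ^ size ≈ u
  x^size≈x = fermat′ size enumeration

  x^[size∸1]≈1 : ∀ {u} → u ≉ 0# → u ^ (size ℕ.∸ 1) ≈ 1#
  x^[size∸1]≈1 {u} u≉0 = *-cancelˡ u≉0 (begin
    u ^ suc (size ℕ.∸ 1)  ≡⟨ ≡.cong (u ^_) (ℕₚ.m+[n∸m]≡n (ℕₚ.<⇒≤ 1<size)) ⟩
    u ^ size              ≈⟨ x^size≈x u ⟩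
    u                     ≈⟨ *-identityʳ u ⟨
    u * 1#                ∎)

-- A finite field inside a domain: fixed points and additivity of the q-th power.

module FiniteFieldInDomain
    (K : FiniteField c ℓ) (D : CommutativeRing c′ ℓ′) (isDomain : IsDiscreteDomain D)
    (φ : FiniteField.Carrier K → CommutativeRing.Carrier D)
    (isHom : IsHom (FiniteField.commutativeRing K) D φ) where
  private module K = FiniteField K
  open CommutativeRing D
  open IsDiscreteDomain isDomain
  open DiscreteDomain D isDomain
  open PolynomialRing D
  open Evaluation D
  open Degrees D
  open CommutativeRingSolver D
  open FiniteFieldProperties K using (any?; from-injective; 1<size; x^size≈x; x⁻¹*x≈1)
    renaming (_≟_ to _≟ᴷ_)
  open Algebra.Properties.Semiring.Exp semiring
  open Algebra.Properties.Ring ring using (x∙y⁻¹≈ε⇒x≈y; x≈y⇒x∙y⁻¹≈ε; +-inverseˡ-unique)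
  open RingMorphisms.IsRingHomomorphism isHom
  open PolynomialMap K.commutativeRing D φ isHom using (^-homo; -homo)
  private
    q = K.size
    from = Inverse.from K.enumeration
    module KR = Algebra.Properties.Ring K.ring

  φ-≉0 : ∀ {x} → x K.≉ K.0# → φ x ≉ 0#
  φ-≉0 {x} x≉0 φx≈0 = 1≉0 (trans (sym 1#-homo) (trans (sym (⟦⟧-cong (x⁻¹*x≈1 x≉0)))
    (trans (*-homo _ x) (trans (*-congˡ φx≈0) (zeroʳ _)))))

  φ-injective : ∀ {x y} → φ x ≈ φ y → x K.≈ y
  φ-injective {x} {y} φx≈φy with (x K.- y) ≟ᴷ K.0#
  ... | yes x-y≈0 = KR.x∙y⁻¹≈ε⇒x≈y _ _ x-y≈0
  ... | no x-y≉0  = contradiction (trans (-homo x y) (x≈y⇒x∙y⁻¹≈ε φx≈φy)) (φ-≉0 x-y≉0)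

  image-fixed : ∀ e → φ e ^ q ≈ φ e
  image-fixed e = trans (sym (^-homo e q)) (⟦⟧-cong (x^size≈x e))

  inImage? : ∀ u → Dec (∃[ e ] φ e ≈ u)
  inImage? u = any? (λ x≈y φx≈u → trans (sym (⟦⟧-cong x≈y)) φx≈u) (λ e → φ e ≟ u)

  -- The q elements of the image are already roots of Y^q - Y; a fixed point outside it would be
  -- root number q + 1.
  fixed-inImage : ∀ {u} → u ^ q ≈ u → ∃[ e ] φ e ≈ u
  fixed-inImage {u} u^q≈u with inImage? u
  ... | yes e      = e
  ... | no ∄e = contradiction root (monic-has-few-roots {p = monomial 1# q -ᴾ monomial 1# 1}
      (MonicAt-- {p = monomial 1# q} {monomial 1# 1} (monomial-lead 1# q , monomial-Below 1# q)
        (Below-≤ {p = monomial 1# 1} 1<size (monomial-Below 1# 1)))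
      roots injective)
    where
    roots : Fin (suc q) → Carrier
    roots Fin.zero    = u
    roots (Fin.suc i) = φ (from i)
    injective : ∀ {i j} → roots i ≈ roots j → i ≡ j
    injective {Fin.zero}  {Fin.zero}  eq = ≡.refl
    injective {Fin.zero}  {Fin.suc j} eq = contradiction (_ , sym eq) ∄e
    injective {Fin.suc i} {Fin.zero}  eq = contradiction (_ , eq) ∄e
    injective {Fin.suc i} {Fin.suc j} eq = ≡.cong Fin.suc (from-injective (φ-injective eq))
    roots-fixed : ∀ i → roots i ^ q ≈ roots i
    roots-fixed Fin.zero    = u^q≈u
    roots-fixed (Fin.suc i) = image-fixed (from i)
    root : ∀ i → eval (monomial 1# q -ᴾ monomial 1# 1) (roots i) ≈ 0#
    root i = trans (eval-- (monomial 1# q) (monomial 1# 1) _)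
      (x≈y⇒x∙y⁻¹≈ε (trans (eval-monomial 1# q _) (trans (*-congˡ (trans (roots-fixed i) (sym
        (*-identityʳ _))))
        (sym (eval-monomial 1# 1 _)))))

  private
    -- The polynomial (Y + v)^k - Y^k, built by the recursion P_{k+1} = (Y + v) P_k + v Y^k. The
    -- leading terms never appear, so the degree bound needs no cancellation.
    power-difference : Carrier → ℕ → Poly
    power-difference v zero    = []
    power-difference v (suc k) = (scale v (power-difference v k) +ᴾ
      (0# ∷ power-difference v k)) +ᴾ monomial v k

    power-difference-Below : ∀ v k → Below k (power-difference v k)
    power-difference-Below v zero    j _ = refl
    power-difference-Below v (suc k) = Below-+ {p = scale v p +ᴾ (0# ∷ p)}
      (Below-+ {p = scale v p} (Below-scale {p = p} v (Below-≤ {p = p} (ℕₚ.n≤1+n k) ih)) (Below-∷ {x = 0#}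
        {p} ih))
      (monomial-Below v k)
      where
      p = power-difference v k
      ih = power-difference-Below v k

    eval-power-difference : ∀ v k u → eval (power-difference v k) u ≈ (u + v) ^ k - u ^ k
    eval-power-difference v zero    u = sym (-‿inverseʳ 1#)
    eval-power-difference v (suc k) u = trans (eval-+ (scale v p +ᴾ (0# ∷ p)) (monomial v k) u)
      (trans (+-cong (trans (eval-+ (scale v p) (0# ∷ p) u) (+-cong (trans (eval-scale v p u) (*-congˡ ih))
          (+-congˡ (*-congˡ ih)))) (eval-monomial v k u))
        (solve 4 (λ u v a b → (v :* (a :- b) :+ (con (0 , 0) :+ u :* (a :- b))) :+ v :* b :=
          (u :+ v) :* a :- u :* b) refl u v ((u + v) ^ k) (u ^ k)))
      where
      p = power-difference v k
      ih = eval-power-difference v k u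

    -- (Y + v)^q − Y^q − v^q has degree below q, so it vanishes once it vanishes on
    -- the q elements of the field; this avoids any mention of the characteristic.
    frobenius-criterion : ∀ v → (∀ e → (φ e + v) ^ q ≈ φ e ^ q + v ^ q) → ∀ u → (u + v) ^ q ≈ u ^ q + v ^ q
    frobenius-criterion v eq u = x∙y⁻¹≈ε⇒x≈y _ _ (trans
      (solve 3 (λ a b c → a :- (b :+ c) := (a :- b) :- c) refl _ _ _)
      (trans (sym (eval-p u)) (eval-zero p u (Below-roots⇒zero {p = p} p-Below (φ ∘ from)
        (from-injective ∘ φ-injective)
        λ i → trans (eval-p (φ (from i)))
          (trans (+-congʳ (+-congʳ (eq (from i)))) (solve 2 (λ b c → ((b :+ c) :- b) :- c := con
            (0 , 0)) refl _ _))))))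
      where
      p = power-difference v q -ᴾ constant (v ^ q)
      p-Below : Below q p
      p-Below = Below-- {p = power-difference v q} (power-difference-Below v q)
        (Below-≤ {p = constant (v ^ q)} (ℕₚ.<⇒≤ 1<size) (Below-constant (v ^ q)))
      eval-p : ∀ u → eval p u ≈ ((u + v) ^ q - u ^ q) - v ^ q
      eval-p u = trans (eval-- (power-difference v q) (constant (v ^ q)) u)
        (+-cong (eval-power-difference v q u) (-‿cong (eval-constant (v ^ q) u)))

  -- The criterion is applied twice. Between two field elements the identity holds because they and
  -- their sum are fixed; this yields it for one field element and one arbitrary element, and that
  -- in turn for two arbitrary ones.
  frobenius-+ : ∀ u v → (u + v) ^ q ≈ u ^ q + v ^ q
  frobenius-+ u v = frobenius-criterion v (λ e → trans (^-congˡ q (+-comm (φ e) v))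
    (trans (frobenius-criterion (φ e) (λ e′ → trans (^-congˡ q (sym (+-homo e′ e)))
        (trans (image-fixed (e′ K.+ e)) (trans (+-homo e′ e) (sym (+-cong (image-fixed e′)
          (image-fixed e))))))
      v) (+-comm _ _))) u

  frobenius-0 : 0# ^ q ≈ 0#
  frobenius-0 = trans (^-congˡ q (sym 0#-homo)) (trans (image-fixed K.0#) 0#-homo)

  frobenius-neg : ∀ u → (- u) ^ q ≈ - (u ^ q)
  frobenius-neg u = +-inverseˡ-unique _ _ (trans (sym (frobenius-+ (- u) u))
    (trans (^-congˡ q (-‿inverseˡ u)) frobenius-0))

  frobenius-injective : ∀ {u v} → u ^ q ≈ v ^ q → u ≈ v
  frobenius-injective {u} {v} eq = x∙y⁻¹≈ε⇒x≈y _ _ (x^k≈0⇒x≈0 q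
    (trans (frobenius-+ u (- v)) (trans (+-congˡ (frobenius-neg v)) (x≈y⇒x∙y⁻¹≈ε eq))))

-- The quotient of a ring by a principal ideal.

module PrincipalQuotient (R : CommutativeRing c ℓ) (h : CommutativeRing.Carrier R) where
  open CommutativeRing R
  open Algebra.Properties.Ring ring using (x≈y⇒x∙y⁻¹≈ε; [y-z]x≈yx-zx)
  open CommutativeRingSolver R

  infix 4 _∣′_ _~_
  _∣′_ : Carrier → Carrier → Set (c ⊔ ℓ)
  d ∣′ x = Σ[ w ∈ Carrier ] w * d ≈ x

  record _~_ (x y : Carrier) : Set (c ⊔ ℓ) where
    constructor mk~
    field divisible : h ∣′ (x - y)
  open _~_ public

  ≈⇒~ : ∀ {x y} → x ≈ y → x ~ y
  ≈⇒~ x≈y = mk~ (0# , trans (zeroˡ h) (sym (x≈y⇒x∙y⁻¹≈ε x≈y)))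

  ∣′⇒~0 : ∀ {x} → h ∣′ x → x ~ 0#
  ∣′⇒~0 {x} (w , eq) = mk~ (w , trans eq (solve 1 (λ x → x := x :- con (0 , 0)) refl x))

  ~0⇒∣′ : ∀ {x} → x ~ 0# → h ∣′ x
  ~0⇒∣′ {x} (mk~ (w , eq)) = w , trans eq (solve 1 (λ x → x :- con (0 , 0) := x) refl x)

  private
    ~-sym : ∀ {x y} → x ~ y → y ~ x
    ~-sym {x} {y} (mk~ (w , eq)) = mk~ (- w , trans
      (trans (solve 2 (λ w h → (:- w) :* h := :- (w :* h)) refl w h) (-‿cong eq))
      (solve 2 (λ x y → :- (x :- y) := y :- x) refl x y))

    ~-trans : ∀ {x y z} → x ~ y → y ~ z → x ~ z
    ~-trans {x} {y} {z} (mk~ (w , eq)) (mk~ (w′ , eq′)) = mk~ (w + w′ , trans (distribʳ h w w′)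
      (trans (+-cong eq eq′) (solve 3 (λ x y z → (x :- y) :+ (y :- z) := x :- z) refl x y z)))

    +-cong~ : ∀ {x x′ y y′} → x ~ x′ → y ~ y′ → (x + y) ~ (x′ + y′)
    +-cong~ {x} {x′} {y} {y′} (mk~ (w , eq)) (mk~ (w′ , eq′)) = mk~ (w + w′ , trans (distribʳ h w w′)
      (trans (+-cong eq eq′)
        (solve 4 (λ x x′ y y′ → (x :- x′) :+ (y :- y′) := (x :+ y) :- (x′ :+ y′)) refl x x′ y y′)))

    *-cong~ : ∀ {x x′ y y′} → x ~ x′ → y ~ y′ → (x * y) ~ (x′ * y′)
    *-cong~ {x} {x′} {y} {y′} (mk~ (w , eq)) (mk~ (w′ , eq′)) = mk~ (y * w + x′ * w′ , trans
      (solve 5 (λ y w x′ w′ h → (y :* w :+ x′ :* w′) :* h := y :* (w :* h) :+ x′ :*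
        (w′ :* h)) refl y w x′ w′ h)
      (trans (+-cong (*-congˡ eq) (*-congˡ eq′))
        (solve 4 (λ x x′ y y′ → y :* (x :- x′) :+ x′ :* (y :- y′) := x :* y :- x′ :* y′) refl x x′ y y′)))

    neg-cong~ : ∀ {x y} → x ~ y → (- x) ~ (- y)
    neg-cong~ {x} {y} (mk~ (w , eq)) = mk~ (- w , trans
      (trans (solve 2 (λ w h → (:- w) :* h := :- (w :* h)) refl w h) (-‿cong eq))
      (solve 2 (λ x y → :- (x :- y) := :- x :- :- y) refl x y))

  quotientRing : CommutativeRing c (c ⊔ ℓ)
  quotientRing = record
    { Carrier = Carrier ; _≈_ = _~_ ; _+_ = _+_ ; _*_ = _*_ ; -_ = -_ ; 0# = 0# ; 1# = 1#
    ; isCommutativeRing = record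
      { isRing = record
        { +-isAbelianGroup = record
          { isGroup = record
            { isMonoid = record
              { isSemigroup = record
                { isMagma = record
                  { isEquivalence = record { refl = ≈⇒~ refl ; sym = ~-sym ; trans = ~-trans }
                  ; ∙-cong = +-cong~ }
                ; assoc = λ x y z → ≈⇒~ (+-assoc x y z) }
              ; identity = (λ x → ≈⇒~ (+-identityˡ x)) , (λ x → ≈⇒~ (+-identityʳ x)) }
            ; inverse = (λ x → ≈⇒~ (-‿inverseˡ x)) , (λ x → ≈⇒~ (-‿inverseʳ x))
            ; ⁻¹-cong = neg-cong~ }
          ; comm = λ x y → ≈⇒~ (+-comm x y) }
        ; *-cong = *-cong~
        ; *-assoc = λ x y z → ≈⇒~ (*-assoc x y z)
        ; *-identity = (λ x → ≈⇒~ (*-identityˡ x)) , (λ x → ≈⇒~ (*-identityʳ x))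
        ; distrib = (λ x y z → ≈⇒~ (distribˡ x y z)) , (λ x y z → ≈⇒~ (distribʳ x y z)) }
      ; *-comm = λ x y → ≈⇒~ (*-comm x y) }
    }

  private module Q = CommutativeRing quotientRing

  -- The elements annihilating `y` modulo `h` form an ideal containing `h`. These closure properties
  -- feed the Euclidean dichotomy when the quotient of a polynomial ring is shown to be a domain.
  annihilator-resp : ∀ {x x′} y → x ~ x′ → (x * y) ~ 0# → (x′ * y) ~ 0#
  annihilator-resp y x~x′ xy~0 = Q.trans (Q.*-congʳ (Q.sym x~x′)) xy~0

  annihilator-- : ∀ {x x′} y → (x * y) ~ 0# → (x′ * y) ~ 0# → ((x - x′) * y) ~ 0#
  annihilator-- {x} {x′} y xy~0 x′y~0 = Q.trans (≈⇒~ ([y-z]x≈yx-zx y x x′))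
    (Q.trans (Q.+-cong xy~0 (Q.-‿cong x′y~0)) (Q.-‿inverseʳ 0#))

  annihilator-* : ∀ w {x} y → (x * y) ~ 0# → ((w * x) * y) ~ 0#
  annihilator-* w {x} y xy~0 = Q.trans (Q.*-assoc w x y) (Q.trans (Q.*-congˡ xy~0) (Q.zeroʳ w))

  h~0 : h ~ 0#
  h~0 = ∣′⇒~0 (1# , *-identityˡ h)

  remainder~ : ∀ {x} s r → x ≈ s * h + r → x ~ r
  remainder~ s r eq = Q.trans (≈⇒~ eq)
    (Q.trans (Q.+-congʳ (Q.trans (Q.*-congˡ h~0) (Q.zeroʳ s))) (Q.+-identityˡ r))

-- Irreducible polynomials over a finite field and the domains they define.

module PolynomialsOverFiniteField (K : FiniteField c ℓ) where
  open FiniteField K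
  open FiniteFieldProperties K
  open PolynomialRing commutativeRing
  open Degrees commutativeRing
  private
    module P = CommutativeRing polynomialRing
    module PR = Algebra.Properties.Ring P.ring

  infix 4 _∣ₚ_
  _∣ₚ_ : Poly → Poly → Set (c ⊔ ℓ)
  m ∣ₚ p = Σ[ w ∈ Poly ] (w *ᴾ m) ≋ p

  zero? : ∀ p → Dec (p ≋ [])
  zero? []      = yes P.refl
  zero? (x ∷ p) with x ≟ 0# | zero? p
  ... | yes x≈0 | yes p≋[] = yes (P.trans (x≈0 ∷-cong p≋[]) 0∷[]≈[])
  ... | no x≉0  | _        = no λ x∷p≋[] → x≉0 (x∷p≋[] .at 0)
  ... | yes _   | no p≉[]  = no λ x∷p≋[] → p≉[] (tail-cong x∷p≋[])

  monic∣? : ∀ {k} (v : Vec Carrier k) p → Dec (monic v ∣ₚ p)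
  monic∣? {k} v p with divMod v p
  ... | s , r , p≋ with zero? (toList r)
  ... | yes r≋[] = yes (s , P.sym (P.trans p≋ (P.trans (P.+-congˡ r≋[]) (P.+-identityʳ _))))
  ... | no r≉[]  = no λ (w , w*m≋p) → r≉[] (remainder-zero w (P.trans w*m≋p p≋))
    where
    remainder-zero : ∀ w → (w *ᴾ monic v) ≋ (s *ᴾ monic v +ᴾ toList r) → toList r ≋ []
    remainder-zero w eq = P.trans (P.sym difference) (P.*-congʳ {monic v}
      (multiple-of-monic-Below k (monic v) (monic-MonicAt v) (w -ᴾ s)
        (Below-resp (P.sym difference) (toList-Below r))))
      where
      difference : ((w -ᴾ s) *ᴾ monic v) ≋ toList r
      difference = P.trans (PR.[y-z]x≈yx-zx (monic v) w s)
        (P.trans (P.+-congʳ eq) (PR.xyx⁻¹≈y (s *ᴾ monic v) (toList r)))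

  -- Irreducibility in the form that a search for a divisor of least degree delivers and that the
  -- Euclidean algorithm consumes.
  NoMonicDivisorBelow : ℕ → Poly → Set (c ⊔ ℓ)
  NoMonicDivisorBelow d f = ∀ k (v : Vec Carrier k) → 0 ℕ.< k → k ℕ.< d → ¬ monic v ∣ₚ f

  record IsIdeal {i} (I : Poly → Set i) : Set (c ⊔ ℓ ⊔ i) where
    field
      resp     : ∀ {p q} → p ≋ q → I p → I q
      -‿closed : ∀ {p q} → I p → I q → I (p -ᴾ q)
      *-closed : ∀ w {p} → I p → I (w *ᴾ p)

  -- The Euclidean algorithm, applied to f and an element of an ideal containing f.
  ideal-dichotomy : ∀ {i} {I : Poly → Set i} → IsIdeal I → ∀ {d f} → I f → NoMonicDivisorBelow d f →
                    ∀ k → k ℕ.≤ d → ∀ p → Below k p → I p → p ≋ [] ⊎ I (constant 1#)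
  ideal-dichotomy isIdeal If irr zero    k≤d p below Ip = inj₁ (Below-zero below)
  ideal-dichotomy {I = I} isIdeal {d} {f} If irr (suc k) k<d p below Ip with coeff p k ≟ 0#
  ... | yes top≈0 = ideal-dichotomy isIdeal If irr k (ℕₚ.<⇒≤ k<d) p below′ Ip
    where
    below′ : Below k p
    below′ j k≤j with k ℕₚ.≟ j
    ... | yes ≡.refl = top≈0
    ... | no k≢j     = below j (ℕₚ.≤∧≢⇒< k≤j k≢j)
  ... | no top≉0 = dichotomy
    where
    open IsIdeal isIdeal
    e⁻¹ = inv _ top≉0
    p′ = scale e⁻¹ p
    v = truncate k p′
    m = monic v
    m≋p′ : m ≋ p′
    m≋p′ = monic-truncate k p′
      (trans (coeff-scale e⁻¹ p k) (x⁻¹*x≈1 top≉0) , Below-scale {p = p} e⁻¹ below)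
    Im : I m
    Im = resp (P.trans (P.trans (P.+-congˡ 0∷[]≈[]) (P.+-identityʳ _)) (P.sym m≋p′)) (*-closed
      (constant e⁻¹) Ip)
    dichotomy : p ≋ [] ⊎ I (constant 1#)
    dichotomy with k ℕₚ.≟ 0
    -- A monic polynomial of degree 0 is `constant 1#`.
    ... | yes ≡.refl = inj₂ Im
    ... | no k≢0 with divMod v f
    ... | s , r , f≋ with ideal-dichotomy isIdeal If irr k (ℕₚ.<⇒≤ k<d) (toList r) (toList-Below r)
      (resp (P.trans (P.+-congʳ f≋) (PR.xyx⁻¹≈y (s *ᴾ m) (toList r)))
        (-‿closed If (*-closed s Im)))
    ... | inj₁ r≋[] = contradiction (s , P.sym (P.trans f≋ (P.trans (P.+-congˡ r≋[]) (P.+-identityʳ _))))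
      (irr k v (ℕₚ.n≢0⇒n>0 k≢0) k<d)
    ... | inj₂ I1 = inj₂ I1

  monic-cong : ∀ {k} {v w : Vec Carrier k} → Pointwise _≈_ v w → monic v ≋ monic w
  monic-cong []            = P.refl
  monic-cong (x≈y ∷ v≈w) = x≈y ∷-cong monic-cong v≈w

  ∣ₚ-trans : ∀ {p q r} → p ∣ₚ q → q ∣ₚ r → p ∣ₚ r
  ∣ₚ-trans {p} (s , sp≋q) (t , tq≋r) = t *ᴾ s , P.trans (P.*-assoc t s p) (P.trans (P.*-congˡ {t} sp≋q) tq≋r)

  -- The search succeeds at the latest at `p` itself. Least degree gives irreducibility because a
  -- divisor of the factor is a divisor of `p` too.
  irreducible-factor : ∀ {d p} → MonicAt (suc d) p →
    Σ[ k ∈ ℕ ] Σ[ v ∈ Vec Carrier (suc k) ] monic v ∣ₚ p × NoMonicDivisorBelow (suc k) (monic v)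
  irreducible-factor {d} {p} mp with least
    (λ k → anyVec? (suc k) {P = λ v → monic v ∣ₚ p}
      (λ v≈w (s , eq) → s , P.trans (P.*-congˡ {s} (P.sym (monic-cong v≈w))) eq) (λ v → monic∣? v p))
    d (truncate (suc d) p , constant 1# , P.trans (P.*-identityˡ _) (monic-truncate (suc d) p mp))
  ... | k , (v , v∣p) , _ , smaller = k , v , v∣p ,
    λ { (suc j) w _ (s≤s j<k) w∣v → smaller j j<k (w , ∣ₚ-trans {monic w} w∣v v∣p) }

  module Quotient {k} (v : Vec Carrier (suc k)) (irr : NoMonicDivisorBelow (suc k) (monic v)) where
    private h = monic v

    open PrincipalQuotient polynomialRing h public
    private module Q = CommutativeRing quotientRing

    private
      annihilator : ∀ q → IsIdeal (λ p → (p *ᴾ q) ~ [])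
      annihilator q = record
        { resp     = λ p≋p′ → annihilator-resp q (≈⇒~ p≋p′)
        ; -‿closed = λ {p} {p′} → annihilator-- {p} {p′} q
        ; *-closed = λ w → annihilator-* w q
        }

      -- The annihilator of q contains `h` and the remainder r of p modulo `h`. By the dichotomy
      -- either r is zero, so p vanishes in the quotient, or 1 annihilates q, so q does.
      Q-integral : ∀ {p q} → (p *ᴾ q) ~ [] → p ~ [] ⊎ q ~ []
      Q-integral {p} {q} pq~0 = [ (λ r≋[] → inj₁ (Q.trans p~r (≈⇒~ r≋[]))) ,
          (λ 1*q~0 → inj₂ (Q.trans (Q.sym (Q.*-identityˡ q)) 1*q~0)) ]′
        (ideal-dichotomy (annihilator q) (annihilator-resp q (Q.sym h~0) (Q.zeroˡ q)) irr
          (suc k) ℕₚ.≤-refl (toList r) (toList-Below r) (annihilator-resp q p~r pq~0))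
        where
        division = divMod v p
        r = proj₁ (proj₂ division)
        p~r : p ~ toList r
        p~r = remainder~ (proj₁ division) (toList r) (proj₂ (proj₂ division))

      Q-1≉0 : ¬ (constant 1# ~ [])
      Q-1≉0 1~[] with ~0⇒∣′ 1~[]
      ... | w , w*h≋1 = 1≉0 (P.trans (P.sym w*h≋1) (P.*-congʳ {h}
        (multiple-of-monic-Below (suc k) h (monic-MonicAt v) w
          (Below-resp (P.sym w*h≋1) (Below-≤ {p = constant 1#} (s≤s z≤n) (Below-constant 1#))))) .at 0)

    quotient-isDomain : IsDiscreteDomain quotientRing
    quotient-isDomain = record
      { _≟_ = λ p q → map′ mk~ divisible (monic∣? v (p -ᴾ q))
      ; 1≉0 = Q-1≉0
      ; integral = Q-integral
      }

    constant-isHom : IsHom commutativeRing quotientRing constant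
    constant-isHom = record
      { isSemiringHomomorphism = record
        { isNearSemiringHomomorphism = record
          { +-isMonoidHomomorphism = record
            { isMagmaHomomorphism = record
              { isRelHomomorphism = record { cong = λ x≈y → ≈⇒~ (x≈y ∷-cong P.refl) }
              ; homo = λ x y → Q.refl }
            ; ε-homo = ≈⇒~ 0∷[]≈[] }
          ; *-homo = λ x y → ≈⇒~ (sym (+-identityʳ _) ∷-cong P.refl) }
        ; 1#-homo = Q.refl }
      ; -‿homo = λ x → Q.refl
      }

    root : Poly
    root = 0# ∷ 1# ∷ []

    root-* : ∀ p → (root *ᴾ p) ≋ (0# ∷ p)
    root-* p = P.trans (shift-*ᴾ (1# ∷ []) p) (refl ∷-cong P.*-identityˡ p)

    eval-root : ∀ p → Evaluation.eval quotientRing (map constant p) root ~ p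
    eval-root []      = Q.refl
    eval-root (x ∷ p) = Q.trans (Q.+-congˡ {constant x} (Q.*-congˡ {root} (eval-root p)))
      (≈⇒~ (P.trans (P.+-congˡ {constant x} (root-* p)) (+-identityʳ x ∷-cong P.refl)))

-- Radicals, greatest common divisors and lifting the exponent.

module NumberTheory where
  open import Data.Nat.Base using (_+_; _*_; _^_)
  open ≡ using (refl; sym; trans; cong; cong₂; subst)
  open ≡.≡-Reasoning

  prime≢1 : ∀ {p} → Prime p → p ≢ 1
  prime≢1 pp refl = Prime.¬prime[1] pp

  prime∤1 : ∀ {p} → Prime p → ¬ p ∣ 1
  prime∤1 pp p∣1 = prime≢1 pp (Div.∣1⇒≡1 p∣1)

  prime∣prime⇒≡ : ∀ {p q} → Prime p → Prime q → p ∣ q → p ≡ q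
  prime∣prime⇒≡ pp pq p∣q with Prime.prime⇒irreducible pq p∣q
  ... | inj₁ p≡1 = contradiction p≡1 (prime≢1 pp)
  ... | inj₂ p≡q = p≡q

  ∃prime∣ : ∀ n .{{_ : NonZero n}} → n ≢ 1 → Σ[ p ∈ ℕ ] Prime p × p ∣ n
  ∃prime∣ n n≢1 with factorise n
  ... | record { factors = [] ; isFactorisation = eq } = contradiction eq n≢1
  ... | record { factors = p ∷ ps ; isFactorisation = refl ; factorsPrime = pp ∷ _ } = p , pp , Div.m∣m*n
    (product ps)

  private
    prime∤product : ∀ {p ps} → Prime p → All Prime ps → All (p ≢_) ps → ¬ p ∣ product ps
    prime∤product pp [] [] p∣1 = prime∤1 pp p∣1
    prime∤product {ps = q ∷ ps} pp (pq ∷ pps) (p≢q ∷ p∉ps) p∣ with Prime.euclidsLemma q (product ps) pp p∣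
    ... | inj₁ p∣q  = p≢q (prime∣prime⇒≡ pp pq p∣q)
    ... | inj₂ p∣ps = prime∤product pp pps p∉ps p∣ps

    product-distinct-primes∣ : ∀ {m ps} → Unique ps → All Prime ps → All (_∣ m) ps → product ps ∣ m
    product-distinct-primes∣ [] [] [] = Div.1∣ _
    product-distinct-primes∣ {ps = p ∷ ps} (p∉ps ∷ uniq) (pp ∷ pps) (p∣m ∷ ps∣m)
      with product-distinct-primes∣ uniq pps ps∣m
    ... | divides k refl with Prime.euclidsLemma k (product ps) pp p∣m
    ... | inj₁ p∣k  = Div.*-monoˡ-∣ (product ps) p∣k
    ... | inj₂ p∣ps = contradiction p∣ps (prime∤product pp pps p∉ps)

  rad∣ : ∀ t {m} → (∀ p → Prime p → p ∣ t → p ∣ m) → rad t ∣ m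
  rad∣ t {m} primes∣m = product-distinct-primes∣
    (Uniqueₚ.filter⁺ prime∣t? (Uniqueₚ.upTo⁺ (suc t)))
    (All.map proj₁ all) (All.map (λ (pp , p∣t) → primes∣m _ pp p∣t) all)
    where
    prime∣t? = λ p → prime? p ×-dec p Div.∣? t
    all = Allₚ.all-filter prime∣t? (List.upTo (suc t))

  prime∣rad : ∀ n .{{_ : NonZero n}} {p} → Prime p → p ∣ n → p ∣ rad n
  prime∣rad n pp p∣n = ∈⇒∣product (Membershipₚ.∈-filter⁺ (λ p → prime? p ×-dec p Div.∣? n)
    (Membershipₚ.∈-upTo⁺ (s≤s (Div.∣⇒≤ p∣n))) (pp , p∣n))

  gcd≡1 : ∀ t k .{{_ : NonZero t}} → (∀ p → Prime p → p ∣ t → ¬ p ∣ k) → gcd t k ≡ 1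
  gcd≡1 t k coprime with gcd t k ℕₚ.≟ 1
  ... | yes eq = eq
  ... | no ≢1 with ∃prime∣ (gcd t k) {{ℕ.≢-nonZero (GCD.gcd[m,n]≢0 t k (inj₁ (ℕ.≢-nonZero⁻¹ t)))}} ≢1
  ... | p , pp , p∣gcd = contradiction (Div.∣-trans p∣gcd (GCD.gcd[m,n]∣n t k))
    (coprime p pp (Div.∣-trans p∣gcd (GCD.gcd[m,n]∣m t k)))

  -- Write a = c e t. Then gcd(a, e k) = e g with g = gcd(t c, k). Being a divisor of k, g is prime
  -- to t and therefore divides c, so t e g divides a.
  ∣/gcd : ∀ {t e k a m} .{{_ : NonZero (gcd a m)}} → m ≡ e * k → gcd t k ≡ 1 → e * t ∣ a → t ∣ a / gcd a m
  ∣/gcd {t} {e} {k} refl gcd≡1 (divides m refl) = Div.m*n∣o⇒m∣o/n t _ (subst (λ g → t * g ∣ m * (e * t))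
    (sym gcd≡e*g) (
    subst (t * (e * g) ∣_) (sym (rearrange m e t)) (subst (_∣ e * (t * m)) (sym (rearrange′ t e g))
      (Div.*-monoʳ-∣ e (Div.*-monoʳ-∣ t g∣m)))))
    where
    g = gcd (t * m) k
    rearrange : ∀ m e t → m * (e * t) ≡ e * (t * m)
    rearrange = solve-∀
    rearrange′ : ∀ t e g → t * (e * g) ≡ e * (t * g)
    rearrange′ = solve-∀
    gcd≡e*g : gcd (m * (e * t)) (e * k) ≡ e * g
    gcd≡e*g = trans (cong (λ x → gcd x (e * k)) (rearrange m e t)) (sym (GCD.c*gcd[m,n]≡gcd[cm,cn] e
      (t * m) k))
    g∣m : g ∣ m
    g∣m = coprime-divisor {n = t} (λ (d∣g , d∣t) → gcd≡1⇒coprime {t} {k} gcd≡1 (d∣t , Div.∣-trans d∣g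
      (GCD.gcd[m,n]∣n (t * m) k)))
      (GCD.gcd[m,n]∣m (t * m) k)

  geometric : ℕ → ℕ → ℕ
  geometric x zero    = 0
  geometric x (suc k) = 1 + x * geometric x k

  ^≡1+*geometric : ∀ m k → (1 + m) ^ k ≡ 1 + m * geometric (1 + m) k
  ^≡1+*geometric m zero    = cong suc (sym (ℕₚ.*-zeroʳ m))
  ^≡1+*geometric m (suc k) = trans (cong ((1 + m) *_) (^≡1+*geometric m k)) (lemma m (geometric (1 + m) k))
    where
    lemma : ∀ m g → (1 + m) * (1 + m * g) ≡ 1 + m * (1 + (1 + m) * g)
    lemma = solve-∀

  geometric-+ : ∀ x j k → geometric x (j + k) ≡ geometric x j + x ^ j * geometric x k
  geometric-+ x zero    k = sym (ℕₚ.+-identityʳ _)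
  geometric-+ x (suc j) k = trans (cong (λ g → 1 + x * g) (geometric-+ x j k)) (lemma x (geometric x j)
    (x ^ j) (geometric x k))
    where
    lemma : ∀ x a b c → 1 + x * (a + b * c) ≡ 1 + x * a + x * b * c
    lemma = solve-∀

  geometric-* : ∀ x j k → geometric x (k * j) ≡ geometric x j * geometric (x ^ j) k
  geometric-* x j zero    = sym (ℕₚ.*-zeroʳ (geometric x j))
  geometric-* x j (suc k) = begin
    geometric x (j + k * j)                                         ≡⟨ geometric-+ x j (k * j) ⟩
    geometric x j + x ^ j * geometric x (k * j)                     ≡⟨ cong
      (λ g → geometric x j + x ^ j * g) (geometric-* x j k) ⟩
    geometric x j + x ^ j * (geometric x j * geometric (x ^ j) k)   ≡⟨ lemma (geometric x j) (x ^ j)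
      (geometric (x ^ j) k) ⟩
    geometric x j * (1 + x ^ j * geometric (x ^ j) k)               ∎
    where
    lemma : ∀ a b c → a + b * (a * c) ≡ a * (1 + b * c)
    lemma = solve-∀

  parity : ∀ p → (Σ[ h ∈ ℕ ] p ≡ h * 2) ⊎ (Σ[ h ∈ ℕ ] p ≡ 1 + 2 * h)
  parity zero    = inj₁ (0 , refl)
  parity (suc p) with parity p
  ... | inj₁ (h , refl) = inj₂ (h , cong suc (ℕₚ.*-comm h 2))
  ... | inj₂ (h , refl) = inj₁ (suc h , cong (2 +_) (ℕₚ.*-comm 2 h))

  private
    -- k(k - 1)/2, the coefficient of m when the geometric sum in 1 + m is expanded in powers of m.
    triangle : ℕ → ℕ
    triangle zero    = 0
    triangle (suc k) = triangle k + k

    triangle-odd : ∀ h → triangle (1 + 2 * h) ≡ (1 + 2 * h) * h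
    triangle-odd h = ℕₚ.*-cancelˡ-≡ _ _ 2 (ℕₚ.+-cancelʳ-≡ (1 + 2 * h) _ _ (trans (double (1 + 2 * h))
      (lemma h)))
      where
      double-step : ∀ t k → 2 * (t + k) + suc k ≡ (2 * t + k) + (1 + 2 * k)
      double-step = solve-∀
      square : ∀ k → k * k + (1 + 2 * k) ≡ suc k * suc k
      square = solve-∀
      double : ∀ k → 2 * triangle k + k ≡ k * k
      double zero    = refl
      double (suc k) = trans (double-step (triangle k) k) (trans (cong (_+ (1 + 2 * k)) (double k))
        (square k))
      lemma : ∀ h → (1 + 2 * h) * (1 + 2 * h) ≡ 2 * ((1 + 2 * h) * h) + (1 + 2 * h)
      lemma = solve-∀

    geometric-expansion : ∀ m k → Σ[ y ∈ ℕ ] geometric (1 + m) k ≡ k + m * triangle k + m * m * y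
    geometric-expansion m zero    = 0 , lemma m
      where
      lemma : ∀ m → 0 ≡ m * 0 + m * m * 0
      lemma = solve-∀
    geometric-expansion m (suc k) with geometric-expansion m k
    ... | y , eq = y + triangle k + m * y ,
      trans (cong (λ g → 1 + (1 + m) * g) eq) (lemma m k (triangle k) y)
      where
      lemma : ∀ m k t y → 1 + (1 + m) * (k + m * t + m * m * y) ≡ suc k + m * (t + k) + m * m *
        (y + t + m * y)
      lemma = solve-∀

    -- Modulo m the geometric sum in 1 + m with k terms is k.
    ∣geometric⇒∣ : ∀ {p m} k → p ∣ m → p ∣ geometric (1 + m) k → p ∣ k
    ∣geometric⇒∣ {p} {m} k p∣m p∣g with geometric-expansion m k
    ... | y , eq = Div.∣m+n∣m⇒∣n {m = m * (triangle k + m * y)} (subst (p ∣_) (trans eq (lemma m k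
      (triangle k) y)) p∣g)
      (Div.∣m⇒∣m*n _ p∣m)
      where
      lemma : ∀ m k t y → k + m * t + m * m * y ≡ m * (t + m * y) + k
      lemma = solve-∀

    prime∤1+ : ∀ {r m} x → Prime r → r ∣ m → ¬ r ∣ (1 + m * x)
    prime∤1+ {r} {m} x pr r∣m r∣ = prime∤1 pr (Div.∣m+n∣m⇒∣n (subst (r ∣_) (ℕₚ.+-comm 1 (m * x)) r∣)
      (Div.∣m⇒∣m*n x r∣m))

    -- The sum contains p exactly once, up to a cofactor that is 1 modulo every prime divisor of m.
    -- For odd p this follows from the expansion up to m², since p divides both p(p - 1)/2 and m.
    -- For p = 2 the sum is 2 + m and the cofactor 1 + m/2; only 4 ∣ m keeps m/2 even.
    geometric-prime : ∀ {p m} → Prime p → p ∣ m → (2 ∣ p → 4 ∣ m) →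
                      Σ[ u ∈ ℕ ] geometric (1 + m) p ≡ p * u × (∀ r → Prime r → r ∣ m → ¬ r ∣ u)
    geometric-prime {p} {m} pp p∣m 4∣ with parity p
    ... | inj₂ (h , refl) with geometric-expansion m (1 + 2 * h) | p∣m
    ... | y , eq | divides m′ m≡ = 1 + m * (h + m′ * y) ,
      trans (trans eq (cong (λ t → p + m * t + m * m * y) (triangle-odd h)))
        (trans (cong (λ n → p + m * (p * h) + m * n * y) m≡) (lemma p m m′ h y)) ,
      λ r pr r∣m → prime∤1+ (h + m′ * y) pr r∣m
      where
      lemma : ∀ p m m′ h y → p + m * (p * h) + m * (m′ * p) * y ≡ p * (1 + m * (h + m′ * y))
      lemma = solve-∀
    geometric-prime {p} {m} pp p∣m 4∣ | inj₁ (h , p≡h*2) with prime∣prime⇒≡ Prime.prime[2] pp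
      (divides h p≡h*2)
    ... | refl with 4∣ Div.∣-refl
    ... | divides m′ refl = 1 + 2 * m′ * 1 , lemma m′ , λ r pr r∣m → prime∤1+ 1 pr (r∣2m′ r pr r∣m)
      where
      lemma : ∀ m → 1 + (1 + m * 4) * (1 + (1 + m * 4) * 0) ≡ 2 * (1 + 2 * m * 1)
      lemma = solve-∀
      lemma′ : ∀ m → m * 4 ≡ 2 * (2 * m)
      lemma′ = solve-∀
      r∣2m′ : ∀ r → Prime r → r ∣ m′ * 4 → r ∣ 2 * m′
      r∣2m′ r pr r∣ with Prime.euclidsLemma 2 (2 * m′) pr (subst (r ∣_) (lemma′ m′) r∣)
      ... | inj₁ r∣2 = Div.∣m⇒∣m*n m′ r∣2
      ... | inj₂ r∣  = r∣

    -- The listed primes may repeat, so they are cancelled one at a time by Euclid's lemma.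
    product∣-cancel : ∀ ps u {y} → All Prime ps → All (λ r → ¬ r ∣ u) ps → product ps ∣ u * y → product ps ∣ y
    product∣-cancel []       u [] [] _ = Div.1∣ _
    product∣-cancel (p ∷ ps) u {y} (pp ∷ pps) (p∤u ∷ ps∤u) p*P∣
      with Prime.euclidsLemma u y pp (Div.∣-trans (Div.m∣m*n (product ps)) p*P∣)
    ... | inj₁ p∣u = contradiction p∣u p∤u
    ... | inj₂ (divides y′ refl) = subst (_∣ y′ * p) (ℕₚ.*-comm (product ps) p) (Div.*-monoˡ-∣ p
      (product∣-cancel ps u pps ps∤u (Div.*-cancelˡ-∣ p {{Prime.prime⇒nonZero pp}}
        (subst (p * product ps ∣_) (lemma u y′ p) p*P∣))))
      where
      lemma : ∀ u y p → u * (y * p) ≡ p * (u * y)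
      lemma = solve-∀

    -- The primes are removed one at a time. As p ∣ k, write k = k′ p; the sum with k terms is the
    -- sum with p terms times a sum with k′ terms in (1 + m)^p = 1 + m′. The first factor is p times
    -- a cofactor prime to the rest, and m ∣ m′ preserves the hypotheses for the second.
    product∣geometric⇒∣ : ∀ ps m k → All Prime ps → All (_∣ m) ps → (2 ∣ product ps → 4 ∣ m) →
                          product ps ∣ geometric (1 + m) k → product ps ∣ k
    product∣geometric⇒∣ []       m k [] [] _ _ = Div.1∣ k
    product∣geometric⇒∣ (p ∷ ps) m k (pp ∷ pps) (p∣m ∷ ps∣m) 4∣ p*P∣
      with ∣geometric⇒∣ k p∣m (Div.∣-trans (Div.m∣m*n (product ps)) p*P∣)
         | geometric-prime pp p∣m (λ 2∣p → 4∣ (Div.∣-trans 2∣p (Div.m∣m*n (product ps))))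
    ... | divides k′ refl | u , g≡p*u , u-unit =
      subst (_∣ k′ * p) (ℕₚ.*-comm (product ps) p) (Div.*-monoˡ-∣ p
        (product∣geometric⇒∣ ps m′ k′ pps (All.map (Div.∣m⇒∣m*n _) ps∣m)
          (λ 2∣P → Div.∣m⇒∣m*n _ (4∣ (Div.∣n⇒∣m*n p 2∣P)))
          (product∣-cancel ps u pps (All.zipWith (λ (pr , r∣m) → u-unit _ pr r∣m) (pps , ps∣m))
            (Div.*-cancelˡ-∣ p {{Prime.prime⇒nonZero pp}} (subst (p * product ps ∣_) g≡ p*P∣)))))
      where
      m′ = m * geometric (1 + m) p
      g≡ : geometric (1 + m) (k′ * p) ≡ p * (u * geometric (1 + m′) k′)
      g≡ = trans (geometric-* (1 + m) p k′) (trans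
        (cong₂ (λ a b → a * geometric b k′) g≡p*u (^≡1+*geometric m p)) (ℕₚ.*-assoc p u _))

  -- A form of the lifting-the-exponent lemma.
  ∣geometric⇒∣exponent : ∀ t .{{_ : NonZero t}} m k → (∀ p → Prime p → p ∣ t → p ∣ m) → (2 ∣ t → 4 ∣ m) →
                         t ∣ geometric (1 + m) k → t ∣ k
  ∣geometric⇒∣exponent t m k primes∣m 4∣m with factorise t
  ... | record { factors = ps ; isFactorisation = refl ; factorsPrime = pps } =
    product∣geometric⇒∣ ps m k pps
      (All.tabulate (λ {p} p∈ps → primes∣m p (All.lookup pps p∈ps) (∈⇒∣product p∈ps))) 4∣m

  4n≡2n*2 : ∀ n → 4 * n ≡ 2 * n * 2
  4n≡2n*2 = solve-∀

  s*[o*[k*p]]≡[k*o]*[s*p] : ∀ s o k p → s * (o * (k * p)) ≡ (k * o) * (s * p)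
  s*[o*[k*p]]≡[k*o]*[s*p] = solve-∀

  m∣[1+m]²∸1 : ∀ m → m ∣ (1 + m) ^ 2 ℕ.∸ 1
  m∣[1+m]²∸1 m = divides (2 + m) (cong (ℕ._∸ 1) (lemma m))
    where
    lemma : ∀ m → (1 + m) * ((1 + m) * 1) ≡ 1 + (2 + m) * m
    lemma = solve-∀

  4∣odd²∸1 : ∀ h → 4 ∣ (1 + 2 * h) ^ 2 ℕ.∸ 1
  4∣odd²∸1 h = divides (h * h + h) (cong (ℕ._∸ 1) (lemma h))
    where
    lemma : ∀ h → (1 + 2 * h) * ((1 + 2 * h) * 1) ≡ 1 + (h * h + h) * 4
    lemma = solve-∀

-- Dickson polynomials: coefficients, recurrence and functional equation.

module DicksonNumbers where
  open import Data.Nat.Base using (_+_; _*_; _∸_)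
  open ≡ using (refl; sym; trans; cong; cong₂)
  open ≡.≡-Reasoning

  nC0≡1 : ∀ n → n C 0 ≡ 1
  nC0≡1 n = trans (Comb.nCk≡nC[n∸k] {n = n} z≤n) (Comb.nCn≡1 n)

  pascal : ∀ n k → suc n C suc k ≡ n C k + n C suc k
  pascal n k = sym (Comb.nCk+nC[k+1]≡[n+1]C[k+1] n k)

  absorption : ∀ n k → suc k * (suc n C suc k) ≡ suc n * (n C k)
  absorption zero    zero    = refl
  absorption zero    (suc k) = trans (cong (suc (suc k) *_) (Comb.k>n⇒nCk≡0 {1} {suc (suc k)} (s≤s
    (s≤s z≤n))))
    (trans (ℕₚ.*-zeroʳ (suc (suc k))) (cong (1 *_) (sym (Comb.k>n⇒nCk≡0 {0} {suc k} (s≤s z≤n)))))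
  absorption (suc n) zero    = trans (ℕₚ.*-identityˡ _) (trans (Comb.nC1≡n (suc (suc n)))
    (sym (trans (cong (suc (suc n) *_) (nC0≡1 (suc n))) (ℕₚ.*-identityʳ _))))
  absorption (suc n) (suc k) = begin
    suc (suc k) * (suc (suc n) C suc (suc k))
      ≡⟨ cong (suc (suc k) *_) (pascal (suc n) (suc k)) ⟩
    suc (suc k) * (a + suc n C suc (suc k))
      ≡⟨ ℕₚ.*-distribˡ-+ (suc (suc k)) a _ ⟩
    suc (suc k) * a + suc (suc k) * (suc n C suc (suc k))
      ≡⟨ cong₂ (λ x y → a + x + y) (absorption n k) (absorption n (suc k)) ⟩
    a + suc n * (n C k) + suc n * (n C suc k)
      ≡⟨ lemma (suc n) a (n C k) (n C suc k) ⟩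
    a + suc n * (n C k + n C suc k)
      ≡⟨ cong (λ x → a + suc n * x) (pascal n k) ⟨
    suc (suc n) * a ∎
    where
    a = suc n C suc k
    lemma : ∀ n a b c → a + n * b + n * c ≡ a + n * (b + c)
    lemma = solve-∀

  private
    quotient : ∀ d m i → d ≡ suc m → .{{_ : NonZero d}} →
               (2 + (m + i)) * (d C suc i) / d ≡ d C suc i + m C i
    quotient (suc m) m i refl = trans
      (cong (_/ suc m) (begin
        (2 + (m + i)) * (suc m C suc i)                         ≡⟨ lemma m i (suc m C suc i) ⟩
        suc m * (suc m C suc i) + suc i * (suc m C suc i)       ≡⟨ cong (suc m * (suc m C suc i) +_)
          (absorption m i) ⟩
        suc m * (suc m C suc i) + suc m * (m C i)               ≡⟨ ℕₚ.*-distribˡ-+ (suc m) (suc m C suc i)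
          (m C i) ⟨
        suc m * (suc m C suc i + m C i)                         ≡⟨ ℕₚ.*-comm (suc m) _ ⟩
        (suc m C suc i + m C i) * suc m                         ∎))
      (DivMod.m*n/n≡m (suc m C suc i + m C i) (suc m))
      where
      lemma : ∀ m i x → (2 + (m + i)) * x ≡ suc m * x + suc i * x
      lemma = solve-∀

  -- The absorption identity makes the division exact. The two summands express D_{n+2} as E_{n+2} -
  -- a E_n, where E denotes the Dickson polynomials of the second kind, whose plain binomial
  -- coefficients obey Pascal's rule.
  dicksonNumber-suc : ∀ n i → i ℕ.≤ n → .{{_ : NonZero (suc n ∸ i)}} →
                      (2 + n) * ((suc n ∸ i) C suc i) / (suc n ∸ i) ≡ (suc n ∸ i) C suc i + (n ∸ i) C i
  dicksonNumber-suc n i i≤n = trans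
    (cong (λ k → (2 + k) * ((suc n ∸ i) C suc i) / (suc n ∸ i)) (sym (ℕₚ.m∸n+n≡m i≤n)))
    (quotient (suc n ∸ i) (n ∸ i) i (ℕₚ.+-∸-assoc 1 i≤n))

module DicksonSequence (S : CommutativeRing c ℓ) (x y : CommutativeRing.Carrier S) where
  open CommutativeRing S
  open DicksonNumbers using (nC0≡1; pascal)
  open Algebra.Properties.Semiring.Exp semiring
  open Algebra.Properties.Semiring.Mult semiring using (×-congˡ; ×-homo-+; ×-comm-*; ×-homo-1) renaming
    (_×_ to _·_)
  open CommutativeRingSolver S
  open SetoidReasoning setoid
  private module Σ+ = CommutativeMonoidSum +-commutativeMonoid
  open Algebra.Properties.Semiring.Sum semiring using (*-distribˡ-sum)

  term : ℕ → ℕ → Carrier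
  term n i = (((n ℕ.∸ i) C i) · y ^ i) * x ^ (n ℕ.∸ 2 ℕ.* i)

  -- The upper limit `N` is independent of `n`: terms past n/2 vanish, so the recursion can relate
  -- sums of neighbouring indices without adjusting their ranges.
  binomialSum : ℕ → ℕ → Carrier
  binomialSum N n = Σ+.sum {suc N} (λ i → term n (toℕ i))

  term-zero : ∀ n → term n 0 ≈ x ^ n
  term-zero n = trans (*-congʳ (trans (×-congˡ (nC0≡1 n)) (×-homo-1 1#))) (*-identityˡ _)

  term-vanishes : ∀ n i → n ℕ.∸ i ℕ.< i → term n i ≈ 0#
  term-vanishes n i lt = trans (*-congʳ (×-congˡ (Comb.k>n⇒nCk≡0 lt))) (zeroˡ _)

  2*suc : ∀ i → 2 ℕ.* suc i ≡ 2 ℕ.+ 2 ℕ.* i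
  2*suc i = ≡.cong suc (ℕₚ.+-suc i (i ℕ.+ 0))

  private
    exponent : ∀ n i → (2 ℕ.+ n) ℕ.∸ 2 ℕ.* suc i ≡ n ℕ.∸ 2 ℕ.* i
    exponent n i = ≡.cong ((2 ℕ.+ n) ℕ.∸_) (2*suc i)

    exponent-suc : ∀ n i → i ℕ.< n ℕ.∸ i → n ℕ.∸ 2 ℕ.* i ≡ suc ((1 ℕ.+ n) ℕ.∸ 2 ℕ.* suc i)
    exponent-suc n i i<n∸i = ≡.trans
      (≡.trans (≡.cong (ℕ._∸ 2 ℕ.* i) n≡) (ℕₚ.m+n∸m≡n (2 ℕ.* i) (suc m)))
      (≡.cong suc (≡.sym (≡.trans (≡.cong₂ (λ a b → (1 ℕ.+ a) ℕ.∸ b) n≡ (2*suc i))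
        (≡.trans (≡.cong (ℕ._∸ (1 ℕ.+ 2 ℕ.* i)) (ℕₚ.+-suc (2 ℕ.* i) m)) (ℕₚ.m+n∸m≡n (2 ℕ.* i) m)))))
      where
      m = (n ℕ.∸ i) ℕ.∸ suc i
      lemma : ∀ i m → (suc i ℕ.+ m) ℕ.+ i ≡ 2 ℕ.* i ℕ.+ suc m
      lemma = solve-∀
      i≤n : i ℕ.≤ n
      i≤n = ℕₚ.≤-trans (ℕₚ.<⇒≤ i<n∸i) (ℕₚ.m∸n≤m n i)
      n≡ : n ≡ 2 ℕ.* i ℕ.+ suc m
      n≡ = ≡.trans (≡.sym (ℕₚ.m∸n+n≡m i≤n))
        (≡.trans (≡.cong (ℕ._+ i) (≡.sym (ℕₚ.m+[n∸m]≡n i<n∸i))) (lemma i m))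

    -- The exponents match only for i < n - i. Beyond that, truncated subtraction breaks the
    -- exponent law, but both sides vanish with their binomial coefficients.
    x*term : ∀ n i → (((n ℕ.∸ i) C suc i) · y ^ suc i) * x ^ (n ℕ.∸ 2 ℕ.* i) ≈ x * term (1 ℕ.+ n) (suc i)
    x*term n i with i ℕₚ.<? n ℕ.∸ i
    ... | yes i<n∸i = trans (*-congˡ (reflexive (≡.cong (x ^_) (exponent-suc n i i<n∸i))))
      (solve 3 (λ a x b → a :* (x :* b) := x :* (a :* b)) refl _ x _)
    ... | no i≮n∸i  = trans (trans (*-congʳ (×-congˡ (Comb.k>n⇒nCk≡0 lt))) (zeroˡ _))
      (sym (trans (*-congˡ (term-vanishes (1 ℕ.+ n) (suc i) lt)) (zeroʳ x)))
      where lt = s≤s (ℕₚ.≮⇒≥ i≮n∸i)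

  term-suc : ∀ n i → term (2 ℕ.+ n) (suc i) ≈ x * term (1 ℕ.+ n) (suc i) + y * term n i
  term-suc n i with i ℕₚ.≤? n
  ... | yes i≤n = begin
    (((suc n ℕ.∸ i) C suc i) · y ^ suc i) * x ^ ((2 ℕ.+ n) ℕ.∸ 2 ℕ.* suc i)
      ≡⟨ ≡.cong₂ (λ k e → (k · y ^ suc i) * x ^ e)
           (≡.trans (≡.cong (_C suc i) (ℕₚ.+-∸-assoc 1 i≤n)) (pascal (n ℕ.∸ i) i)) (exponent n i) ⟩
    ((c₁ ℕ.+ c₂) · y ^ suc i) * x ^ (n ℕ.∸ 2 ℕ.* i)
      ≈⟨ *-congʳ (trans (×-homo-+ (y ^ suc i) c₁ c₂) (+-congʳ (sym (×-comm-* c₁ y (y ^ i))))) ⟩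
    (y * (c₁ · y ^ i) + c₂ · y ^ suc i) * x ^ (n ℕ.∸ 2 ℕ.* i)
      ≈⟨ solve 4 (λ y a b z → (y :* a :+ b) :* z := b :* z :+ y :* (a :* z)) refl y _ _ _ ⟩
    (c₂ · y ^ suc i) * x ^ (n ℕ.∸ 2 ℕ.* i) + y * term n i
      ≈⟨ +-congʳ (x*term n i) ⟩
    x * term (1 ℕ.+ n) (suc i) + y * term n i ∎
    where
    c₁ = (n ℕ.∸ i) C i
    c₂ = (n ℕ.∸ i) C suc i
  ... | no i≰n = trans (term-vanishes (2 ℕ.+ n) (suc i) (below (ℕₚ.m≤n⇒m∸n≡0 n<i) (s≤s z≤n)))
    (sym (trans (+-cong (trans (*-congˡ (term-vanishes (1 ℕ.+ n) (suc i) (below n∸i≡0 (s≤s z≤n)))) (zeroʳ x))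
      (trans (*-congˡ (term-vanishes n i (below n∸i≡0 (ℕₚ.≤-trans (s≤s z≤n) n<i)))) (zeroʳ y)))
        (+-identityʳ 0#)))
    where
    n<i = ℕₚ.≰⇒> i≰n
    n∸i≡0 = ℕₚ.m≤n⇒m∸n≡0 (ℕₚ.<⇒≤ n<i)
    below : ∀ {a b} → a ≡ 0 → 0 ℕ.< b → a ℕ.< b
    below ≡.refl 0<b = 0<b

  binomialSum-suc : ∀ N n → binomialSum (suc N) (2 ℕ.+ n) ≈ x * binomialSum (suc N)
    (1 ℕ.+ n) + y * binomialSum N n
  binomialSum-suc N n = begin
    term (2 ℕ.+ n) 0 + Σ+.sum {suc N} (λ i → term (2 ℕ.+ n) (suc (toℕ i)))
      ≈⟨ +-cong (trans (term-zero (2 ℕ.+ n)) (*-congˡ (sym (term-zero (1 ℕ.+ n)))))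
           (trans (Σ+.sum-cong-≋ {suc N} (λ i → term-suc n (toℕ i)))
             (Σ+.∑-distrib-+ {suc N} (λ i → x * term (1 ℕ.+ n) (suc (toℕ i))) (λ i → y * term n (toℕ i)))) ⟩
    x * term (1 ℕ.+ n) 0 + (Σ+.sum {suc N} (λ i → x * term (1 ℕ.+ n) (suc (toℕ i))) + Σ+.sum {suc N}
      (λ i → y * term n (toℕ i)))
      ≈⟨ +-congˡ (+-cong (sym (*-distribˡ-sum {suc N} x (λ i → term (1 ℕ.+ n) (suc (toℕ i)))))
           (sym (*-distribˡ-sum {suc N} y (λ i → term n (toℕ i))))) ⟩
    x * term (1 ℕ.+ n) 0 + (x * Σ+.sum {suc N} (λ i → term (1 ℕ.+ n) (suc (toℕ i))) + y * binomialSum N n)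
      ≈⟨ solve 4 (λ x a b c → x :* a :+ (x :* b :+ c) := x :* (a :+ b) :+ c) refl x _ _ _ ⟩
    x * binomialSum (suc N) (1 ℕ.+ n) + y * binomialSum N n ∎

  secondKind : ℕ → Carrier
  secondKind 0             = 1#
  secondKind 1             = x
  secondKind (suc (suc n)) = x * secondKind (suc n) + y * secondKind n

  private
    sum-zero : ∀ {m} (f : Fin m → Carrier) → (∀ i → f i ≈ 0#) → Σ+.sum f ≈ 0#
    sum-zero {m} f f≈0 = trans (Σ+.sum-cong-≋ f≈0) (Σ+.sum-replicate-zero m)

    tail-vanishes : ∀ N n → n ℕ.≤ 1 → Σ+.sum {N} (λ i → term n (suc (toℕ i))) ≈ 0#
    tail-vanishes N n n≤1 = sum-zero {N} _ λ i →
      term-vanishes n (suc (toℕ i)) (≡.subst (ℕ._< suc (toℕ i)) (≡.sym (ℕₚ.m≤n⇒m∸n≡0 (ℕₚ.≤-trans n≤1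
        (s≤s z≤n)))) (s≤s z≤n))

  binomialSum≈secondKind : ∀ n N → ⌊ n /2⌋ ℕ.≤ N → binomialSum N n ≈ secondKind n
  binomialSum≈secondKind 0 N _ = trans (+-cong (term-zero 0) (tail-vanishes N 0 z≤n)) (+-identityʳ 1#)
  binomialSum≈secondKind 1 N _ = trans (+-cong (term-zero 1) (tail-vanishes N 1 ℕₚ.≤-refl))
    (trans (+-identityʳ _) (*-identityʳ x))
  binomialSum≈secondKind (suc (suc n)) (suc N) (s≤s le) = trans (binomialSum-suc N n)
    (+-cong (*-congˡ (binomialSum≈secondKind (suc n) (suc N)
        (ℕₚ.≤-trans (ℕₚ.⌊n/2⌋-mono (ℕₚ.n≤1+n (suc n))) (s≤s le))))
      (*-congˡ (binomialSum≈secondKind n N le)))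

  -- Both sides satisfy the linear recurrence of order two with characteristic roots u and w, hence
  -- the two base cases.
  secondKind≈powerSum : ∀ {u w} → x ≈ u + w → y ≈ - (u * w) → ∀ n →
                        secondKind (2 ℕ.+ n) + y * secondKind n ≈ u ^ (2 ℕ.+ n) + w ^ (2 ℕ.+ n)
  secondKind≈powerSum {u} {w} x≈ y≈ 0 = trans (+-cong (+-cong (*-cong x≈ x≈) (*-congʳ y≈)) (*-congʳ y≈))
    (solve 2 (λ u w → ((u :+ w) :* (u :+ w) :+ :- (u :* w) :* con (1 , 0)) :+ :- (u :* w) :* con (1 , 0) :=
      u :* (u :* con (1 , 0)) :+ w :* (w :* con (1 , 0))) refl u w)
  secondKind≈powerSum {u} {w} x≈ y≈ 1 = trans
    (+-cong (+-cong (*-cong x≈ (+-cong (*-cong x≈ x≈) (*-congʳ y≈))) (*-cong y≈ x≈)) (*-cong y≈ x≈))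
    (solve 2 (λ u w → ((u :+ w) :* ((u :+ w) :* (u :+ w) :+ :- (u :* w) :* con (1 , 0)) :+ :- (u :* w) :*
      (u :+ w))
        :+ :- (u :* w) :* (u :+ w) :=
      u :* (u :* (u :* con (1 , 0))) :+ w :* (w :* (w :* con (1 , 0)))) refl u w)
  secondKind≈powerSum {u} {w} x≈ y≈ (suc (suc n)) = begin
    (x * s₃ + y * s₂) + y * (x * s₁ + y * s₀)
      ≈⟨ solve 6 (λ x y a b c d → (x :* a :+ y :* b) :+ y :* (x :* c :+ y :* d) :=
           x :* (a :+ y :* c) :+ y :* (b :+ y :* d)) refl x y s₃ s₂ s₁ s₀ ⟩
    x * (s₃ + y * s₁) + y * (s₂ + y * s₀)
      ≈⟨ +-cong (*-cong x≈ (secondKind≈powerSum x≈ y≈ (suc n))) (*-cong y≈ (secondKind≈powerSum x≈ y≈ n)) ⟩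
    (u + w) * (u ^ (3 ℕ.+ n) + w ^ (3 ℕ.+ n)) + - (u * w) * (u ^ (2 ℕ.+ n) + w ^ (2 ℕ.+ n))
      ≈⟨ solve 4 (λ u w a b → (u :+ w) :* (u :* a :+ w :* b) :+ :- (u :* w) :* (a :+ b) :=
           u :* (u :* a) :+ w :* (w :* b)) refl u w (u ^ (2 ℕ.+ n)) (w ^ (2 ℕ.+ n)) ⟩
    u ^ (4 ℕ.+ n) + w ^ (4 ℕ.+ n) ∎
    where
    s₀ = secondKind n ; s₁ = secondKind (1 ℕ.+ n) ; s₂ = secondKind (2 ℕ.+ n) ; s₃ = secondKind (3 ℕ.+ n)

module DicksonMonic (R : CommutativeRing c ℓ) where
  open CommutativeRing R
  open PolynomialRing R
  open Degrees R
  open Algebra.Properties.Semiring.Exp semiring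
  open Algebra.Properties.Semiring.Mult semiring using (×-congˡ; ×-homo-1) renaming (_×_ to _·_)
  private
    open RawMonoidDefs (RawRing.+-rawMonoid polyRawRing) using () renaming (sum to sumᴾ)

    coeff-sum-zero : ∀ {m} (f : Fin m → Poly) k → (∀ i → coeff (f i) k ≈ 0#) → coeff (sumᴾ f) k ≈ 0#
    coeff-sum-zero {zero}  f k _ = refl
    coeff-sum-zero {suc m} f k z = trans (coeff-+ (f Fin.zero) (sumᴾ (f ∘ Fin.suc)) k)
      (trans (+-cong (z Fin.zero) (coeff-sum-zero (f ∘ Fin.suc) k (z ∘ Fin.suc))) (+-identityˡ 0#))

  dicksonTerm : ∀ n .{{_ : NonZero n}} → Carrier → Fin (suc ⌊ n /2⌋) → Poly
  dicksonTerm n a i = monomial (dicksonNumber n i · (- a) ^ toℕ i) (n ℕ.∸ 2 ℕ.* toℕ i)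

  dicksonNumber-zero : ∀ n .{{_ : NonZero n}} → dicksonNumber n Fin.zero ≡ 1
  dicksonNumber-zero n = ≡.trans
    (≡.cong (λ k → n ℕ.* k / n) (DicksonNumbers.nC0≡1 n))
    (≡.trans (≡.cong (_/ n) (ℕₚ.*-identityʳ n)) (DivMod.n/n≡1 n))

  dickson-MonicAt : ∀ n .{{_ : NonZero n}} a → MonicAt n (dickson n a)
  dickson-MonicAt n@(suc n-1) a =
    trans (coeff-+ (terms Fin.zero) (sumᴾ (terms ∘ Fin.suc)) n)
      (trans (+-cong (trans (monomial-lead (c₀ · 1#) n) (trans (×-congˡ (dicksonNumber-zero n))
        (×-homo-1 1#)))
        (coeff-sum-zero (terms ∘ Fin.suc) n λ i → vanishes (Fin.suc i)
          (s≤s (ℕₚ.m∸n≤m n-1 (toℕ i ℕ.+ suc (toℕ i ℕ.+ 0))))))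
        (+-identityʳ 1#)) ,
    λ j n<j → coeff-sum-zero terms j λ i → vanishes i (ℕₚ.≤-<-trans (ℕₚ.m∸n≤m n (2 ℕ.* toℕ i)) n<j)
    where
    terms = dicksonTerm n a
    vanishes : ∀ i {j} → n ℕ.∸ 2 ℕ.* toℕ i ℕ.< j → coeff (terms i) j ≈ 0#
    vanishes i lt = coeff-monomial-≢ (dicksonNumber n i · (- a) ^ toℕ i) (ℕₚ.<⇒≢ lt)
    c₀ = dicksonNumber n Fin.zero

module DicksonPolynomial (R : CommutativeRing c ℓ) (S : CommutativeRing c′ ℓ′)
    (φ : CommutativeRing.Carrier R → CommutativeRing.Carrier S) (isHom : IsHom R S φ) where
  open CommutativeRing S
  open RingMorphisms.IsRingHomomorphism isHom
  open PolynomialMap R S φ isHom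
  open Evaluation S using (eval; eval-+; eval-congˡ; eval-monomial)
  open Algebra.Properties.Semiring.Exp semiring
  open Algebra.Properties.Semiring.Mult semiring using (×-congˡ; ×-congʳ; ×-homo-+; ×-comm-*) renaming
    (_×_ to _·_)
  open DicksonMonic R using (dicksonTerm; dicksonNumber-zero)
  open SetoidReasoning setoid
  open Algebra.Properties.Semiring.Sum semiring using (*-distribˡ-sum)
  private
    module Σ+ = CommutativeMonoidSum +-commutativeMonoid
    module R = CommutativeRing R
    module R[X] = PolynomialRing R
    open RawMonoidDefs (RawRing.+-rawMonoid R[X].polyRawRing) using () renaming (sum to sumᴾ)

    eval-sum : ∀ {m} (f : Fin m → R[X].Poly) u → eval (map φ (sumᴾ f)) u ≈ Σ+.sum (λ i → eval (map φ (f i)) u)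
    eval-sum {zero}  f u = refl
    eval-sum {suc m} f u = trans (eval-congˡ u (map-+ (f Fin.zero) _))
      (trans (eval-+ (map φ (f Fin.zero)) _ u) (+-congˡ (eval-sum (f ∘ Fin.suc) u)))

  -- Waring's formula. Besides monicity and degree, it is the property of Dickson polynomials on
  -- which the later argument rests.
  eval-dickson : ∀ n .{{_ : NonZero n}} a {u w} → φ a ≈ u * w →
                 eval (map φ (R[X].dickson n a)) (u + w) ≈ u ^ n + w ^ n
  eval-dickson n@(suc _) a {u} {w} φa≈uw = trans (eval-sum (dicksonTerm n a) x) (trans
    (Σ+.sum-cong-≋ eval-term) (closed n))
    where
    x = u + w
    y = φ (R.- a)
    y≈ : y ≈ - (u * w)
    y≈ = trans (-‿homo a) (-‿cong φa≈uw)
    open DicksonSequence S x y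
    coefficient : ∀ n .{{_ : NonZero n}} → Fin (suc ⌊ n /2⌋) → Carrier
    coefficient n i = (R[X].dicksonNumber n i · y ^ toℕ i) * x ^ (n ℕ.∸ 2 ℕ.* toℕ i)
    eval-term : ∀ i → eval (map φ (dicksonTerm n a i)) x ≈ coefficient n i
    eval-term i = trans (eval-congˡ x (map-monomial _ (n ℕ.∸ 2 ℕ.* toℕ i)))
      (trans (eval-monomial _ (n ℕ.∸ 2 ℕ.* toℕ i) x)
        (*-congʳ (trans (·-homo (R[X].dicksonNumber n i) _) (×-congʳ (R[X].dicksonNumber n i) (^-homo
          (R.- a) (toℕ i))))))
    coefficient-zero : ∀ n .{{_ : NonZero n}} → coefficient n Fin.zero ≈ term n 0
    coefficient-zero n = *-congʳ (×-congˡ (≡.trans (dicksonNumber-zero n) (≡.sym (DicksonNumbers.nC0≡1 n))))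
    coefficient-suc : ∀ n i → coefficient (2 ℕ.+ n) (Fin.suc i) ≈ term (2 ℕ.+ n) (suc (toℕ i)) + y * term n
      (toℕ i)
    coefficient-suc n i = begin
      (R[X].dicksonNumber (2 ℕ.+ n) (Fin.suc i) · y ^ suc (toℕ i)) * x ^ ((2 ℕ.+ n) ℕ.∸ 2 ℕ.* suc (toℕ i))
        ≈⟨ *-congʳ (×-congˡ (DicksonNumbers.dicksonNumber-suc n (toℕ i) i≤n
          {{ℕ.≢-nonZero (ℕₚ.m>n⇒m∸n≢0 (s≤s i≤n))}})) ⟩
      (((suc n ℕ.∸ toℕ i) C suc (toℕ i) ℕ.+ (n ℕ.∸ toℕ i) C toℕ i) · y ^ suc (toℕ i)) * x ^
        ((2 ℕ.+ n) ℕ.∸ 2 ℕ.* suc (toℕ i))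
        ≈⟨ *-congʳ (×-homo-+ _ ((suc n ℕ.∸ toℕ i) C suc (toℕ i)) ((n ℕ.∸ toℕ i) C toℕ i)) ⟩
      (_ + ((n ℕ.∸ toℕ i) C toℕ i) · y ^ suc (toℕ i)) * x ^ ((2 ℕ.+ n) ℕ.∸ 2 ℕ.* suc (toℕ i))
        ≈⟨ distribʳ _ _ _ ⟩
      term (2 ℕ.+ n) (suc (toℕ i)) + (((n ℕ.∸ toℕ i) C toℕ i) · y ^ suc (toℕ i)) * x ^
        ((2 ℕ.+ n) ℕ.∸ 2 ℕ.* suc (toℕ i))
        ≈⟨ +-congˡ (*-cong (sym (×-comm-* ((n ℕ.∸ toℕ i) C toℕ i) y (y ^ toℕ i)))
             (reflexive (≡.cong (λ e → x ^ ((2 ℕ.+ n) ℕ.∸ e)) (2*suc (toℕ i))))) ⟩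
      term (2 ℕ.+ n) (suc (toℕ i)) + (y * (((n ℕ.∸ toℕ i) C toℕ i) · y ^ toℕ i)) * x ^ (n ℕ.∸ 2 ℕ.* toℕ i)
        ≈⟨ +-congˡ (*-assoc _ _ _) ⟩
      term (2 ℕ.+ n) (suc (toℕ i)) + y * term n (toℕ i) ∎
      where
      i≤n : toℕ i ℕ.≤ n
      i≤n = ℕₚ.≤-trans (Finₚ.toℕ≤pred[n] i) (ℕₚ.⌊n/2⌋≤n n)
    closed : ∀ n .{{_ : NonZero n}} → Σ+.sum (coefficient n) ≈ u ^ n + w ^ n
    closed 1 = trans (+-identityʳ _) (trans (coefficient-zero 1) (trans (term-zero 1)
      (distribʳ 1# u w)))
    closed (suc (suc n)) = begin
      coefficient (2 ℕ.+ n) Fin.zero + Σ+.sum {suc ⌊ n /2⌋} (λ i → coefficient (2 ℕ.+ n) (Fin.suc i))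
        ≈⟨ +-cong (coefficient-zero (2 ℕ.+ n)) (trans (Σ+.sum-cong-≋ {suc ⌊ n /2⌋} (coefficient-suc n))
             (Σ+.∑-distrib-+ {suc ⌊ n /2⌋} (λ i → term (2 ℕ.+ n) (suc (toℕ i))) (λ i → y * term n (toℕ i)))) ⟩
      term (2 ℕ.+ n) 0 + (Σ+.sum {suc ⌊ n /2⌋} (λ i → term (2 ℕ.+ n) (suc (toℕ i))) + Σ+.sum {suc ⌊ n /2⌋}
        (λ i → y * term n (toℕ i)))
        ≈⟨ +-assoc _ _ _ ⟨
      binomialSum (suc ⌊ n /2⌋) (2 ℕ.+ n) + Σ+.sum {suc ⌊ n /2⌋} (λ i → y * term n (toℕ i))
        ≈⟨ +-congˡ (*-distribˡ-sum {suc ⌊ n /2⌋} y (λ i → term n (toℕ i))) ⟨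
      binomialSum (suc ⌊ n /2⌋) (2 ℕ.+ n) + y * binomialSum ⌊ n /2⌋ n
        ≈⟨ +-cong (binomialSum≈secondKind (2 ℕ.+ n) (suc ⌊ n /2⌋) ℕₚ.≤-refl)
             (*-congˡ (binomialSum≈secondKind n ⌊ n /2⌋ ℕₚ.≤-refl)) ⟩
      secondKind (2 ℕ.+ n) + y * secondKind n
        ≈⟨ secondKind≈powerSum refl y≈ n ⟩
      u ^ (2 ℕ.+ n) + w ^ (2 ℕ.+ n) ∎

-- Z^d · b^{-d} · f(b(Z + 1/Z)) for a monic polynomial f of degree d, given by its
-- lower coefficients.
module ReciprocalSubstitution (R : CommutativeRing c ℓ)
    {b b⁻¹ : CommutativeRing.Carrier R} (bb⁻¹≈1 : AreInverse R b b⁻¹) where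
  open CommutativeRing R
  open PolynomialRing R
  open Degrees R
  open Algebra.Properties.Semiring.Exp semiring

  substituted : ∀ {d} → Vec Carrier d → Poly
  substituted []            = constant 1#
  substituted {suc d} (x ∷ v) = (1# ∷ 0# ∷ 1# ∷ []) *ᴾ substituted v +ᴾ monomial (x * b⁻¹ ^ suc d) (suc d)

  substituted-MonicAt : ∀ {d} (v : Vec Carrier d) → MonicAt (d ℕ.* 2) (substituted v)
  substituted-MonicAt []      = refl , Below-constant 1#
  substituted-MonicAt {suc d} (x ∷ v) = MonicAt-+ {p = (1# ∷ 0# ∷ 1# ∷ []) *ᴾ substituted v} {monomial
    (x * b⁻¹ ^ suc d) (suc d)}
    (MonicAt-* {2} {d ℕ.* 2} {1# ∷ 0# ∷ 1# ∷ []} {substituted v}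
      (refl , λ { (suc (suc (suc j))) _ → refl ; (suc (suc zero)) (s≤s (s≤s ())) ; (suc zero) (s≤s ()) })
      (substituted-MonicAt v))
    (Below-≤ {p = monomial (x * b⁻¹ ^ suc d) (suc d)} (s≤s (s≤s (ℕₚ.m≤m*n d 2))) (monomial-Below _ (suc d)))

  -- It makes Z invertible modulo any divisor of the polynomial, so that 1/z is available next to z.
  substituted-constant : ∀ {d} (v : Vec Carrier d) → coeff (substituted v) 0 ≈ 1#
  substituted-constant []      = refl
  substituted-constant {suc d} (x ∷ v) = trans (coeff-+ ((1# ∷ 0# ∷ 1# ∷ []) *ᴾ substituted v) (monomial
    (x * b⁻¹ ^ suc d) (suc d)) 0)
    (trans (+-identityʳ _) (trans (coeff-*-zero 1# (0# ∷ 1# ∷ []) (substituted v))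
      (trans (*-identityˡ _) (substituted-constant v))))

  module _ (S : CommutativeRing c′ ℓ′) (ψ : Carrier → CommutativeRing.Carrier S) (isHom : IsHom R S ψ)
      {z z⁻¹ : CommutativeRing.Carrier S} (zz⁻¹≈1 : AreInverse S z z⁻¹) where
    private
      module S = CommutativeRing S
      open RingMorphisms.IsRingHomomorphism isHom
      open PolynomialMap R S ψ isHom
      open Evaluation S
      module E = Algebra.Properties.Semiring.Exp S.semiring
      open CommutativeRingSolver S
      open SetoidReasoning S.setoid
      open Algebra.Properties.CommutativeSemiring.Exp S.commutativeSemiring using (^-distrib-*)

      open UnitPowers S using (1^k≈1)

    eval-substituted : ∀ {d} (v : Vec Carrier d) →
      ψ b E.^ d S.* eval (map ψ (substituted v)) z S.≈
      z E.^ d S.* eval (map ψ (monic v)) (ψ b S.* (z S.+ z⁻¹))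
    eval-substituted []      = S.*-congˡ (S.trans (S.+-congˡ (S.zeroʳ z)) (S.sym (S.+-congˡ (S.zeroʳ _))))
    eval-substituted {suc d} (x ∷ v) = begin
      β^ (suc d) S.* eval (map ψ (A *ᴾ substituted v +ᴾ m)) z
        ≈⟨ S.*-congˡ (S.trans (eval-congˡ z (map-+ (A *ᴾ substituted v) m)) (S.trans (eval-+ (map ψ
          (A *ᴾ substituted v)) (map ψ m) z)
             (S.+-cong (S.trans (eval-congˡ z (map-* A (substituted v))) (eval-* (map ψ A) (map ψ
               (substituted v)) z))
               (S.trans (eval-congˡ z (map-monomial _ (suc d))) (eval-monomial _ (suc d) z))))) ⟩
      β^ (suc d) S.* (eval (map ψ A) z S.* e₁ S.+ ψ (x * b⁻¹ ^ suc d) S.* z E.^ suc d)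
        ≈⟨ S.*-congˡ (S.+-cong (S.*-congʳ eval-A) (S.*-congʳ (S.trans (*-homo x _) (S.*-congˡ (^-homo b⁻¹
          (suc d)))))) ⟩
      β^ (suc d) S.* ((S.1# S.+ z S.* z) S.* e₁ S.+ (ψ x S.* ψ b⁻¹ E.^ suc d) S.* z E.^ suc d)
        ≈⟨ solve 7 (λ β βᵈ z e x γ zᵈ → (β :* βᵈ) :* ((con (1 , 0) :+ z :* z) :* e :+ (x :* γ) :*
          (z :* zᵈ)) :=
             β :* (con (1 , 0) :+ z :* z) :* (βᵈ :* e) :+ ((β :* βᵈ) :* γ) :* (x :* (z :* zᵈ))) S.refl
             (ψ b) (β^ d) z e₁ (ψ x) (ψ b⁻¹ E.^ suc d) (z E.^ d) ⟩
      ψ b S.* (S.1# S.+ z S.* z) S.* (β^ d S.* e₁) S.+ (β^ (suc d) S.* ψ b⁻¹ E.^ suc d) S.*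
        (ψ x S.* z E.^ suc d)
        ≈⟨ S.+-cong (S.*-cong (S.*-congˡ (S.+-congʳ (S.sym zz⁻¹≈1))) (eval-substituted v))
          (S.*-congʳ cancel) ⟩
      ψ b S.* (z S.* z⁻¹ S.+ z S.* z) S.* (z E.^ d S.* e₂) S.+ S.1# S.* (ψ x S.* z E.^ suc d)
        ≈⟨ solve 6 (λ β z w zᵈ e x → β :* (z :* w :+ z :* z) :* (zᵈ :* e) :+ con (1 , 0) :* (x :*
          (z :* zᵈ)) :=
             (z :* zᵈ) :* (x :+ (β :* (z :+ w)) :* e)) S.refl (ψ b) z z⁻¹ (z E.^ d) e₂ (ψ x) ⟩
      z E.^ suc d S.* (ψ x S.+ (ψ b S.* (z S.+ z⁻¹)) S.* e₂) ∎
      where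
      β^ = ψ b E.^_
      A = 1# ∷ 0# ∷ 1# ∷ []
      m = monomial (x * b⁻¹ ^ suc d) (suc d)
      e₁ = eval (map ψ (substituted v)) z
      e₂ = eval (map ψ (monic v)) (ψ b S.* (z S.+ z⁻¹))
      eval-A : eval (map ψ A) z S.≈ S.1# S.+ z S.* z
      eval-A = S.trans (S.+-cong 1#-homo (S.*-congˡ (S.+-cong 0#-homo (S.*-congˡ (S.+-congʳ 1#-homo)))))
        (solve 1 (λ z → con (1 , 0) :+ z :* (con (0 , 0) :+ z :* (con (1 , 0) :+ z :* con (0 , 0))) := con
          (1 , 0) :+ z :* z) S.refl z)
      cancel : β^ (suc d) S.* ψ b⁻¹ E.^ suc d S.≈ S.1#
      cancel = S.trans (S.sym (^-distrib-* (ψ b) (ψ b⁻¹) (suc d)))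
        (S.trans (E.^-congˡ (suc d) (S.trans (S.sym (*-homo b b⁻¹)) (S.trans (⟦⟧-cong bb⁻¹≈1) 1#-homo)))
          (1^k≈1 (suc d)))

-- The hypotheses on `a` and `b` act on the remaining argument only through these facts: b is a
-- square root of a, conjugation negates it, and q is odd.
record IsRootOfNonsquare (F : FiniteField c ℓ) (E : QuadraticExtension F c′ ℓ′)
    (a : FiniteField.Carrier F) (b : QuadraticExtension.Carrier E) : Set (c ⊔ ℓ ⊔ c′ ⊔ ℓ′) where
  private module F = FiniteField F
  open QuadraticExtension E
  field
    b²≈ιa   : b ^ 2 ≈ ι a
    b≉0     : b ≉ 0#
    b^q≈-b  : b ^ F.size ≈ - b
    h₀      : ℕ
    q≡1+2h₀ : F.size ≡ 1 ℕ.+ 2 ℕ.* h₀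

-- The element x = b(z + 1/z) and its conjugates.

module RootInExtension {c ℓ c′ ℓ′ c″ ℓ″ : Level}
    (F : FiniteField c ℓ) (E : QuadraticExtension F c′ ℓ′)
    (a : FiniteField.Carrier F) (b : QuadraticExtension.Carrier E)
      (isRootOfNonsquare : IsRootOfNonsquare F E a b)
    (n : ℕ) {{n≢0 : NonZero n}} (radn∣q-1 : rad n ∣ (FiniteField.size F ℕ.∸ 1))
    (L : CommutativeRing c″ ℓ″) (L-isDomain : IsDiscreteDomain L)
    (ψ : QuadraticExtension.Carrier E → CommutativeRing.Carrier L)
    (ψ-isHom : IsHom (QuadraticExtension.commutativeRing E) L ψ)
    (z z⁻¹ : CommutativeRing.Carrier L) (zz⁻¹≈1 : AreInverse L z z⁻¹)
    where
  private
    module F = FiniteField F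
    module E = QuadraticExtension E
    module F[X] = PolynomialRing F.commutativeRing
  open IsRootOfNonsquare isRootOfNonsquare
  open CommutativeRing L
  open IsDiscreteDomain L-isDomain
  open DiscreteDomain L L-isDomain
  open Evaluation L
  open CommutativeRingSolver L
  open SetoidReasoning setoid
  open UnitPowers L using (1^k≈1)
  open Algebra.Properties.Ring ring using (x∙y⁻¹≈ε⇒x≈y; -‿involutive)
  open Algebra.Properties.Semiring.Exp semiring
  open Algebra.Properties.CommutativeSemiring.Exp commutativeSemiring using (^-distrib-*)
  private
    module ψ = RingMorphisms.IsRingHomomorphism ψ-isHom

  q Q M : ℕ
  q = F.size
  Q = q ℕ.^ 2
  M = Q ℕ.∸ 1

  ι-isHom : IsHom F.commutativeRing E.commutativeRing E.ι
  ι-isHom = RingMorphisms.IsRingMonomorphism.isRingHomomorphism E.isRingMonomorphism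

  φ : F.Carrier → Carrier
  φ = ψ ∘ E.ι

  φ-isHom : IsHom F.commutativeRing L φ
  φ-isHom = Composition.isRingHomomorphism trans ι-isHom ψ-isHom

  private
    module ψF = FiniteFieldInDomain E.extension L L-isDomain ψ ψ-isHom
    module φF = FiniteFieldInDomain F L L-isDomain φ φ-isHom
    module ψP = PolynomialMap E.commutativeRing L ψ ψ-isHom
    module φP = PolynomialMap F.commutativeRing L φ φ-isHom
    module EF = FiniteFieldProperties E.extension
    module ED = DiscreteDomain E.commutativeRing EF.isDomain
    module EE = Algebra.Properties.Semiring.Exp E.semiring
    module ER = Algebra.Properties.Ring E.ring

  x^-cong : ∀ {x} {j k} → j ≡ k → x ^ j ≈ x ^ k
  x^-cong {x} eq = reflexive (≡.cong (x ^_) eq)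

  β x : Carrier
  β = ψ b
  x = β * (z + z⁻¹)

  z≉0 : z ≉ 0#
  z≉0 z≈0 = 1≉0 (trans (sym zz⁻¹≈1) (trans (*-congʳ z≈0) (zeroˡ _)))

  β≉0 : β ≉ 0#
  β≉0 = ψF.φ-≉0 b≉0

  zᵏz⁻ᵏ≈1 : ∀ k → z ^ k * z⁻¹ ^ k ≈ 1#
  zᵏz⁻ᵏ≈1 k = trans (sym (^-distrib-* z z⁻¹ k)) (trans (^-congˡ k zz⁻¹≈1) (1^k≈1 k))

  eval-dickson-x : ∀ k .{{_ : NonZero k}} → eval (map φ (F[X].dickson k a)) x ≈ β ^ k * (z ^ k + z⁻¹ ^ k)
  eval-dickson-x k = begin
    eval (map φ (F[X].dickson k a)) x
      ≈⟨ eval-congʳ (map φ (F[X].dickson k a)) (distribˡ β z z⁻¹) ⟩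
    eval (map φ (F[X].dickson k a)) (β * z + β * z⁻¹)
      ≈⟨ DicksonPolynomial.eval-dickson F.commutativeRing L φ φ-isHom k a φa≈ ⟩
    (β * z) ^ k + (β * z⁻¹) ^ k
      ≈⟨ +-cong (^-distrib-* β z k) (^-distrib-* β z⁻¹ k) ⟩
    β ^ k * z ^ k + β ^ k * z⁻¹ ^ k
      ≈⟨ distribˡ _ _ _ ⟨
    β ^ k * (z ^ k + z⁻¹ ^ k) ∎
    where
    φa≈ : φ a ≈ (β * z) * (β * z⁻¹)
    φa≈ = begin
      φ a                        ≈⟨ ψ.⟦⟧-cong b²≈ιa ⟨
      ψ (b E.^ 2)                ≈⟨ ψP.^-homo b 2 ⟩
      β ^ 2                      ≈⟨ *-congˡ (*-congˡ zz⁻¹≈1) ⟨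
      β * (β * (z * z⁻¹))        ≈⟨ solve 3 (λ b z w → b :* (b :* (z :* w)) := (b :* z) :*
        (b :* w)) refl β z z⁻¹ ⟩
      (β * z) * (β * z⁻¹)        ∎

  dickson-root⇒z²ⁿ≈-1 : eval (map φ (F[X].dickson n a)) x ≈ 0# → z ^ (2 ℕ.* n) ≈ - 1#
  dickson-root⇒z²ⁿ≈-1 Dₙ-root = begin
    z ^ (n ℕ.+ (n ℕ.+ 0))     ≈⟨ ^-homo-* z n (n ℕ.+ 0) ⟩
    z ^ n * z ^ (n ℕ.+ 0)     ≈⟨ *-congˡ (x^-cong (ℕₚ.+-identityʳ n)) ⟩
    z ^ n * z ^ n             ≈⟨ solve 2 (λ u v → u :* u := u :* (u :+ v) :- u :* v) refl (z ^ n) (z⁻¹ ^ n) ⟩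
    z ^ n * (z ^ n + z⁻¹ ^ n) - z ^ n * z⁻¹ ^ n
                              ≈⟨ +-cong (trans (*-congˡ zⁿ+z⁻ⁿ≈0) (zeroʳ _)) (-‿cong (zᵏz⁻ᵏ≈1 n)) ⟩
    0# - 1#                   ≈⟨ +-identityˡ _ ⟩
    - 1#                      ∎
    where
    zⁿ+z⁻ⁿ≈0 : z ^ n + z⁻¹ ^ n ≈ 0#
    zⁿ+z⁻ⁿ≈0 = [ (λ βⁿ≈0 → contradiction βⁿ≈0 (^-≉0 n β≉0)) , id ]′
      (integral (trans (sym (eval-dickson-x n)) Dₙ-root))

  frobenius-eval : ∀ p u → eval (map φ p) (u ^ q) ≈ eval (map φ p) u ^ q
  frobenius-eval []      u = sym φF.frobenius-0
  frobenius-eval (e ∷ p) u = begin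
    φ e + u ^ q * eval (map φ p) (u ^ q)    ≈⟨ +-cong (sym (φF.image-fixed e)) (*-congˡ
      (frobenius-eval p u)) ⟩
    φ e ^ q + u ^ q * eval (map φ p) u ^ q  ≈⟨ +-congˡ (^-distrib-* u _ q) ⟨
    φ e ^ q + (u * eval (map φ p) u) ^ q    ≈⟨ φF.frobenius-+ (φ e) _ ⟨
    (φ e + u * eval (map φ p) u) ^ q        ∎

  x^[q*qⁱ] : ∀ i u → u ^ (q ℕ.^ suc i) ≈ (u ^ q) ^ (q ℕ.^ i)
  x^[q*qⁱ] i u = sym (^-assocʳ u q (q ℕ.^ i))

  frobeniusⁱ-+ : ∀ i u v → (u + v) ^ (q ℕ.^ i) ≈ u ^ (q ℕ.^ i) + v ^ (q ℕ.^ i)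
  frobeniusⁱ-+ zero    u v = distribʳ 1# u v
  frobeniusⁱ-+ (suc i) u v = begin
    (u + v) ^ (q ℕ.^ suc i)                          ≈⟨ x^[q*qⁱ] i (u + v) ⟩
    ((u + v) ^ q) ^ (q ℕ.^ i)                        ≈⟨ ^-congˡ (q ℕ.^ i) (φF.frobenius-+ u v) ⟩
    (u ^ q + v ^ q) ^ (q ℕ.^ i)                      ≈⟨ frobeniusⁱ-+ i (u ^ q) (v ^ q) ⟩
    (u ^ q) ^ (q ℕ.^ i) + (v ^ q) ^ (q ℕ.^ i)        ≈⟨ +-cong (x^[q*qⁱ] i u) (x^[q*qⁱ] i v) ⟨
    u ^ (q ℕ.^ suc i) + v ^ (q ℕ.^ suc i)            ∎

  frobeniusⁱ-neg : ∀ i u → (- u) ^ (q ℕ.^ i) ≈ - (u ^ (q ℕ.^ i))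
  frobeniusⁱ-neg zero    u = trans (*-identityʳ _) (-‿cong (sym (*-identityʳ u)))
  frobeniusⁱ-neg (suc i) u = begin
    (- u) ^ (q ℕ.^ suc i)        ≈⟨ x^[q*qⁱ] i (- u) ⟩
    ((- u) ^ q) ^ (q ℕ.^ i)      ≈⟨ ^-congˡ (q ℕ.^ i) (φF.frobenius-neg u) ⟩
    (- (u ^ q)) ^ (q ℕ.^ i)      ≈⟨ frobeniusⁱ-neg i (u ^ q) ⟩
    - ((u ^ q) ^ (q ℕ.^ i))      ≈⟨ -‿cong (x^[q*qⁱ] i u) ⟨
    - (u ^ (q ℕ.^ suc i))        ∎

  frobeniusⁱ-injective : ∀ i {u v} → u ^ (q ℕ.^ i) ≈ v ^ (q ℕ.^ i) → u ≈ v
  frobeniusⁱ-injective zero    eq = trans (sym (*-identityʳ _)) (trans eq (*-identityʳ _))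
  frobeniusⁱ-injective (suc i) eq = φF.frobenius-injective
    (frobeniusⁱ-injective i (trans (sym (x^[q*qⁱ] i _)) (trans eq (x^[q*qⁱ] i _))))

  conjugate-root : ∀ p i → eval (map φ p) x ≈ 0# → eval (map φ p) (x ^ (q ℕ.^ i)) ≈ 0#
  conjugate-root p zero    root = trans (eval-congʳ (map φ p) (*-identityʳ x)) root
  conjugate-root p (suc i) root = begin
    eval (map φ p) (x ^ (q ℕ.^ suc i))      ≈⟨ eval-congʳ (map φ p) (trans (x^-cong (ℕₚ.*-comm q (q ℕ.^ i)))
      (sym (^-assocʳ x (q ℕ.^ i) q))) ⟩
    eval (map φ p) ((x ^ (q ℕ.^ i)) ^ q)    ≈⟨ frobenius-eval p _ ⟩
    eval (map φ p) (x ^ (q ℕ.^ i)) ^ q      ≈⟨ ^-congˡ q (conjugate-root p i root) ⟩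
    0# ^ q                                  ≈⟨ φF.frobenius-0 ⟩
    0#                                      ∎

  -- Among x, x^q, …, x^(q^d) two must coincide, as p has at most d roots.
  period : ∀ {d} p → Degrees.MonicAt F.commutativeRing d p → eval (map φ p) x ≈ 0# →
           Σ[ s ∈ ℕ ] 0 ℕ.< s × s ℕ.≤ d × x ^ (q ℕ.^ s) ≈ x
  period {d} p p-MonicAt root = decide
    (Finₚ.any? λ i → Finₚ.any? λ j → (i Finₚ.<? j) ×-dec (conjugate i ≟ conjugate j))
    where
    conjugate : Fin (suc d) → Carrier
    conjugate i = x ^ (q ℕ.^ toℕ i)
    Collision : Set _
    Collision = ∃[ i ] ∃[ j ] i Fin.< j × conjugate i ≈ conjugate j
    injective : ¬ Collision → ∀ {i j} → conjugate i ≈ conjugate j → i ≡ j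
    injective ¬collision {i} {j} eq with Finₚ.<-cmp i j
    ... | tri< i<j _ _ = contradiction (i , j , i<j , eq) ¬collision
    ... | tri≈ _ i≡j _ = i≡j
    ... | tri> _ _ j<i = contradiction (j , i , j<i , sym eq) ¬collision
    decide : Dec Collision → Σ[ s ∈ ℕ ] 0 ℕ.< s × s ℕ.≤ d × x ^ (q ℕ.^ s) ≈ x
    decide (no ¬collision) = contradiction (λ i → conjugate-root p (toℕ i) root)
      (monic-has-few-roots {p = map φ p} (φP.map-MonicAt {p = p} p-MonicAt) conjugate (injective ¬collision))
    decide (yes (i , j , i<j , eq)) =
      s , ℕₚ.m<n⇒0<n∸m i<j , ℕₚ.≤-trans (ℕₚ.m∸n≤m (toℕ j) (toℕ i)) (Finₚ.toℕ≤pred[n] j) ,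
      frobeniusⁱ-injective (toℕ i) (begin
        (x ^ (q ℕ.^ s)) ^ (q ℕ.^ toℕ i)    ≈⟨ ^-assocʳ x (q ℕ.^ s) (q ℕ.^ toℕ i) ⟩
        x ^ (q ℕ.^ s ℕ.* q ℕ.^ toℕ i)      ≈⟨ x^-cong (≡.trans (≡.sym (ℕₚ.^-distribˡ-+-* q s (toℕ i)))
                                                (≡.cong (q ℕ.^_) (ℕₚ.m∸n+n≡m (ℕₚ.<⇒≤ i<j)))) ⟩
        conjugate j                        ≈⟨ eq ⟨
        conjugate i                        ∎)
      where s = toℕ j ℕ.∸ toℕ i

  -- The exponent t, the order of α and the period of x.

  module Orders (z²ⁿ≈-1 : z ^ (2 ℕ.* n) ≈ - 1#) where

    z⁴ⁿ≈1 : z ^ (4 ℕ.* n) ≈ 1#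
    z⁴ⁿ≈1 = begin
      z ^ (4 ℕ.* n)            ≈⟨ x^-cong (NumberTheory.4n≡2n*2 n) ⟩
      z ^ (2 ℕ.* n ℕ.* 2)      ≈⟨ ^-assocʳ z (2 ℕ.* n) 2 ⟨
      (z ^ (2 ℕ.* n)) ^ 2      ≈⟨ ^-congˡ 2 z²ⁿ≈-1 ⟩
      (- 1#) ^ 2               ≈⟨ solve 0 (:- con (1 , 0) :* (:- con (1 , 0) :* con (1 , 0)) := con
        (1 , 0)) refl ⟩
      1#                       ∎

    InE : Carrier → Set _
    InE u = ∃[ e ] ψ e ≈ u

    abstract
      -- The index `k` stands for the exponent `suc k`, which keeps the exponent positive. The
      -- search is bounded by 4n because z^{4n} = 1 lies in the image.
      leastData : Σ[ k ∈ ℕ ] InE (z ^ suc k) × k ℕ.≤ ℕ.pred (4 ℕ.* n) × (∀ j → j ℕ.< k → ¬ InE (z ^ suc j))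
      leastData = least (λ k → ψF.inImage? (z ^ suc k)) (ℕ.pred (4 ℕ.* n))
        (E.1# , trans ψ.1#-homo (sym (trans (x^-cong (ℕₚ.suc-pred (4 ℕ.* n) {{ℕₚ.m*n≢0 4 n}})) z⁴ⁿ≈1)))

    t-1 t : ℕ
    t-1 = proj₁ leastData
    t = suc t-1

    α : E.Carrier
    α = proj₁ (proj₁ (proj₂ leastData))

    ψα≈zᵗ : ψ α ≈ z ^ t
    ψα≈zᵗ = proj₂ (proj₁ (proj₂ leastData))

    α≉0 : α E.≉ E.0#
    α≉0 α≈0 = ^-≉0 t z≉0 (trans (sym ψα≈zᵗ) (trans (ψ.⟦⟧-cong α≈0) ψ.0#-homo))

    α⁻¹ : E.Carrier
    α⁻¹ = E.inv α α≉0

    ψα⁻¹≈z⁻ᵗ : ψ α⁻¹ ≈ z⁻¹ ^ t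
    ψα⁻¹≈z⁻ᵗ = *-cancelˡ (^-≉0 t z≉0) (begin
      z ^ t * ψ α⁻¹      ≈⟨ *-congʳ ψα≈zᵗ ⟨
      ψ α * ψ α⁻¹        ≈⟨ ψ.*-homo α α⁻¹ ⟨
      ψ (α E.* α⁻¹)      ≈⟨ ψ.⟦⟧-cong (EF.x*x⁻¹≈1 α≉0) ⟩
      ψ E.1#             ≈⟨ ψ.1#-homo ⟩
      1#                 ≈⟨ zᵏz⁻ᵏ≈1 t ⟨
      z ^ t * z⁻¹ ^ t    ∎)

    z^[k*t]≈ψαᵏ : ∀ k → z ^ (k ℕ.* t) ≈ ψ (α E.^ k)
    z^[k*t]≈ψαᵏ k = begin
      z ^ (k ℕ.* t)    ≈⟨ x^-cong (ℕₚ.*-comm k t) ⟩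
      z ^ (t ℕ.* k)    ≈⟨ ^-assocʳ z t k ⟨
      (z ^ t) ^ k      ≈⟨ ^-congˡ k ψα≈zᵗ ⟨
      ψ α ^ k          ≈⟨ ψP.^-homo α k ⟨
      ψ (α E.^ k)      ∎

    InE⇒t∣ : ∀ {m} → InE (z ^ m) → t ∣ m
    InE⇒t∣ = least-exponent∣ t-1 reduce (proj₂ (proj₂ (proj₂ leastData)))
      where
      reduce : ∀ r k → InE (z ^ (r ℕ.+ k ℕ.* t)) → InE (z ^ r)
      reduce r k (e , ψe≈) = e E.* α⁻¹ E.^ k , *-cancelˡ (^-≉0 (k ℕ.* t) z≉0) (begin
        z ^ (k ℕ.* t) * ψ (e E.* α⁻¹ E.^ k)
          ≈⟨ *-cong (z^[k*t]≈ψαᵏ k) (trans (ψ.*-homo e _) (*-congʳ (trans ψe≈ (^-homo-* z r (k ℕ.* t))))) ⟩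
        ψ (α E.^ k) * ((z ^ r * z ^ (k ℕ.* t)) * ψ (α⁻¹ E.^ k))
          ≈⟨ solve 4 (λ a r s b → a :* ((r :* s) :* b) := (a :* b) :* (s :* r)) refl _ _ _ _ ⟩
        (ψ (α E.^ k) * ψ (α⁻¹ E.^ k)) * (z ^ (k ℕ.* t) * z ^ r)
          ≈⟨ *-congʳ (trans (*-cong (ψP.^-homo α k) (ψP.^-homo α⁻¹ k)) (trans (sym (^-distrib-* (ψ α)
            (ψ α⁻¹) k))
               (trans (^-congˡ k (trans (sym (ψ.*-homo α α⁻¹)) (trans (ψ.⟦⟧-cong
                 (EF.x*x⁻¹≈1 α≉0)) ψ.1#-homo))) (1^k≈1 k)))) ⟩
        1# * (z ^ (k ℕ.* t) * z ^ r)
          ≈⟨ *-identityˡ _ ⟩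
        z ^ (k ℕ.* t) * z ^ r ∎)

    Q≡1+M : Q ≡ 1 ℕ.+ M
    Q≡1+M = ≡.sym (ℕₚ.m+[n∸m]≡n (≡.subst (1 ℕ.≤_) E.size≡ (ℕₚ.<⇒≤ EF.1<size)))

    InE⇐^M : ∀ m → z ^ (m ℕ.* M) ≈ 1# → InE (z ^ m)
    InE⇐^M m eq = ψF.fixed-inImage (begin
      (z ^ m) ^ E.size            ≈⟨ x^-cong (≡.trans E.size≡ Q≡1+M) ⟩
      z ^ m * (z ^ m) ^ M         ≈⟨ *-congˡ (trans (^-assocʳ z m M) eq) ⟩
      z ^ m * 1#                  ≈⟨ *-identityʳ _ ⟩
      z ^ m                       ∎)

    t∣2n : t ∣ 2 ℕ.* n
    t∣2n = InE⇒t∣ (E.- E.1# , trans (ψ.-‿homo E.1#) (trans (-‿cong ψ.1#-homo) (sym z²ⁿ≈-1)))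

    4∣M : 4 ∣ M
    4∣M = ≡.subst (λ k → 4 ∣ k ℕ.^ 2 ℕ.∸ 1) (≡.sym q≡1+2h₀) (NumberTheory.4∣odd²∸1 h₀)

    q-1∣M : q ℕ.∸ 1 ∣ M
    q-1∣M = ≡.subst (λ k → k ℕ.∸ 1 ∣ k ℕ.^ 2 ℕ.∸ 1) (≡.sym q≡1+2h₀) (NumberTheory.m∣[1+m]²∸1 (2 ℕ.* h₀))

    open NumberTheory

    -- This is where the condition on rad(n) is used: since t ∣ 2n, a prime divisor of t is 2, which
    -- divides q² - 1 for odd q, or divides n and hence q - 1.
    prime∣t⇒∣M : ∀ p → Prime p → p ∣ t → p ∣ M
    prime∣t⇒∣M p pp p∣t =
      [ (λ p∣2 → Div.∣-trans p∣2 (Div.∣-trans (divides 2 ≡.refl) 4∣M))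
      , (λ p∣n → Div.∣-trans (prime∣rad n pp p∣n) (Div.∣-trans radn∣q-1 q-1∣M))
      ]′ (Prime.euclidsLemma 2 n pp (Div.∣-trans p∣t t∣2n))

    private
      M≢0 : NonZero M
      M≢0 = ℕ.>-nonZero (ℕₚ.m<n⇒0<n∸m (≡.subst (1 ℕ.<_) E.size≡ EF.1<size))

      αᴹ≈1 : α E.^ M E.≈ E.1#
      αᴹ≈1 = ≡.subst (λ k → α E.^ (k ℕ.∸ 1) E.≈ E.1#) E.size≡ (EF.x^[size∸1]≈1 α≉0)

    abstract
      orderData : Σ[ k ∈ ℕ ] α E.^ suc k E.≈ E.1# × k ℕ.≤ ℕ.pred M × (∀ j → j ℕ.< k → ¬
        (α E.^ suc j E.≈ E.1#))
      orderData = least (λ k → (α E.^ suc k) EF.≟ E.1#) (ℕ.pred M)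
        (≡.subst (λ k → α E.^ k E.≈ E.1#) (≡.sym (ℕₚ.suc-pred M {{M≢0}})) αᴹ≈1)

    ord-1 ord : ℕ
    ord-1 = proj₁ orderData
    ord = suc ord-1

    αᵒʳᵈ≈1 : α E.^ ord E.≈ E.1#
    αᵒʳᵈ≈1 = proj₁ (proj₂ orderData)

    isOrder : E.IsOrder α ord
    isOrder = record
      { nonZero = _
      ; x^m≈1   = αᵒʳᵈ≈1
      ; minimal = λ { (suc k) αᵏ≈1 → s≤s (ℕₚ.≮⇒≥ (λ k<ord → proj₂ (proj₂ (proj₂ orderData)) k k<ord αᵏ≈1))
                    ; zero {{()}} _ }
      }

    ord∣ : ∀ {m} → α E.^ m E.≈ E.1# → ord ∣ m
    ord∣ = least-exponent∣ ord-1 reduce (proj₂ (proj₂ (proj₂ orderData)))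
      where
      reduce : ∀ r k → α E.^ (r ℕ.+ k ℕ.* ord) E.≈ E.1# → α E.^ r E.≈ E.1#
      reduce r k eq = E.trans (E.sym (E.trans (EE.^-homo-* α r (k ℕ.* ord))
        (E.trans (E.*-congˡ (E.trans (E.reflexive (≡.cong (α E.^_) (ℕₚ.*-comm k ord)))
            (E.trans (E.sym (EE.^-assocʳ α ord k)) (E.trans (EE.^-congˡ k αᵒʳᵈ≈1)
              (UnitPowers.1^k≈1 E.commutativeRing k)))))
          (E.*-identityʳ _)))) eq

    abstract
      cofactor : Σ[ K ∈ ℕ ] M ≡ ord ℕ.* K
      cofactor = Div.quotient ord∣M , ≡.trans (Div._∣_.equality ord∣M) (ℕₚ.*-comm (Div.quotient ord∣M) ord)
        where
        ord∣M : ord ∣ M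
        ord∣M = ord∣ αᴹ≈1

    K : ℕ
    K = proj₁ cofactor

    M≡ord*K : M ≡ ord ℕ.* K
    M≡ord*K = proj₂ cofactor

    prime∣t⇒∤K : ∀ p → Prime p → p ∣ t → ¬ p ∣ K
    prime∣t⇒∤K p pp p∣t@(divides s t≡s*p) (divides K′ K≡K′*p) = prime∤1 pp
      -- With z^s in 𝔽_{q²}, t = s p would divide s, and p would divide 1.
      (Div.*-cancelˡ-∣ s {{s≢0}} (≡.subst₂ _∣_ t≡s*p (≡.sym (ℕₚ.*-identityʳ s)) (InE⇒t∣ (InE⇐^M s zˢᴹ≈1))))
      where
      s≢0 : NonZero s
      s≢0 = ℕ.≢-nonZero λ { ≡.refl → case t≡s*p of λ () }
      zˢᴹ≈1 : z ^ (s ℕ.* M) ≈ 1#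
      zˢᴹ≈1 = begin
        z ^ (s ℕ.* M)
          ≈⟨ x^-cong (≡.trans (≡.cong (s ℕ.*_) (≡.trans M≡ord*K (≡.cong (ord ℕ.*_) K≡K′*p)))
               (≡.trans (s*[o*[k*p]]≡[k*o]*[s*p] s ord K′ p) (≡.cong ((K′ ℕ.* ord) ℕ.*_) (≡.sym t≡s*p)))) ⟩
        z ^ ((K′ ℕ.* ord) ℕ.* t)      ≈⟨ z^[k*t]≈ψαᵏ (K′ ℕ.* ord) ⟩
        ψ (α E.^ (K′ ℕ.* ord))        ≈⟨ ψP.^-homo α (K′ ℕ.* ord) ⟩
        ψ α ^ (K′ ℕ.* ord)            ≈⟨ x^-cong (ℕₚ.*-comm K′ ord) ⟩
        ψ α ^ (ord ℕ.* K′)            ≈⟨ ^-assocʳ (ψ α) ord K′ ⟨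
        (ψ α ^ ord) ^ K′              ≈⟨ ^-congˡ K′ (trans (sym (ψP.^-homo α ord)) (trans
          (ψ.⟦⟧-cong αᵒʳᵈ≈1) ψ.1#-homo)) ⟩
        1# ^ K′                       ≈⟨ 1^k≈1 K′ ⟩
        1#                            ∎

    prime∣t⇒∣ord : ∀ p → Prime p → p ∣ t → p ∣ ord
    prime∣t⇒∣ord p pp p∣t = [ id , (λ p∣K → contradiction p∣K (prime∣t⇒∤K p pp p∣t)) ]′
      (Prime.euclidsLemma ord K pp (≡.subst (p ∣_) M≡ord*K (prime∣t⇒∣M p pp p∣t)))

    condition-i : α E.^ (2 ℕ.* n / t) E.≈ E.- E.1#
    condition-i = ψF.φ-injective (begin
      ψ (α E.^ (2 ℕ.* n / t))        ≈⟨ z^[k*t]≈ψαᵏ (2 ℕ.* n / t) ⟨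
      z ^ (2 ℕ.* n / t ℕ.* t)        ≈⟨ x^-cong (DivMod.m/n*n≡m t∣2n) ⟩
      z ^ (2 ℕ.* n)                  ≈⟨ z²ⁿ≈-1 ⟩
      - 1#                           ≈⟨ trans (ψ.-‿homo E.1#) (-‿cong ψ.1#-homo) ⟨
      ψ (E.- E.1#)                   ∎)

    condition-ii : rad t ∣ ord
    condition-ii = rad∣ t prime∣t⇒∣ord

    gcd[t,K]≡1 : gcd t K ≡ 1
    gcd[t,K]≡1 = gcd≡1 t K prime∣t⇒∤K

    condition-iii : gcd t (M / ord) ≡ 1
    condition-iii = ≡.trans (≡.cong (gcd t) (≡.trans (≡.cong (_/ ord) (≡.trans M≡ord*K (ℕₚ.*-comm ord K)))
      (DivMod.m*n/n≡m K ord))) gcd[t,K]≡1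

    -- z^{4n} = 1 says that α^{4n/t} = 1, so ord · t divides 4n. Since q² - 1 = ord · K with K prime
    -- to t, `∣/gcd` applies.
    t∣4n/gcd : .{{_ : NonZero (gcd (4 ℕ.* n) M)}} → t ∣ 4 ℕ.* n / gcd (4 ℕ.* n) M
    t∣4n/gcd = ∣/gcd {t} {ord} {K} M≡ord*K gcd[t,K]≡1 (ord*t∣ t∣4n z⁴ⁿ≈1)
      where
      t∣4n : t ∣ 4 ℕ.* n
      t∣4n = ≡.subst (t ∣_) (≡.sym (4n≡2n*2 n)) (Div.∣m⇒∣m*n 2 t∣2n)
      ord*t∣ : ∀ {m} → t ∣ m → z ^ m ≈ 1# → ord ℕ.* t ∣ m
      ord*t∣ (divides w ≡.refl) zʷᵗ≈1 = Div.*-monoˡ-∣ t (ord∣ {w}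
        (ψF.φ-injective (trans (sym (z^[k*t]≈ψαᵏ w)) (trans zʷᵗ≈1 (sym ψ.1#-homo)))))

    -- Cancelling z leaves z^{g(q² - 1)} = 1 with `g` the geometric sum in q² with h terms, which
    -- puts z^g into 𝔽_{q²}. Lifting the exponent then passes from t ∣ g to t ∣ h.
    zᴺ≈z⇒t∣ : ∀ h → z ^ (Q ℕ.^ h) ≈ z → t ∣ h
    zᴺ≈z⇒t∣ h eq = ∣geometric⇒∣exponent t M h prime∣t⇒∣M (λ _ → 4∣M)
      (InE⇒t∣ (InE⇐^M g (*-cancelˡ z≉0 (begin
        z * z ^ (g ℕ.* M)         ≈⟨ x^-cong (≡.cong suc (ℕₚ.*-comm g M)) ⟩
        z ^ (1 ℕ.+ M ℕ.* g)       ≈⟨ x^-cong (^≡1+*geometric M h) ⟨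
        z ^ ((1 ℕ.+ M) ℕ.^ h)     ≈⟨ x^-cong (≡.cong (ℕ._^ h) Q≡1+M) ⟨
        z ^ (Q ℕ.^ h)             ≈⟨ eq ⟩
        z                         ≈⟨ *-identityʳ z ⟨
        z * 1#                    ∎))))
      where g = geometric (1 ℕ.+ M) h

    -- A prime divisor p of t divides ord, which divides 2; so p = ord = 2. Then K = (q² - 1)/2 is
    -- even because 4 ∣ q² - 1, although p must not divide K.
    α²≈1⇒t≡1 : α E.* α E.≈ E.1# → t ≡ 1
    α²≈1⇒t≡1 α²≈1 = decide (t ℕₚ.≟ 1)
      where
      ord∣2 : ord ∣ 2
      ord∣2 = ord∣ {2} (E.trans (E.*-congˡ (E.*-identityʳ α)) α²≈1)
      absurd : (Σ[ p ∈ ℕ ] Prime p × p ∣ t) → ⊥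
      absurd (p , pp , p∣t) = prime∣t⇒∤K p pp p∣t (≡.subst (_∣ K) (≡.sym p≡2) 2∣K)
        where
        p≡2 : p ≡ 2
        p≡2 = prime∣prime⇒≡ pp Prime.prime[2] (Div.∣-trans (prime∣t⇒∣ord p pp p∣t) ord∣2)
        ord≡2 : ord ≡ 2
        ord≡2 = Div.∣-antisym ord∣2 (≡.subst (_∣ ord) p≡2 (prime∣t⇒∣ord p pp p∣t))
        2∣K : 2 ∣ K
        2∣K = Div.*-cancelˡ-∣ 2 (≡.subst (4 ∣_) (≡.trans M≡ord*K (≡.cong (ℕ._* K) ord≡2)) 4∣M)
      decide : Dec (t ≡ 1) → t ≡ 1
      decide (yes t≡1) = t≡1
      decide (no t≢1)  = ⊥-elim (absurd (∃prime∣ t t≢1))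

    image^Qʰ : ∀ h e → ψ e ^ (Q ℕ.^ h) ≈ ψ e
    image^Qʰ zero    e = *-identityʳ (ψ e)
    image^Qʰ (suc h) e = begin
      ψ e ^ (Q ℕ.* Q ℕ.^ h)      ≈⟨ ^-assocʳ (ψ e) Q (Q ℕ.^ h) ⟨
      (ψ e ^ Q) ^ (Q ℕ.^ h)      ≈⟨ ^-congˡ (Q ℕ.^ h) (trans (x^-cong (≡.sym E.size≡)) (ψF.image-fixed e)) ⟩
      ψ e ^ (Q ℕ.^ h)            ≈⟨ image^Qʰ h e ⟩
      ψ e                        ∎

    image^qᵒᵈᵈ : ∀ h e → ψ e ^ (q ℕ.^ (1 ℕ.+ 2 ℕ.* h)) ≈ ψ (e E.^ q)
    image^qᵒᵈᵈ h e = begin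
      ψ e ^ (q ℕ.* q ℕ.^ (2 ℕ.* h))      ≈⟨ ^-assocʳ (ψ e) q (q ℕ.^ (2 ℕ.* h)) ⟨
      (ψ e ^ q) ^ (q ℕ.^ (2 ℕ.* h))      ≈⟨ x^-cong (ℕₚ.^-*-assoc q 2 h) ⟨
      (ψ e ^ q) ^ (Q ℕ.^ h)              ≈⟨ ^-congˡ (Q ℕ.^ h) (ψP.^-homo e q) ⟨
      ψ (e E.^ q) ^ (Q ℕ.^ h)            ≈⟨ image^Qʰ h (e E.^ q) ⟩
      ψ (e E.^ q)                        ∎

    -- Equal sum and product 1 make w a root of (Y - z)(Y - 1/z).
    equal-sums : ∀ {w w′} → w * w′ ≈ 1# → w + w′ ≈ z + z⁻¹ → w ≈ z ⊎ w ≈ z⁻¹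
    equal-sums {w} {w′} ww′≈1 sums = [ inj₁ ∘ x∙y⁻¹≈ε⇒x≈y w z , inj₂ ∘ x∙y⁻¹≈ε⇒x≈y w z⁻¹ ]′ (integral (begin
      (w - z) * (w - z⁻¹)                  ≈⟨ solve 3 (λ w z v → (w :- z) :* (w :- v) := w :* w :- w :*
        (z :+ v) :+ z :* v) refl w z z⁻¹ ⟩
      w * w - w * (z + z⁻¹) + z * z⁻¹      ≈⟨ +-cong (+-congˡ (-‿cong (*-congˡ (sym sums)))) (trans zz⁻¹≈1
        (sym ww′≈1)) ⟩
      w * w - w * (w + w′) + w * w′        ≈⟨ solve 2 (λ w v → w :* w :- w :* (w :+ v) :+ w :* v := con
        (0 , 0)) refl w w′ ⟩
      0#                                   ∎))

    OddCase : Set _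
    OddCase = ¬ (2 ∣ t) × (α E.^ (q ℕ.∸ 1) E.≈ E.- E.1# ⊎ α E.^ (q ℕ.+ 1) E.≈ E.- E.1#)

    module _ (s : ℕ) (0<s : 0 ℕ.< s) (xᴺ≈x : x ^ (q ℕ.^ s) ≈ x) where
      private
        N = q ℕ.^ s
        w = z ^ N
        w′ = z⁻¹ ^ N

      ww′≈1 : w * w′ ≈ 1#
      ww′≈1 = zᵏz⁻ᵏ≈1 N

      [zᵗ]ᴺ≈wᵗ : ψ α ^ N ≈ w ^ t
      [zᵗ]ᴺ≈wᵗ = begin
        ψ α ^ N        ≈⟨ ^-congˡ N ψα≈zᵗ ⟩
        (z ^ t) ^ N    ≈⟨ ^-assocʳ z t N ⟩
        z ^ (t ℕ.* N)  ≈⟨ x^-cong (ℕₚ.*-comm t N) ⟩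
        z ^ (N ℕ.* t)  ≈⟨ ^-assocʳ z N t ⟨
        w ^ t          ∎

      βᴺ[w+w′]≈x : β ^ N * (w + w′) ≈ β * (z + z⁻¹)
      βᴺ[w+w′]≈x = trans (*-congˡ (sym (frobeniusⁱ-+ s z z⁻¹))) (trans (sym (^-distrib-* β (z + z⁻¹) N)) xᴺ≈x)

      even-period : ∀ h → s ≡ h ℕ.* 2 → 2 ℕ.* t ℕ.≤ s
      even-period h s≡h*2 = ≡.subst₂ ℕ._≤_ (ℕₚ.*-comm t 2) (≡.sym s≡h*2) (ℕₚ.*-monoˡ-≤ 2 t≤h)
        where
        h≢0 : NonZero h
        h≢0 = ℕ.≢-nonZero λ { ≡.refl → ℕₚ.<⇒≢ 0<s (≡.sym s≡h*2) }
        N≡Qʰ : N ≡ Q ℕ.^ h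
        N≡Qʰ = ≡.trans (≡.cong (q ℕ.^_) (≡.trans s≡h*2 (ℕₚ.*-comm h 2))) (≡.sym (ℕₚ.^-*-assoc q 2 h))
        image : ∀ e → ψ e ^ N ≈ ψ e
        image e = trans (x^-cong N≡Qʰ) (image^Qʰ h e)
        α²≈1 : w ≈ z⁻¹ → α E.* α E.≈ E.1#
        α²≈1 w≈z⁻¹ = ψF.φ-injective (begin
          ψ (α E.* α)        ≈⟨ ψ.*-homo α α ⟩
          ψ α * ψ α          ≈⟨ *-cong ψα≈zᵗ (trans (sym (image α)) (trans [zᵗ]ᴺ≈wᵗ (^-congˡ t w≈z⁻¹))) ⟩
          z ^ t * z⁻¹ ^ t    ≈⟨ zᵏz⁻ᵏ≈1 t ⟩
          1#                 ≈⟨ ψ.1#-homo ⟨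
          ψ E.1#             ∎)
        t≤h : t ℕ.≤ h
        t≤h = [ (λ w≈z → Div.∣⇒≤ {{h≢0}} (zᴺ≈z⇒t∣ h (trans (x^-cong (≡.sym N≡Qʰ)) w≈z)))
              , (λ w≈z⁻¹ → ≡.subst (ℕ._≤ h) (≡.sym (α²≈1⇒t≡1 (α²≈1 w≈z⁻¹))) (ℕ.>-nonZero⁻¹ h {{h≢0}}))
              ]′ (equal-sums ww′≈1 (*-cancelˡ β≉0 (trans (*-congʳ (sym (image b))) βᴺ[w+w′]≈x)))

      odd-period : ∀ h → s ≡ 1 ℕ.+ 2 ℕ.* h → t ℕ.≤ s × OddCase
      odd-period h s≡1+2h = Div.∣⇒≤ {{ℕ.>-nonZero 0<s}} t∣s , t-odd ,
        [ (λ -w≈z → inj₁ (αᵠ⁻¹≈-1 (neg-swap -w≈z))) , (λ -w≈z⁻¹ → inj₂ (αᵠ⁺¹≈-1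
          (neg-swap -w≈z⁻¹))) ]′ -w-cases
        where
        image : ∀ e → ψ e ^ N ≈ ψ (e E.^ q)
        image e = trans (x^-cong (≡.cong (q ℕ.^_) s≡1+2h)) (image^qᵒᵈᵈ h e)
        neg-swap : ∀ {u v} → - u ≈ v → u ≈ - v
        neg-swap {u} -u≈v = trans (sym (-‿involutive u)) (-‿cong -u≈v)
        -- An odd number of conjugations negates b; the sign is passed on to w and w′.
        βᴺ≈-β : β ^ N ≈ - β
        βᴺ≈-β = trans (image b) (trans (ψ.⟦⟧-cong b^q≈-b) (ψ.-‿homo b))
        -w*-w′≈1 : - w * - w′ ≈ 1#
        -w*-w′≈1 = trans (solve 2 (λ w v → (:- w) :* (:- v) := w :* v) refl w w′) ww′≈1
        -w-cases : - w ≈ z ⊎ - w ≈ z⁻¹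
        -w-cases = equal-sums -w*-w′≈1 (*-cancelˡ β≉0 (begin
          β * (- w + - w′)     ≈⟨ solve 3 (λ b w v → b :* (:- w :+ :- v) := (:- b) :* (w :+ v)) refl β w w′ ⟩
          - β * (w + w′)       ≈⟨ *-congʳ βᴺ≈-β ⟨
          β ^ N * (w + w′)     ≈⟨ βᴺ[w+w′]≈x ⟩
          β * (z + z⁻¹)        ∎))
        -- Repeating u ↦ u^N cancels both the sign and a possible inversion. Since N² = (q²)^s, the
        -- criterion for even periods becomes available and gives t ∣ s.
        wᴺ≈z : w ^ N ≈ z
        wᴺ≈z = [ (λ -w≈z → trans (^-congˡ N (neg-swap -w≈z)) (trans (frobeniusⁱ-neg s z) -w≈z))
               , (λ -w≈z⁻¹ → trans (^-congˡ N (neg-swap -w≈z⁻¹)) (trans (frobeniusⁱ-neg s z⁻¹) (begin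
                   - w′                    ≈⟨ *-identityˡ _ ⟨
                   1# * - w′               ≈⟨ *-congʳ zz⁻¹≈1 ⟨
                   (z * z⁻¹) * - w′        ≈⟨ *-assoc z z⁻¹ _ ⟩
                   z * (z⁻¹ * - w′)        ≈⟨ *-congˡ (trans (*-congʳ (sym -w≈z⁻¹)) -w*-w′≈1) ⟩
                   z * 1#                  ≈⟨ *-identityʳ z ⟩
                   z                       ∎)))
               ]′ -w-cases
        t∣s : t ∣ s
        t∣s = zᴺ≈z⇒t∣ s (begin
          z ^ (Q ℕ.^ s)        ≈⟨ x^-cong (ℕₚ.^-*-assoc q 2 s) ⟩
          z ^ (q ℕ.^ (2 ℕ.* s))  ≈⟨ x^-cong (≡.trans (≡.cong (λ k → q ℕ.^ (s ℕ.+ k)) (ℕₚ.+-identityʳ s))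
            (ℕₚ.^-distribˡ-+-* q s s)) ⟩
          z ^ (N ℕ.* N)        ≈⟨ ^-assocʳ z N N ⟨
          w ^ N                ≈⟨ wᴺ≈z ⟩
          z                    ∎)
        t-odd : ¬ (2 ∣ t)
        t-odd 2∣t = prime∤1 Prime.prime[2] (Div.∣m+n∣m⇒∣n
          (≡.subst (2 ∣_) (≡.trans s≡1+2h (ℕₚ.+-comm 1 (2 ℕ.* h))) (Div.∣-trans 2∣t t∣s)) (Div.m∣m*n h))
        [-u]ᵗ≈-uᵗ : ∀ u → (- u) ^ t ≈ - (u ^ t)
        [-u]ᵗ≈-uᵗ u = [ (λ (k , t≡k*2) → contradiction (divides k t≡k*2) t-odd) , (λ (k , t≡1+2k) → begin
          (- u) ^ t                    ≈⟨ x^-cong t≡1+2k ⟩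
          - u * (- u) ^ (2 ℕ.* k)      ≈⟨ *-congˡ (^-assocʳ (- u) 2 k) ⟨
          - u * ((- u) ^ 2) ^ k        ≈⟨ *-congˡ (^-congˡ k (solve 1 (λ u → (:- u) :* ((:- u) :* con
            (1 , 0)) := u :* (u :* con (1 , 0))) refl u)) ⟩
          - u * (u ^ 2) ^ k            ≈⟨ *-congˡ (^-assocʳ u 2 k) ⟩
          - u * u ^ (2 ℕ.* k)          ≈⟨ solve 2 (λ u v → (:- u) :* v := :- (u :* v)) refl u _ ⟩
          - (u ^ (1 ℕ.+ 2 ℕ.* k))      ≈⟨ -‿cong (x^-cong t≡1+2k) ⟨
          - (u ^ t)                    ∎) ]′ (parity t)
        αᵠ≈ : ∀ {u e} → w ≈ - u → ψ e ≈ u ^ t → α E.^ q E.≈ E.- e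
        αᵠ≈ {u} {e} w≈-u ψe≈uᵗ = ψF.φ-injective (begin
          ψ (α E.^ q)      ≈⟨ image α ⟨
          ψ α ^ N          ≈⟨ [zᵗ]ᴺ≈wᵗ ⟩
          w ^ t            ≈⟨ ^-congˡ t w≈-u ⟩
          (- u) ^ t        ≈⟨ [-u]ᵗ≈-uᵗ u ⟩
          - (u ^ t)        ≈⟨ -‿cong ψe≈uᵗ ⟨
          - ψ e            ≈⟨ ψ.-‿homo e ⟨
          ψ (E.- e)        ∎)
        αᵠ⁻¹≈-1 : w ≈ - z → α E.^ (q ℕ.∸ 1) E.≈ E.- E.1#
        αᵠ⁻¹≈-1 w≈-z = ED.*-cancelˡ α≉0 (E.trans (E.reflexive (≡.cong (α E.^_) q≡))
          (E.trans (αᵠ≈ w≈-z ψα≈zᵗ) (E.trans (E.-‿cong (E.sym (E.*-identityʳ α))) (ER.-‿distribʳ-* α E.1#))))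
          where
          q≡ : suc (q ℕ.∸ 1) ≡ q
          q≡ = ≡.subst (λ k → suc (k ℕ.∸ 1) ≡ k) (≡.sym q≡1+2h₀) ≡.refl
        αᵠ⁺¹≈-1 : w ≈ - z⁻¹ → α E.^ (q ℕ.+ 1) E.≈ E.- E.1#
        αᵠ⁺¹≈-1 w≈-z⁻¹ = E.trans (EE.^-homo-* α q 1) (E.trans (E.*-cong (αᵠ≈ w≈-z⁻¹ ψα⁻¹≈z⁻ᵗ)
          (E.*-identityʳ α))
          (E.trans (E.sym (ER.-‿distribˡ-* α⁻¹ α)) (E.-‿cong (EF.x⁻¹*x≈1 α≉0))))

      period-bound : 2 ℕ.* t ℕ.≤ s ⊎ (t ℕ.≤ s × OddCase)
      period-bound = [ (λ (h , s≡) → inj₁ (even-period h s≡)) , (λ (h , s≡) → inj₂ (odd-period h s≡)) ]′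
        (parity s)

-- Consequences of a being a non-square.

module QuadraticExtensionProperties {c ℓ c′ ℓ′ : Level} (F : FiniteField c ℓ) (E : QuadraticExtension F c′ ℓ′)
    (a : FiniteField.Carrier F) (a-nonsquare : ¬ FiniteField.IsSquare F a)
    (b : QuadraticExtension.Carrier E) (b∉F : ¬ QuadraticExtension.InBase E b)
    (b²≈ιa : QuadraticExtension._≈_ E (QuadraticExtension._^_ E b 2) (QuadraticExtension.ι E a)) where
  open QuadraticExtension E
  open Algebra.Properties.Semiring.Exp semiring using (^-assocʳ; ^-congˡ)
  open SetoidReasoning ≈-setoid
  private
    module F = FiniteField F
    module FF = FiniteFieldProperties F
    module EF = FiniteFieldProperties extension
    module FExp = Algebra.Properties.Semiring.Exp F.semiring
    ι-isHom = RingMorphisms.IsRingMonomorphism.isRingHomomorphism isRingMonomorphism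
    module ι = RingMorphisms.IsRingHomomorphism ι-isHom
    module ιF = FiniteFieldInDomain F commutativeRing EF.isDomain ι ι-isHom

  b≉0 : b ≉ 0#
  b≉0 b≈0 = b∉F (F.0# , trans ι.0#-homo (sym b≈0))

  -- Both b^q and b are square roots of a, and b^q = b would put b into 𝔽_q.
  b^q≈-b : b ^ F.size ≈ - b
  b^q≈-b = [ (λ b^q≈b → contradiction (ιF.fixed-inImage b^q≈b) b∉F) , id ]′
    (DiscreteDomain.x²≈y² commutativeRing EF.isDomain (begin
      b ^ F.size * b ^ F.size        ≈⟨ *-congˡ (*-identityʳ _) ⟨
      (b ^ F.size) ^ 2               ≈⟨ ^-assocʳ b F.size 2 ⟩
      b ^ (F.size ℕ.* 2)             ≡⟨ ≡.cong (b ^_) (ℕₚ.*-comm F.size 2) ⟩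
      b ^ (2 ℕ.* F.size)             ≈⟨ ^-assocʳ b 2 F.size ⟨
      (b ^ 2) ^ F.size               ≈⟨ ^-congˡ F.size b²≈ιa ⟩
      ι a ^ F.size                   ≈⟨ ιF.image-fixed a ⟩
      ι a                            ≈⟨ b²≈ιa ⟨
      b ^ 2                          ≈⟨ *-congˡ (*-identityʳ _) ⟩
      b * b                          ∎))

  -- In a field of even order every element a = a^q is a square.
  size-odd : Σ[ h ∈ ℕ ] F.size ≡ 1 ℕ.+ 2 ℕ.* h
  size-odd = [ (λ (h , q≡h*2) → contradiction (a F.^ h , F.trans (FExp.^-assocʳ a h 2)
      (F.trans (F.reflexive (≡.cong (a F.^_) (≡.sym q≡h*2))) (FF.x^size≈x a))) a-nonsquare)
    , id ]′ (NumberTheory.parity F.size)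

  isRootOfNonsquare : IsRootOfNonsquare F E a b
  isRootOfNonsquare = record
    { b²≈ιa = b²≈ιa ; b≉0 = b≉0 ; b^q≈-b = b^q≈-b ; h₀ = proj₁ size-odd ; q≡1+2h₀ = proj₂ size-odd }

-- Irreducibility in terms of monic divisors.

module IrreducibleMonic (K : FiniteField c ℓ) where
  private module K = FiniteField K
  open PolynomialRing K.commutativeRing
  open Degrees K.commutativeRing
  open PolynomialsOverFiniteField K
  private module P = CommutativeRing polynomialRing

  private
    1≉[] : ¬ (constant K.1# ≋ [])
    1≉[] 1≋[] = K.1≉0 (1≋[] .at 0)

    no-unit-multiple : ∀ {k p m} w → MonicAt k m → Below k p → (w *ᴾ m) ≋ p → w ≋ []
    no-unit-multiple {k} {p} {m} w mm below eq = multiple-of-monic-Below k m mm w (Below-resp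
      (P.sym eq) below)

  -- In f = w m neither factor can be a unit. If m were, 1 would be a multiple of m of degree below
  -- k; if s w = 1, then m = s f would be a multiple of f of degree below d. Either way the
  -- multiplier vanishes and 1 = 0.
  irreducible⇒NoMonicDivisorBelow : ∀ {d f} → MonicAt d f → Irreducible f → NoMonicDivisorBelow d f
  irreducible⇒NoMonicDivisorBelow {d} {f} f-MonicAt irr k v 0<k k<d (w , w*m≋f) =
    [ w-not-unit , m-not-unit ]′ (RawSemiringDefs.Irreducible.split-∣1 irr {w} {monic v} (at (P.sym w*m≋f)))
    where
    m-not-unit : ¬ (monic v ∣ᴾ constant K.1#)
    m-not-unit (s RawMagmaDefs., s*m≈1) = 1≉[] (P.trans (P.sym (mk≋ s*m≈1)) (P.*-congʳ {monic v}
      (no-unit-multiple {p = constant K.1#} s (monic-MonicAt v) (Below-≤ {p = constant K.1#} 0<k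
        (Below-constant K.1#)) (mk≋ s*m≈1))))
    w-not-unit : ¬ (w ∣ᴾ constant K.1#)
    w-not-unit (s RawMagmaDefs., s*w≈1) = 1≉[] (P.trans (P.sym (mk≋ s*w≈1)) (P.*-congʳ {w}
      (no-unit-multiple s f-MonicAt
      (λ j d≤j → proj₂ (monic-MonicAt v) j (ℕₚ.<-≤-trans k<d d≤j))
      (P.trans (P.*-congˡ {s} (P.sym w*m≋f)) (P.trans (P.sym (P.*-assoc s w (monic v)))
        (P.trans (P.*-congʳ {monic v} {s *ᴾ w} {constant K.1#} (mk≋ s*w≈1)) (P.*-identityˡ (monic v))))))))

  irreducible⇒positive-degree : ∀ {d f} → MonicAt d f → Irreducible f → NonZero d
  irreducible⇒positive-degree {suc d} _ _ = _
  irreducible⇒positive-degree {zero} {f} f-MonicAt irr = contradiction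
    (constant K.1# RawMagmaDefs., at (P.trans (P.*-identityˡ f) (P.sym (monic-truncate 0 f f-MonicAt))))
    (RawSemiringDefs.Irreducible.p∤1 irr)

module QuadraticProduct (R : CommutativeRing c ℓ) where
  open CommutativeRing R
  open CommutativeRingSolver R

  [x-y]*[x-z] : ∀ x y z → (x - y) * (x - z) ≈ (x * x - (y + z) * x) + y * z
  [x-y]*[x-z] = solve 3 (λ x y z → (x :- y) :* (x :- z) := (x :* x :- (y :+ z) :* x) :+ y :* z) refl

-- Identification of the irreducible factor.

module Conclusion {c ℓ c′ ℓ′ c″ ℓ″ : Level}
    (F : FiniteField c ℓ) (E : QuadraticExtension F c′ ℓ′)
    (a : FiniteField.Carrier F) (b : QuadraticExtension.Carrier E)
      (isRootOfNonsquare : IsRootOfNonsquare F E a b)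
    (n : ℕ) {{n≢0 : NonZero n}} (radn∣q-1 : rad n ∣ (FiniteField.size F ℕ.∸ 1))
    (L : CommutativeRing c″ ℓ″) (L-isDomain : IsDiscreteDomain L)
    (ψ : QuadraticExtension.Carrier E → CommutativeRing.Carrier L)
    (ψ-isHom : IsHom (QuadraticExtension.commutativeRing E) L ψ)
    (z z⁻¹ : CommutativeRing.Carrier L) (zz⁻¹≈1 : AreInverse L z z⁻¹)
    (f : PolynomialRing.Poly (FiniteField.commutativeRing F)) (d : ℕ)
    (f-MonicAt : Degrees.MonicAt (FiniteField.commutativeRing F) d f)
    (f-irreducible : PolynomialsOverFiniteField.NoMonicDivisorBelow F d f)
    (f-root : Evaluation.IsRoot L (map (ψ ∘ QuadraticExtension.ι E) f)
      (RootInExtension.x F E a b isRootOfNonsquare n radn∣q-1 L L-isDomain ψ ψ-isHom z z⁻¹ zz⁻¹≈1))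
    (f∣Dₙ : PolynomialsOverFiniteField._∣ₚ_ F f (PolynomialRing.dickson (FiniteField.commutativeRing F) n a))
    where
  private
    module F = FiniteField F
    module E = QuadraticExtension E
    module F[X] = PolynomialRing F.commutativeRing
    module E[X] = PolynomialRing E.commutativeRing
  open IsRootOfNonsquare isRootOfNonsquare
  open CommutativeRing L
  open IsDiscreteDomain L-isDomain
  open Evaluation L hiding (IsRoot)
  open SetoidReasoning setoid
  open RootInExtension F E a b isRootOfNonsquare n radn∣q-1 L L-isDomain ψ ψ-isHom z z⁻¹ zz⁻¹≈1
  open Algebra.Properties.Semiring.Exp semiring
  private
    module LR = Algebra.Properties.Ring ring
    module LX = PolynomialRing L
    module FP = CommutativeRing F[X].polynomialRing
    module FPR = Algebra.Properties.Ring FP.ring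
    module EP = CommutativeRing E[X].polynomialRing
    module FD = Degrees F.commutativeRing
    module ED = Degrees E.commutativeRing
    module φP = PolynomialMap F.commutativeRing L φ φ-isHom
    module ψP = PolynomialMap E.commutativeRing L ψ ψ-isHom
    module ιP = PolynomialMap F.commutativeRing E.commutativeRing E.ι ι-isHom
    module φ = RingMorphisms.IsRingHomomorphism φ-isHom
    module ψ = RingMorphisms.IsRingHomomorphism ψ-isHom
    module EF = FiniteFieldProperties E.extension
    module EExp = Algebra.Properties.Semiring.Exp E.semiring
    module EExpᶜ = Algebra.Properties.CommutativeSemiring.Exp E.commutativeSemiring
    module ER = Algebra.Properties.Ring E.ring
    module ιF = FiniteFieldInDomain F E.commutativeRing EF.isDomain E.ι ι-isHom

  IsRoot : F[X].Poly → Set _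
  IsRoot p = eval (map φ p) x ≈ 0#

  private
    IsRoot-isIdeal : PolynomialsOverFiniteField.IsIdeal F IsRoot
    IsRoot-isIdeal = record
      { resp     = λ p≋p′ root → trans (eval-congˡ x (φP.map-cong (FP.sym p≋p′))) root
      ; -‿closed = λ {p} {p′} root root′ → trans (eval-congˡ x (φP.map-- p p′))
          (trans (eval-- (map φ p) (map φ p′) x) (trans (+-cong root (-‿cong root′)) (-‿inverseʳ 0#)))
      ; *-closed = λ w {p} root → trans (eval-congˡ x (φP.map-* w p))
          (trans (eval-* (map φ w) (map φ p) x) (trans (*-congˡ root) (zeroʳ _)))
      }

    ¬IsRoot-1 : ¬ IsRoot (F[X].constant F.1#)
    ¬IsRoot-1 root = 1≉0 (trans (sym (trans (eval-constant (φ F.1#) x) φ.1#-homo)) root)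

    root-Below⇒zero : ∀ p → FD.Below d p → IsRoot p → p F[X].≋ []
    root-Below⇒zero p below root = [ id , (λ root-1 → contradiction root-1 ¬IsRoot-1) ]′
      (PolynomialsOverFiniteField.ideal-dichotomy F IsRoot-isIdeal
        {f = f} f-root f-irreducible d ℕₚ.≤-refl p below root)

  -- The polynomials vanishing at x form an ideal that contains f but not 1, so by the dichotomy a
  -- member of degree below d is zero. This excludes e < d, and for e = d it applies to f - G, whose
  -- leading terms cancel.
  minimal-polynomial : ∀ {e} G → FD.MonicAt e G → e ℕ.≤ d → IsRoot G → f F[X].≋ G
  minimal-polynomial {e} G G-MonicAt e≤d G-root = [ below , same ]′ (ℕₚ.m≤n⇒m<n∨m≡n e≤d)
    where
    below : e ℕ.< d → f F[X].≋ G
    below e<d = contradiction (F.trans (F.sym (proj₁ G-MonicAt))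
      (root-Below⇒zero G (FD.Below-≤ {p = G} e<d (proj₂ G-MonicAt)) G-root .F[X].at e)) F.1≉0
    same : e ≡ d → f F[X].≋ G
    same ≡.refl = FPR.x∙y⁻¹≈ε⇒x≈y f G (root-Below⇒zero (f F[X].-ᴾ G) difference-Below
      (PolynomialsOverFiniteField.IsIdeal.-‿closed IsRoot-isIdeal {f} {G} f-root G-root))
      where
      equal-above : ∀ j → d ℕ.≤ j → F[X].coeff f j F.≈ F[X].coeff G j
      equal-above j d≤j = [ (λ d<j → F.trans (proj₂ f-MonicAt j d<j) (F.sym (proj₂ G-MonicAt j d<j)))
                          , (λ { ≡.refl → F.trans (proj₁ f-MonicAt) (F.sym (proj₁ G-MonicAt)) }) ]′
                            (ℕₚ.m≤n⇒m<n∨m≡n d≤j)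
      difference-Below : FD.Below d (f F[X].-ᴾ G)
      difference-Below j d≤j = F.trans (F[X].coeff-- f G j)
        (F.trans (F.+-congʳ (equal-above j d≤j)) (F.-‿inverseʳ _))

  z²ⁿ≈-1 : z ^ (2 ℕ.* n) ≈ - 1#
  z²ⁿ≈-1 = dickson-root⇒z²ⁿ≈-1 (begin
    eval (map φ (F[X].dickson n a)) x           ≈⟨ eval-congˡ x (φP.map-cong (proj₂ f∣Dₙ)) ⟨
    eval (map φ (proj₁ f∣Dₙ F[X].*ᴾ f)) x                ≈⟨ PolynomialsOverFiniteField.IsIdeal.*-closed IsRoot-isIdeal (proj₁ f∣Dₙ) {f} f-root ⟩
    0#                                          ∎)

  open Orders z²ⁿ≈-1 public

  map-map : ∀ p → map ψ (map E.ι p) ≡ map φ p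
  map-map p = ≡.sym (Listₚ.map-∘ p)

  D : F[X].Poly
  D = F[X].dickson t a

  D̂ : E[X].Poly
  D̂ = map E.ι D

  D-MonicAt : FD.MonicAt t D
  D-MonicAt = DicksonMonic.dickson-MonicAt F.commutativeRing t a

  γ : E.Carrier
  γ = b E.^ t E.* (α E.+ α⁻¹)

  γ̄ : E.Carrier
  γ̄ = b E.^ (q ℕ.* t) E.* (α E.^ q E.+ α⁻¹ E.^ q)

  γ^q≈γ̄ : γ E.^ q E.≈ γ̄
  γ^q≈γ̄ = E.trans (EExpᶜ.^-distrib-* (b E.^ t) (α E.+ α⁻¹) q)
    (E.*-cong (E.trans (EExp.^-assocʳ b t q) (E.reflexive (≡.cong (b E.^_) (ℕₚ.*-comm t q))))
      (ιF.frobenius-+ α α⁻¹))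

  g₁ g₂ : E[X].Poly
  g₁ = D̂ E[X].-ᴾ E[X].constant γ
  g₂ = D̂ E[X].-ᴾ E[X].constant γ̄

  private
    D̂-c-MonicAt : ∀ e → ED.MonicAt t (D̂ E[X].-ᴾ E[X].constant e)
    D̂-c-MonicAt e = ED.MonicAt-- {p = D̂} {E[X].constant e} (ιP.map-MonicAt {p = D} D-MonicAt)
      (ED.Below-≤ {p = E[X].constant e} (s≤s z≤n) (ED.Below-constant e))

    eval-D̂ : eval (map ψ D̂) x ≈ ψ γ
    eval-D̂ = begin
      eval (map ψ D̂) x               ≡⟨ ≡.cong (λ p → eval p x) (map-map D) ⟩
      eval (map φ D) x               ≈⟨ eval-dickson-x t ⟩
      β ^ t * (z ^ t + z⁻¹ ^ t)      ≈⟨ *-cong (ψP.^-homo b t) (+-cong ψα≈zᵗ ψα⁻¹≈z⁻ᵗ) ⟨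
      ψ (b E.^ t) * (ψ α + ψ α⁻¹)    ≈⟨ *-congˡ (ψ.+-homo α α⁻¹) ⟨
      ψ (b E.^ t) * ψ (α E.+ α⁻¹)    ≈⟨ ψ.*-homo (b E.^ t) (α E.+ α⁻¹) ⟨
      ψ γ                            ∎

    g₁-root : eval (map ψ g₁) x ≈ 0#
    g₁-root = begin
      eval (map ψ g₁) x
        ≈⟨ eval-congˡ x (ψP.map-- D̂ (E[X].constant γ)) ⟩
      eval (map ψ D̂ LX.-ᴾ LX.constant (ψ γ)) x
        ≈⟨ eval-- (map ψ D̂) (LX.constant (ψ γ)) x ⟩
      eval (map ψ D̂) x - eval (LX.constant (ψ γ)) x
        ≈⟨ LR.x≈y⇒x∙y⁻¹≈ε (trans eval-D̂ (sym (eval-constant (ψ γ) x))) ⟩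
      0# ∎

    IsRoot-from : ∀ G {p} → map E.ι G E[X].≋ p → eval (map ψ p) x ≈ 0# → IsRoot G
    IsRoot-from G {p} Ĝ≋p p-root = trans (reflexive (≡.cong (λ r → eval r x) (≡.sym (map-map G))))
      (trans (eval-congˡ x (ψP.map-cong Ĝ≋p)) p-root)

    f̂≋ : ∀ {e} G {p} → map E.ι G E[X].≋ p → ED.MonicAt e p → e ℕ.≤ d → eval
      (map ψ p) x ≈ 0# → map E.ι f E[X].≋ p
    f̂≋ G Ĝ≋p p-MonicAt e≤d p-root = EP.trans (ιP.map-cong (minimal-polynomial G
      (ιP.MonicAt-map⁻¹ ιF.φ-injective {p = G} (ED.MonicAt-resp (EP.sym Ĝ≋p) p-MonicAt)) e≤d
        (IsRoot-from G Ĝ≋p p-root))) Ĝ≋p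

  factor-linear : γ̄ E.≈ γ → t ℕ.≤ d → map E.ι f E[X].≋ g₁
  factor-linear γ̄≈γ t≤d = f̂≋ G Ĝ≋g₁ (D̂-c-MonicAt γ) t≤d g₁-root
    where
    γ∈F = ιF.fixed-inImage (E.trans γ^q≈γ̄ γ̄≈γ)
    G = D F[X].-ᴾ F[X].constant (proj₁ γ∈F)
    Ĝ≋g₁ : map E.ι G E[X].≋ g₁
    Ĝ≋g₁ = EP.trans (ιP.map-- D (F[X].constant (proj₁ γ∈F)))
      (EP.+-congˡ {D̂} (EP.-‿cong (proj₂ γ∈F E[X].∷-cong EP.refl)))

  -- The product is D² - (γ + γ̄) D + γ γ̄. As γ^q = γ̄ and γ̄^q = γ, the trace and the norm are
  -- fixed by the q-th power, so the product comes from a polynomial `H` over 𝔽_q.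
  factor-quadratic : 2 ℕ.* t ℕ.≤ d → map E.ι f E[X].≋ (g₁ E[X].*ᴾ g₂)
  factor-quadratic 2t≤d = f̂≋ H Ĥ≋ (ED.MonicAt-* {p = g₁} {g₂} (D̂-c-MonicAt γ) (D̂-c-MonicAt γ̄))
    (≡.subst (ℕ._≤ d) (≡.cong (t ℕ.+_) (ℕₚ.+-identityʳ t)) 2t≤d)
    (trans (eval-congˡ x (ψP.map-* g₁ g₂)) (trans (eval-* (map ψ g₁) (map ψ g₂) x) (trans (*-congʳ g₁-root)
      (zeroˡ _))))
    where
    γ̄^q≈γ : γ̄ E.^ q E.≈ γ
    γ̄^q≈γ = E.trans (EExp.^-congˡ q (E.sym γ^q≈γ̄)) (E.trans (EExp.^-assocʳ γ q q)
      (E.trans (E.reflexive (≡.cong (γ E.^_) (≡.trans (≡.cong (q ℕ.*_) (≡.sym (ℕₚ.*-identityʳ q)))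
        (≡.sym E.size≡)))) (EF.x^size≈x γ)))
    trace∈F = ιF.fixed-inImage {γ E.+ γ̄} (E.trans (ιF.frobenius-+ γ γ̄) (E.trans (E.+-cong γ^q≈γ̄ γ̄^q≈γ)
      (E.+-comm γ̄ γ)))
    norm∈F = ιF.fixed-inImage {γ E.* γ̄} (E.trans (EExpᶜ.^-distrib-* γ γ̄ q) (E.trans
      (E.*-cong γ^q≈γ̄ γ̄^q≈γ) (E.*-comm γ̄ γ)))
    tr = F[X].constant (proj₁ trace∈F)
    nm = F[X].constant (proj₁ norm∈F)
    H = (D F[X].*ᴾ D F[X].-ᴾ tr F[X].*ᴾ D) F[X].+ᴾ nm
    Γ = E[X].constant γ
    Γ̄ = E[X].constant γ̄
    Ĥ≋ : map E.ι H E[X].≋ (g₁ E[X].*ᴾ g₂)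
    Ĥ≋ = EP.trans (ιP.map-+ (D F[X].*ᴾ D F[X].-ᴾ tr F[X].*ᴾ D) nm)
      (EP.trans (EP.+-cong
        (EP.trans (ιP.map-- (D F[X].*ᴾ D) (tr F[X].*ᴾ D))
          (EP.+-cong (ιP.map-* D D) (EP.-‿cong (EP.trans (ιP.map-* tr D)
            (EP.*-congʳ {D̂} {map E.ι tr} {Γ E[X].+ᴾ Γ̄} (proj₂ trace∈F E[X].∷-cong EP.refl))))))
        (E.trans (proj₂ norm∈F) (E.sym (E.+-identityʳ _)) E[X].∷-cong EP.refl))
        (EP.sym (QuadraticProduct.[x-y]*[x-z] E[X].polynomialRing D̂ Γ Γ̄)))

  InCaseA : Set _
  InCaseA =
    (2 ∣ t × (E.InBase α ⊎ α E.^ (q ℕ.+ 1) E.≈ E.1#))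
    ⊎ (¬ (2 ∣ t) × (α E.^ (q ℕ.∸ 1) E.≈ E.- E.1# ⊎ α E.^ (q ℕ.+ 1) E.≈ E.- E.1#))

  private
    inverse-unique : ∀ {u u′ v v′} → u E.* u′ E.≈ E.1# → v E.* v′ E.≈ E.1# → u E.≈ v → u′ E.≈ v′
    inverse-unique {u} {u′} {v} {v′} uu′≈1 vv′≈1 u≈v = E.trans (E.sym (E.*-identityʳ u′)) (E.trans
      (E.*-congˡ (E.sym vv′≈1))
      (E.trans (E.sym (E.*-assoc u′ v v′)) (E.trans (E.*-congʳ (E.trans (E.*-congˡ (E.sym u≈v)) (E.trans
        (E.*-comm u′ u) uu′≈1)))
        (E.*-identityˡ v′))))

    αα⁻¹≈1 : α E.* α⁻¹ E.≈ E.1#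
    αα⁻¹≈1 = EF.x*x⁻¹≈1 α≉0

    αᵠ*α⁻ᵠ≈1 : α E.^ q E.* α⁻¹ E.^ q E.≈ E.1#
    αᵠ*α⁻ᵠ≈1 = E.trans (E.sym (EExpᶜ.^-distrib-* α α⁻¹ q)) (E.trans (EExp.^-congˡ q αα⁻¹≈1)
      (UnitPowers.1^k≈1 E.commutativeRing q))

    sum≈ : ∀ {v v′} → v E.* v′ E.≈ E.1# → α E.^ q E.≈ v → α E.^ q E.+ α⁻¹ E.^ q E.≈ v E.+ v′
    sum≈ vv′≈1 αᵠ≈v = E.+-cong αᵠ≈v (inverse-unique αᵠ*α⁻ᵠ≈1 vv′≈1 αᵠ≈v)

    -v*-v′≈1 : ∀ {v v′} → v E.* v′ E.≈ E.1# → E.- v E.* E.- v′ E.≈ E.1#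
    -v*-v′≈1 {v} {v′} vv′≈1 = E.trans (E.sym (ER.-‿distribˡ-* v (E.- v′)))
      (E.trans (E.-‿cong (E.sym (ER.-‿distribʳ-* v v′))) (E.trans (ER.-‿involutive _) vv′≈1))

    αᵠ⁺¹ : α E.^ (q ℕ.+ 1) E.≈ α E.^ q E.* α
    αᵠ⁺¹ = E.trans (EExp.^-homo-* α q 1) (E.*-congˡ (E.*-identityʳ α))

    αᵠ⁺¹≈⇒αᵠ≈ : ∀ {e} → α E.^ (q ℕ.+ 1) E.≈ e → α E.^ q E.≈ e E.* α⁻¹
    αᵠ⁺¹≈⇒αᵠ≈ eq = E.trans (E.sym (E.trans (E.*-assoc _ α α⁻¹) (E.trans (E.*-congˡ αα⁻¹≈1)
      (E.*-identityʳ _))))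
      (E.*-congʳ (E.trans (E.sym αᵠ⁺¹) eq))

    α⁻¹α≈1 : α⁻¹ E.* α E.≈ E.1#
    α⁻¹α≈1 = EF.x⁻¹*x≈1 α≉0

    bᵠᵗ : b E.^ (q ℕ.* t) E.≈ (E.- b) E.^ t
    bᵠᵗ = E.trans (E.sym (EExp.^-assocʳ b q t)) (EExp.^-congˡ t b^q≈-b)

    [-b]² : (E.- b) E.^ 2 E.≈ b E.^ 2
    [-b]² = E.trans (E.*-congˡ (E.*-identityʳ _)) (E.trans (E.sym (ER.-‿distribˡ-* b (E.- b)))
      (E.trans (E.-‿cong (E.sym (ER.-‿distribʳ-* b b))) (E.trans (ER.-‿involutive _) (E.*-congˡ (E.sym
        (E.*-identityʳ b))))))

    [-b]²ᵏ : ∀ k → (E.- b) E.^ (2 ℕ.* k) E.≈ b E.^ (2 ℕ.* k)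
    [-b]²ᵏ k = E.trans (E.sym (EExp.^-assocʳ (E.- b) 2 k)) (E.trans (EExp.^-congˡ k [-b]²)
      (EExp.^-assocʳ b 2 k))

    even⇒bᵠᵗ≈bᵗ : 2 ∣ t → b E.^ (q ℕ.* t) E.≈ b E.^ t
    even⇒bᵠᵗ≈bᵗ (divides k t≡k*2) = E.trans bᵠᵗ (≡.subst (λ j → (E.- b) E.^ j E.≈ b E.^ j)
      (≡.trans (ℕₚ.*-comm 2 k) (≡.sym t≡k*2)) ([-b]²ᵏ k))

    odd⇒bᵠᵗ≈-bᵗ : ¬ (2 ∣ t) → b E.^ (q ℕ.* t) E.≈ E.- (b E.^ t)
    odd⇒bᵠᵗ≈-bᵗ 2∤t = E.trans bᵠᵗ ([ (λ (k , t≡k*2) → contradiction (divides k t≡k*2) 2∤t)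
      , (λ (k , t≡1+2k) → ≡.subst (λ j → (E.- b) E.^ j E.≈ E.- (b E.^ j)) (≡.sym t≡1+2k)
          (E.trans (E.*-congˡ ([-b]²ᵏ k)) (E.sym (ER.-‿distribˡ-* b _)))) ]′ (NumberTheory.parity t))

    -- `v` is α or α⁻¹: the two even conditions of case (a) say that α^q is one of these, which
    -- leaves α + α⁻¹ unchanged, and b^t is fixed because conjugation only negates b.
    even-case : 2 ∣ t → ∀ {v v′} → v E.+ v′ E.≈ α E.+ α⁻¹ → v E.* v′ E.≈ E.1# → α E.^ q E.≈ v → γ̄ E.≈ γ
    even-case 2∣t v+v′≈ vv′≈1 αᵠ≈v = E.*-cong (even⇒bᵠᵗ≈bᵗ 2∣t) (E.trans (sum≈ vv′≈1 αᵠ≈v) v+v′≈)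

    -- Here α^q is -α or -α⁻¹. Conjugation negates both b^t and α + α⁻¹, and the signs cancel in the
    -- product.
    odd-case : ¬ (2 ∣ t) → ∀ {v v′} → v E.+ v′ E.≈ α E.+ α⁻¹ → v E.* v′ E.≈ E.1# → α E.^ q E.≈ E.- v → γ̄ E.≈ γ
    odd-case 2∤t {v} {v′} v+v′≈ vv′≈1 αᵠ≈-v = E.trans
      (E.*-cong (odd⇒bᵠᵗ≈-bᵗ 2∤t) (E.trans (sum≈ (-v*-v′≈1 vv′≈1) αᵠ≈-v) (E.trans (ER.-‿+-comm v v′)
        (E.-‿cong v+v′≈))))
      (E.trans (E.sym (ER.-‿distribˡ-* (b E.^ t) _)) (E.trans (E.-‿cong (E.sym (ER.-‿distribʳ-*
        (b E.^ t) _))) (ER.-‿involutive _)))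

  inCaseA⇒γ̄≈γ : InCaseA → γ̄ E.≈ γ
  inCaseA⇒γ̄≈γ (inj₁ (2∣t , inj₁ (e , ιe≈α))) = even-case 2∣t E.refl αα⁻¹≈1
    (E.trans (EExp.^-congˡ q (E.sym ιe≈α)) (E.trans (ιF.image-fixed e) ιe≈α))
  inCaseA⇒γ̄≈γ (inj₁ (2∣t , inj₂ αᵠ⁺¹≈1)) = even-case 2∣t (E.+-comm α⁻¹ α) α⁻¹α≈1
    (E.trans (αᵠ⁺¹≈⇒αᵠ≈ αᵠ⁺¹≈1) (E.*-identityˡ α⁻¹))
  inCaseA⇒γ̄≈γ (inj₂ (2∤t , inj₁ αᵠ⁻¹≈-1)) = odd-case 2∤t E.refl αα⁻¹≈1
    (E.trans (E.reflexive (≡.cong (α E.^_) q≡)) (E.trans (E.*-congˡ αᵠ⁻¹≈-1)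
      (E.trans (E.sym (ER.-‿distribʳ-* α E.1#)) (E.-‿cong (E.*-identityʳ α)))))
    where
    q≡ : q ≡ suc (q ℕ.∸ 1)
    q≡ = ≡.subst (λ k → k ≡ suc (k ℕ.∸ 1)) (≡.sym q≡1+2h₀) ≡.refl
  inCaseA⇒γ̄≈γ (inj₂ (2∤t , inj₂ αᵠ⁺¹≈-1)) = odd-case 2∤t (E.+-comm α⁻¹ α) α⁻¹α≈1
    (E.trans (αᵠ⁺¹≈⇒αᵠ≈ αᵠ⁺¹≈-1) (ER.-1*x≈-x α⁻¹))

  degree-bound : 2 ℕ.* t ℕ.≤ d ⊎ (t ℕ.≤ d × OddCase)
  degree-bound = bound (period f f-MonicAt f-root)
    where
    bound : (Σ[ s ∈ ℕ ] 0 ℕ.< s × s ℕ.≤ d × x ^ (q ℕ.^ s) ≈ x) → 2 ℕ.* t ℕ.≤ d ⊎ (t ℕ.≤ d × OddCase)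
    bound (s , 0<s , s≤d , xᴺ≈x) = [ (λ 2t≤s → inj₁ (ℕₚ.≤-trans 2t≤s s≤d))
      , (λ (t≤s , odd) → inj₂ (ℕₚ.≤-trans t≤s s≤d , odd)) ]′ (period-bound s 0<s xᴺ≈x)

  -- `g₁` descends to 𝔽_q, so t ≤ d is enough, and both branches of the degree bound provide it.
  case-a : InCaseA → map E.ι f E[X].≈ᴾ g₁
  case-a inA = factor-linear (inCaseA⇒γ̄≈γ inA)
    ([ (λ 2t≤d → ℕₚ.≤-trans (ℕₚ.m≤n*m t 2) 2t≤d) , proj₁ ]′ degree-bound) .E[X].at

  case-b : ¬ InCaseA → map E.ι f E[X].≈ᴾ (g₁ E[X].*ᴾ g₂)
  case-b ¬inA = factor-quadratic
    ([ id , (λ (_ , odd) → contradiction (inj₂ odd) ¬inA) ]′ degree-bound) .E[X].at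

-- Construction of a domain containing z.

module SplittingDomain (K : FiniteField c ℓ)
    {b : FiniteField.Carrier K} (b≉0 : ¬ FiniteField._≈_ K b (FiniteField.0# K))
    {d : ℕ} (p : PolynomialRing.Poly (FiniteField.commutativeRing K))
    (p-MonicAt : Degrees.MonicAt (FiniteField.commutativeRing K) (suc d) p) where
  private module K = FiniteField K
  open FiniteFieldProperties K using (x*x⁻¹≈1)
  open PolynomialRing K.commutativeRing
  open Degrees K.commutativeRing
  open PolynomialsOverFiniteField K
  open ReciprocalSubstitution K.commutativeRing (x*x⁻¹≈1 b≉0)
  private
    module P = CommutativeRing polynomialRing
    v = truncate (suc d) p

  abstract
    factor : Σ[ k ∈ ℕ ] Σ[ w ∈ Vec K.Carrier (suc k) ]
             monic w ∣ₚ substituted v × NoMonicDivisorBelow (suc k) (monic w)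
    factor = irreducible-factor {p = substituted v} (substituted-MonicAt v)

  open Quotient (proj₁ (proj₂ factor)) (proj₂ (proj₂ (proj₂ factor))) public
  private
    module L = CommutativeRing quotientRing
    module LR = Algebra.Properties.Ring L.ring
    module LE = Algebra.Properties.Semiring.Exp L.semiring
    module LD = DiscreteDomain quotientRing quotient-isDomain
    open Evaluation quotientRing using (eval; eval-congˡ)

    substituted~0 : substituted v ~ []
    substituted~0 = ∣′⇒~0 (proj₁ (proj₂ (proj₂ factor)))

    tail = List.drop 1 (substituted v)

    substituted≋1+root*tail : substituted v ≋ (constant K.1# +ᴾ root *ᴾ tail)
    substituted≋1+root*tail = P.trans
      (mk≋ λ { zero    → K.trans (substituted-constant v) (K.sym (K.+-identityʳ _))
             ; (suc k) → K.sym (K.reflexive (coeff-drop (substituted v) k)) })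
      (P.+-congˡ {constant K.1#} (P.sym (root-* tail)))

  -- The substituted polynomial is 1 + Z · `tail`, because its constant term is 1, and it vanishes
  -- in the quotient.
  root⁻¹ : Poly
  root⁻¹ = -ᴾ tail

  root*root⁻¹~1 : (root *ᴾ root⁻¹) ~ constant K.1#
  root*root⁻¹~1 = L.trans (L.sym (LR.-‿distribʳ-* root tail)) (L.sym (LR.+-inverseˡ-unique (constant K.1#)
    (root *ᴾ tail)
    (L.trans (L.sym (≈⇒~ substituted≋1+root*tail)) substituted~0)))

  -- By `eval-substituted`, z^{d+1} p(b(z + 1/z)) is a multiple of the substituted polynomial at z,
  -- which vanishes; the power of the unit z cancels.
  polynomial-root : eval (map constant p) (constant b *ᴾ (root +ᴾ root⁻¹)) ~ []
  polynomial-root = L.trans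
    (eval-congˡ (constant b *ᴾ (root +ᴾ root⁻¹))
      (PolynomialMap.map-cong K.commutativeRing quotientRing constant constant-isHom (P.sym (monic-truncate
        (suc d) p p-MonicAt)))) $ [ (λ zᵈ~0 → contradiction (LD.x^k≈0⇒x≈0 (suc d) zᵈ~0) root≁0) , id ]′
    (IsDiscreteDomain.integral quotient-isDomain (L.trans
      (L.sym (eval-substituted quotientRing constant constant-isHom root*root⁻¹~1 v))
      (L.trans (L.*-congˡ {constant b LE.^ suc d} (L.trans (eval-root (substituted v)) substituted~0))
        (L.zeroʳ (constant b LE.^ suc d)))))
    where
    root≁0 : ¬ (root ~ [])
    root≁0 root~0 = IsDiscreteDomain.1≉0 quotient-isDomain
      (L.trans (L.sym root*root⁻¹~1) (L.trans (L.*-congʳ {root⁻¹} root~0) (L.zeroˡ root⁻¹)))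

theorem3p3 : ∀ {c ℓ c′ ℓ′ : Level} (F : FiniteField c ℓ) (E : QuadraticExtension F c′ ℓ′) →
    let module F = FiniteField F
        module F[X] = Polynomial F.rawRing
        open QuadraticExtension E
        open Polynomial rawRing
        q = F.size
    in
    (a : F.Carrier) → ¬ F.IsSquare a →
    (b : Carrier) → ¬ InBase b → b ^ 2 ≈ ι a →
    (n : ℕ) .{{_ : NonZero n}} → rad n ∣ (q ℕ.∸ 1) →
    (f : F[X].Poly) → F[X].Irreducible f → F[X].Monic f → f F[X].∣ᴾ F[X].dickson n a →
    Σ[ α ∈ Carrier ] Σ[ α≉0 ∈ α ≉ 0# ]
    Σ[ t ∈ ℕ ] Σ[ t≢0 ∈ NonZero t ]
    Σ[ ord ∈ ℕ ] Σ[ isOrder ∈ IsOrder α ord ]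
      let α⁻¹ = inv α α≉0
          f̂ = map ι f
          Dₜ = map ι (F[X].dickson t {{t≢0}} a)
          inCaseA =
            (2 ∣ t × (InBase α ⊎ α ^ (q ℕ.+ 1) ≈ 1#))
            ⊎ (¬ (2 ∣ t) × (α ^ (q ℕ.∸ 1) ≈ - 1# ⊎ α ^ (q ℕ.+ 1) ≈ - 1#))
          g₁ = Dₜ -ᴾ constant (b ^ t * (α + α⁻¹))
          g₂ = Dₜ -ᴾ constant (b ^ (q ℕ.* t) * (α ^ q + α⁻¹ ^ q))
      in
      t ∣ _/_ (4 ℕ.* n) (gcd (4 ℕ.* n) (q ℕ.^ 2 ℕ.∸ 1)) {{gcd[4n,m]≢0 n _}}
      × α ^ (_/_ (2 ℕ.* n) t {{t≢0}}) ≈ - 1#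
      × rad t ∣ ord
      × gcd t (_/_ (q ℕ.^ 2 ℕ.∸ 1) ord {{IsOrder.nonZero isOrder}}) ≡ 1
      × (inCaseA → f̂ ≈ᴾ g₁)
      × (¬ inCaseA → f̂ ≈ᴾ g₁ *ᴾ g₂)
theorem3p3 F E a a-nonsquare b b∉F b²≈ιa n radn∣q-1 f f-irr (zero , f-MonicAt) f∣Dₙ =
  contradiction ≡.refl (ℕ.≢-nonZero⁻¹ 0 {{IrreducibleMonic.irreducible⇒positive-degree F {f = f} f-MonicAt f-irr}})
theorem3p3 F E a a-nonsquare b b∉F b²≈ιa n radn∣q-1 f f-irr (suc d-1 , f-MonicAt) (g RawMagmaDefs., g*f≈Dₙ) =
  α , α≉0 , t , _ , ord , isOrder ,
  t∣4n/gcd {{gcd[4n,m]≢0 n _}} , condition-i , condition-ii , condition-iii , case-a , case-b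
  where
  module F = FiniteField F
  module E = QuadraticExtension E
  module EP = PolynomialRing E.commutativeRing
  ι-isHom = RingMorphisms.IsRingMonomorphism.isRingHomomorphism E.isRingMonomorphism
  open QuadraticExtensionProperties F E a a-nonsquare b b∉F b²≈ιa
  open SplittingDomain E.extension b≉0 (map E.ι f)
    (PolynomialMap.map-MonicAt F.commutativeRing E.commutativeRing E.ι ι-isHom {p = f} f-MonicAt)
  module L = CommutativeRing quotientRing
  f-root : Evaluation.eval quotientRing (map (EP.constant ∘ E.ι) f) (EP.constant b EP.*ᴾ (root EP.+ᴾ root⁻¹)) ~ []
  f-root = ≡.subst (λ p → Evaluation.eval quotientRing p (EP.constant b EP.*ᴾ (root EP.+ᴾ root⁻¹)) ~ [])
    (≡.sym (Listₚ.map-∘ f)) polynomial-root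
  open Conclusion F E a b isRootOfNonsquare n {{ℕ.≢-nonZero (ℕ.≢-nonZero⁻¹ n)}} radn∣q-1
    quotientRing quotient-isDomain EP.constant constant-isHom root root⁻¹ root*root⁻¹~1
    f (suc d-1) f-MonicAt (IrreducibleMonic.irreducible⇒NoMonicDivisorBelow F f-MonicAt f-irr)
    f-root (g , PolynomialRing.mk≋ g*f≈Dₙ)
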